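{- Let $\Phi$ be the property of being regular. Then for all integers $n\ge3$, $$\tau_\Phi(n,0)=\max\{1,n-3\}.$$ Further, up to isomorphism, the nonlinear regular betweenness structures of minimum co-size (that is, those regular betweenness structures of order $n\geq 3$ whose co-size equals $\tau_\Phi(n,0)$) are the following: - $\mathcal{Q}_n^3$ for $n\ge4$; - $\mathcal{R}_{n,i}^3$ for $n\ge4$, $i\in I_n^3$; - $\mathcal{S}_n^3$ for $n\ge4$; - $\mathcal{B}(K_3)$, where $K_3$ is the complete graph on three vertices with unit edge weights.
   Context: A betweenness structure is a pair $\mathcal{B}=(X,\beta)$ where $X$ is a nonempty finite set and $\beta\subseteq X^3$; write $(x\ y\ z)$ for $(x,y,z)\in\beta$. All betweenness structures are assumed to be almost-metrizable, i.e. for all $x,y,z,w\in X$: (P1) $(x\ x\ z)$; (P2) $(x\ y\ z)\Rightarrow(z\ y\ x)$; (P3) $(x\ y\ z)\wedge(y\ x\ z)\Rightarrow x=y$; (P4) $(x\ y\ z)\wedge(x\ w\ y)\Rightarrow(x\ w\ z)\wedge(w\ y\ z)$. The order of $\mathcal{B}$ is $|X|$. A set of three distinct points is collinear if some ordering of it is in $\beta$; otherwise it is a triangle. The co-size of $\mathcal{B}$ is its number of triangles; $\mathcal{B}$ is linear if its co-size is $0$, and nonlinear otherwise. The substructure induced by nonempty $Y\subseteq X$ is $(Y,\beta\cap Y^3)$. Isomorphisms are bijections of ground sets preserving betweenness in both directions. Graphs are connected with positive real edge weights (weight $1$ unless specified). For a graph $W$ with shortest-path metric $d_W$ (path length is the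 sum of edge weights), the betweenness structure $\mathcal{B}(W)$ induced by $W$ lives on the vertex set and has $(x\ y\ z)$ iff $d_W(x,z)=d_W(x,y)+d_W(y,z)$. A betweenness structure is regular if no four of its points induce a substructure isomorphic to $\mathcal{B}(C_4)$, where $C_4$ is the $4$-cycle with unit weights. For a hereditary property $\Phi$ of betweenness structures, $B_\Phi(n,m)$ is the set of betweenness structures of order $n$ and co-size $m$ that satisfy $\Phi$, and $\tau_\Phi(n,k)=\min\{m>k:B_\Phi(n,m)\ne\emptyset\}$. Let $I_n^3=\{i\in\mathbb{N}:1\le i\le n-3\}$. The following graphs have vertex set $\{x_1,\dots,x_{n-2},y,z\}$ and are obtained from the path $P=x_1x_2\ldots x_{n-2}$: - $Q_n^3$ ($n\ge4$): add edges $\{y,x_1\}$ and $\{z,x_1\}$; - $R_{n,i}^3$ ($n\ge4$, $i\in I_n^3$): delete edge $\{x_i,x_{i+1}\}$, add edges $\{y,x_i\},\{z,x_i\}$, and add edges $\{y,x_{i+1}\},\{z,x_{i+1}\}$ of weight $2$; - $S_n^3$ ($n\ge4$): add edge $\{x_1,y\}$, and add edge $\{x_{n-2},z\}$ of weight $2$ and edge $\{y,z\}$ of weight $n-2$. $\mathcal{Q}_n^3,\mathcal{R}_{n,i}^3,\mathcal{S}_n^3$ are the betweenness structures induced by $Q_n^3,R_{n,i}^3,S_n^3$. -}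

module Defs where

open import Data.Bool using (true; false; if_then_else_)
open import Data.Fin as Fin using (Fin; zero; suc; toℕ; inject₁; fromℕ)
open import Data.Fin.Induction using (<-weakInduction)
open import Data.Fin.Patterns using (0F; 1F; 2F; 3F)
import Data.Fin.Properties as Fin
open import Data.List using (List; length; filter; allFin; cartesianProduct)
open import Data.Nat using (ℕ; zero; suc; _+_; _∸_; _⊔_; _≤_; _<_; z≤n; s≤s; NonZero; _≟_; _≤?_; _<?_)
open import Data.Nat.Induction using (Acc; acc; <-wellFounded)
open import Data.Nat.Properties
open import Data.Product using (∃; ∃-syntax; _×_; _,_; proj₁; proj₂)
open import Data.Sum using (_⊎_; inj₁; inj₂)
open import Function using (_∘_; _↔_; _↣_; _⇔_; Inverse; Injection; mk↔ₛ′)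
open import Function.Construct.Identity using (↔-id)
open import Relation.Binary using (DecidableEquality)
open import Relation.Binary.PropositionalEquality
open import Relation.Nullary using (¬_; Dec; yes; no; does; map′; contradiction; ¬?; _×-dec_; _⊎-dec_)
open import Relation.Nullary.Decidable using (dec-true; dec-false)

------------------------------------------------------------------------
-- Betweenness structures

-- The ground set is a finite type with a chosen enumeration, used only to
-- count; decidability of β makes the co-size a natural number.

record Betweenness : Set₁ where
  field
    X     : Set
    order : ℕ
    ⦃ nonempty ⦄ : NonZero order
    enum  : Fin order ↔ X
    β     : X → X → X → Set
    β?    : ∀ x y z → Dec (β x y z)
    P1    : ∀ x z → β x x z
    P2    : ∀ x y z → β x y z → β z y x
    P3    : ∀ x y z → β x y z → β y x z → x ≡ y
    P4    : ∀ x y z w → β x y z → β x w y → β x w z × β w y z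

  point : Fin order → X
  point = Inverse.to enum

  -- To be used for pairwise distinct a, b, c.
  Collinear : X → X → X → Set
  Collinear a b c =
    β a b c ⊎ β a c b ⊎ β b a c ⊎ β b c a ⊎ β c a b ⊎ β c b a

  Collinear? : ∀ a b c → Dec (Collinear a b c)
  Collinear? a b c =
    β? a b c ⊎-dec β? a c b ⊎-dec β? b a c ⊎-dec
    β? b c a ⊎-dec β? c a b ⊎-dec β? c b a

  -- Each set of three distinct points is listed once, by increasing index.
  Triangle : Fin order × Fin order × Fin order → Set
  Triangle (i , j , k) =
    i Fin.< j × j Fin.< k × ¬ Collinear (point i) (point j) (point k)

  Triangle? : ∀ t → Dec (Triangle t)
  Triangle? (i , j , k) =
    (i Fin.<? j) ×-dec (j Fin.<? k) ×-dec ¬? (Collinear? (point i) (point j) (point k))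

  triangles : List (Fin order × Fin order × Fin order)
  triangles =
    filter Triangle?
      (cartesianProduct (allFin order) (cartesianProduct (allFin order) (allFin order)))

  cosize : ℕ
  cosize = length triangles

open Betweenness public using (order; cosize)

infix 4 _≅_

record _≅_ (A B : Betweenness) : Set where
  private
    module A = Betweenness A
    module B = Betweenness B
  field
    bijection : A.X ↔ B.X
  open Inverse bijection public using (to; from)
  field
    preserves : ∀ x y z → A.β x y z ⇔ B.β (to x) (to y) (to z)

-- The substructure induced by the m-element subset that is the image of Y.

induced : ∀ (B : Betweenness) {m} ⦃ _ : NonZero m ⦄ →
          (Fin m ↣ Betweenness.X B) → Betweenness
induced B {m} Y = record
  { X     = Fin m
  ; order = m
  ; enum  = ↔-id (Fin m)
  ; β     = λ i j k → β (f i) (f j) (f k)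
  ; β?    = λ i j k → β? (f i) (f j) (f k)
  ; P1    = λ i k → P1 (f i) (f k)
  ; P2    = λ i j k → P2 (f i) (f j) (f k)
  ; P3    = λ i j k p q → Injection.injective Y (P3 (f i) (f j) (f k) p q)
  ; P4    = λ i j k l → P4 (f i) (f j) (f k) (f l)
  }
  where
  open Betweenness B using (X; β; β?; P1; P2; P3; P4)
  f : Fin m → X
  f = Injection.to Y

------------------------------------------------------------------------
-- Weighted graphs and their shortest-path metric

-- w u v is the weight of the edge {u, v}, and 0 if there is no such edge.

data Walk {V : Set} (w : V → V → ℕ) : V → V → ℕ → Set where
  []   : ∀ {u} → Walk w u u 0
  step : ∀ {u t v l} → 0 < w u t → Walk w t v l → Walk w u v (w u t + l)

record Graph : Set₁ where
  field
    V         : Set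
    size      : ℕ
    ⦃ nonempty ⦄ : NonZero size
    enum      : Fin size ↔ V
    weight    : V → V → ℕ
    symmetric : ∀ u v → weight u v ≡ weight v u
    loopless  : ∀ v → weight v v ≡ 0
    connected : ∀ u v → ∃[ l ] Walk weight u v l

module _ {V : Set} {w : V → V → ℕ} where

  _++_ : ∀ {u t v l m} → Walk w u t l → Walk w t v m → Walk w u v (l + m)
  []                   ++ q = q
  step {u} {t} {l = l} e p ++ q =
    subst (Walk w _ _) (sym (+-assoc (w u t) l _)) (step e (p ++ q))

  module _ (w-sym : ∀ u v → w u v ≡ w v u) where

    edge : ∀ {u v} → 0 < w u v → Walk w u v (w u v)
    edge e = subst (Walk w _ _) (+-identityʳ _) (step e [])

    reverse : ∀ {u v l} → Walk w u v l → Walk w v u l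
    reverse [] = []
    reverse (step {u} {t} {l = l} e p) =
      subst (Walk w _ _) eq (reverse p ++ edge (subst (0 <_) (w-sym u t) e))
      where
      eq : l + w t u ≡ w u t + l
      eq = trans (+-comm l (w t u)) (cong (_+ l) (w-sym t u))

    connected-via : (r : V) → (∀ u → ∃ (Walk w u r)) → ∀ u v → ∃ (Walk w u v)
    connected-via r h u v = _ , proj₂ (h u) ++ reverse (proj₂ (h v))

-- The least element of an inhabited decidable set of natural numbers.

Least : (ℕ → Set) → ℕ → Set
Least P d = P d × ∀ l → P l → d ≤ l

least : ∀ {P : ℕ → Set} → (∀ l → Dec (P l)) → ∀ n → P n → ∃ (Least P)
least P? zero p = 0 , p , λ _ _ → z≤n
least {P} P? (suc n) p with P? 0
... | yes p₀ = 0 , p₀ , λ _ _ → z≤n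
... | no ¬p₀ with least (P? ∘ suc) n p
...   | d , pd , min = suc d , pd , min′
  where
  min′ : ∀ l → P l → suc d ≤ l
  min′ zero    q = contradiction q ¬p₀
  min′ (suc l) q = s≤s (min l q)

module ShortestPath (W : Graph) where
  open Graph W

  _≟V_ : DecidableEquality V
  u ≟V v = map′ inj (cong from) (from u Fin.≟ from v)
    where
    open Inverse enum using (to; from; strictlyInverseˡ)
    inj : from u ≡ from v → u ≡ v
    inj eq = trans (sym (strictlyInverseˡ u)) (trans (cong to eq) (strictlyInverseˡ v))

  anyV? : {P : V → Set} → (∀ v → Dec (P v)) → Dec (∃ P)
  anyV? {P} P? =
    map′ (λ (i , p) → to i , p)
         (λ (v , p) → from v , subst P (sym (strictlyInverseˡ v)) p)
         (Fin.any? (P? ∘ to))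
    where open Inverse enum using (to; from; strictlyInverseˡ)

  FirstStep : V → V → ℕ → V → Set
  FirstStep u v l t =
    0 < weight u t × weight u t ≤ l × Walk weight t v (l ∸ weight u t)

  fromFirst : ∀ {u v l} → (l ≡ 0 × u ≡ v) ⊎ ∃ (FirstStep u v l) → Walk weight u v l
  fromFirst (inj₁ (refl , refl))         = []
  fromFirst (inj₂ (t , pos , le , rest)) =
    subst (Walk weight _ _) (m+[n∸m]≡n le) (step pos rest)

  toFirst : ∀ {u v l} → Walk weight u v l → (l ≡ 0 × u ≡ v) ⊎ ∃ (FirstStep u v l)
  toFirst [] = inj₁ (refl , refl)
  toFirst (step {u} {t} {l = l} pos p) =
    inj₂ (t , pos , m≤m+n _ _ ,
          subst (Walk weight t _) (sym (m+n∸m≡n (weight u t) l)) p)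

  walkAcc? : ∀ l → Acc _<_ l → ∀ u v → Dec (Walk weight u v l)
  walkAcc? l (acc rs) u v =
    map′ fromFirst toFirst (((l ≟ 0) ×-dec (u ≟V v)) ⊎-dec anyV? first?)
    where
    first? : ∀ t → Dec (FirstStep u v l t)
    first? t with 0 <? weight u t | weight u t ≤? l
    ... | no ¬p  | _      = no (¬p ∘ proj₁)
    ... | yes _  | no ¬q  = no (¬q ∘ proj₁ ∘ proj₂)
    ... | yes p  | yes q  =
      map′ (λ r → p , q , r) (proj₂ ∘ proj₂)
           (walkAcc? (l ∸ weight u t) (rs (∸-monoʳ-< p q)) t v)

  walk? : ∀ u v l → Dec (Walk weight u v l)
  walk? u v l = walkAcc? l (<-wellFounded l) u v

  -- The minimum is taken over all walks.  As edge weights are positive, a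
  -- walk of least weight repeats no vertex, so this is also the minimum
  -- over paths.

  shortest : ∀ u v → ∃ (Least (Walk weight u v))
  shortest u v = least (walk? u v) _ (proj₂ (connected u v))

  d : V → V → ℕ
  d u v = proj₁ (shortest u v)

  d-walk : ∀ u v → Walk weight u v (d u v)
  d-walk u v = proj₁ (proj₂ (shortest u v))

  d-least : ∀ {u v l} → Walk weight u v l → d u v ≤ l
  d-least {u} {v} p = proj₂ (proj₂ (shortest u v)) _ p

  d-refl : ∀ u → d u u ≡ 0
  d-refl u = n≤0⇒n≡0 (d-least [])

  d-sym : ∀ u v → d u v ≡ d v u
  d-sym u v = ≤-antisym (d-least (reverse symmetric (d-walk v u)))
                        (d-least (reverse symmetric (d-walk u v)))

  d-triangle : ∀ u v t → d u t ≤ d u v + d v t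
  d-triangle u v t = d-least (d-walk u v ++ d-walk v t)

  walk-0 : ∀ {u v l} → Walk weight u v l → l ≡ 0 → u ≡ v
  walk-0 []                eq = refl
  walk-0 (step {u} {t} pos p) eq =
    contradiction (subst (0 <_) (m+n≡0⇒m≡0 (weight u t) eq) pos) (<-irrefl refl)

  d-zero : ∀ {u v} → d u v ≡ 0 → u ≡ v
  d-zero {u} {v} = walk-0 (d-walk u v)

𝓑 : Graph → Betweenness
𝓑 W = record
  { X     = V
  ; order = size
  ; enum  = enum
  ; β     = B
  ; β?    = λ x y z → d x z ≟ d x y + d y z
  ; P1    = λ x z → cong (_+ d x z) (sym (d-refl x))
  ; P2    = λ x y z p → begin
      d z x          ≡⟨ d-sym z x ⟩
      d x z          ≡⟨ p ⟩
      d x y + d y z  ≡⟨ cong₂ _+_ (d-sym x y) (d-sym y z) ⟩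
      d y x + d z y  ≡⟨ +-comm (d y x) (d z y) ⟩
      d z y + d y x  ∎
  ; P3    = p3
  ; P4    = p4
  }
  where
  open Graph W
  open ShortestPath W
  open ≡-Reasoning

  B : V → V → V → Set
  B x y z = d x z ≡ d x y + d y z

  p3 : ∀ x y z → B x y z → B y x z → x ≡ y
  p3 x y z p q = d-zero (m+n≡0⇒m≡0 (d x y) (sym (+-cancelʳ-≡ (d x z) 0 _ eq)))
    where
    eq : 0 + d x z ≡ (d x y + d y x) + d x z
    eq = begin
      d x z                    ≡⟨ p ⟩
      d x y + d y z            ≡⟨ cong (d x y +_) q ⟩
      d x y + (d y x + d x z)  ≡⟨ sym (+-assoc (d x y) _ _) ⟩
      (d x y + d y x) + d x z  ∎

  p4 : ∀ x y z w → B x y z → B x w y → B x w z × B w y z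
  p4 x y z w p q = xwz , wyz
    where
    eq : d x z ≡ d x w + (d w y + d y z)
    eq = begin
      d x z                    ≡⟨ p ⟩
      d x y + d y z            ≡⟨ cong (_+ d y z) q ⟩
      (d x w + d w y) + d y z  ≡⟨ +-assoc (d x w) _ _ ⟩
      d x w + (d w y + d y z)  ∎
    wyz : B w y z
    wyz = ≤-antisym (d-triangle w y z)
      (+-cancelˡ-≤ (d x w) _ _ (subst (_≤ d x w + d w z) eq (d-triangle x w z)))
    xwz : B x w z
    xwz = trans eq (cong (d x w +_) (sym wyz))

------------------------------------------------------------------------
-- Undirected graphs from one-way lists of edges

-- An edge is entered in one direction only, the other direction being 0.

undirected : {V : Set} → (V → V → ℕ) → V → V → ℕ
undirected arc u v = arc u v ⊔ arc v u

module _ {V : Set} (arc : V → V → ℕ) where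

  undirected-sym : ∀ u v → undirected arc u v ≡ undirected arc v u
  undirected-sym u v = ⊔-comm (arc u v) (arc v u)

  undirected-loopless : (∀ v → arc v v ≡ 0) → ∀ v → undirected arc v v ≡ 0
  undirected-loopless h v = cong₂ _⊔_ (h v) (h v)

  arc→ : ∀ {u t v} → 0 < arc u t → ∃ (Walk (undirected arc) t v) →
         ∃ (Walk (undirected arc) u v)
  arc→ {u} {t} e (_ , p) = _ , step (≤-trans e (m≤m⊔n (arc u t) (arc t u))) p

  arc← : ∀ {u t v} → 0 < arc t u → ∃ (Walk (undirected arc) t v) →
         ∃ (Walk (undirected arc) u v)
  arc← {u} {t} e (_ , p) = _ , step (≤-trans e (m≤n⊔m (arc u t) (arc t u))) p

------------------------------------------------------------------------
-- K₃ and C₄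

completeWeight : ∀ {n} → Fin n → Fin n → ℕ
completeWeight i j = if does (i Fin.≟ j) then 0 else 1

K₃ : Graph
K₃ = record
  { V         = Fin 3
  ; size      = 3
  ; enum      = ↔-id (Fin 3)
  ; weight    = completeWeight
  ; symmetric = sy
  ; loopless  = ll
  ; connected = connected-via sy zero to0
  }
  where
  sy : ∀ (i j : Fin 3) → completeWeight i j ≡ completeWeight j i
  sy i j with i Fin.≟ j | j Fin.≟ i
  ... | yes _  | yes _  = refl
  ... | yes eq | no neq = contradiction (sym eq) neq
  ... | no neq | yes eq = contradiction (sym eq) neq
  ... | no _   | no _   = refl
  ll : ∀ (i : Fin 3) → completeWeight i i ≡ 0
  ll i rewrite dec-true (i Fin.≟ i) refl = refl
  to0 : ∀ (i : Fin 3) → ∃ (Walk completeWeight i zero)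
  to0 zero             = _ , []
  to0 (suc zero)       = _ , step (s≤s z≤n) []
  to0 (suc (suc zero)) = _ , step (s≤s z≤n) []

cycleArc : Fin 4 → Fin 4 → ℕ
cycleArc 0F 1F = 1
cycleArc 1F 2F = 1
cycleArc 2F 3F = 1
cycleArc 3F 0F = 1
cycleArc _  _  = 0

C₄ : Graph
C₄ = record
  { V         = Fin 4
  ; size      = 4
  ; enum      = ↔-id (Fin 4)
  ; weight    = undirected cycleArc
  ; symmetric = undirected-sym cycleArc
  ; loopless  = undirected-loopless cycleArc ll
  ; connected = connected-via (undirected-sym cycleArc) 0F to0
  }
  where
  ll : ∀ i → cycleArc i i ≡ 0
  ll 0F = refl
  ll 1F = refl
  ll 2F = refl
  ll 3F = refl
  to0 : ∀ i → ∃ (Walk (undirected cycleArc) i 0F)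
  to0 0F = _ , []
  to0 1F = _ , step (s≤s z≤n) []
  to0 2F = _ , step {t = 1F} (s≤s z≤n) (step (s≤s z≤n) [])
  to0 3F = _ , step (s≤s z≤n) []

------------------------------------------------------------------------
-- The graphs Q, R and S on n = 4 + k vertices

-- With m = n - 2, the vertex x j is the mathematical x_{j+1}: indices in
-- Fin m start at 0.

data Vertex (m : ℕ) : Set where
  x   : Fin m → Vertex m
  y z : Vertex m

vertices : ∀ m → Fin (2 + m) ↔ Vertex m
vertices m = mk↔ₛ′ to from to∘from from∘to
  where
  to : Fin (2 + m) → Vertex m
  to zero          = y
  to (suc zero)    = z
  to (suc (suc j)) = x j
  from : Vertex m → Fin (2 + m)
  from y     = zero
  from z     = suc zero
  from (x j) = suc (suc j)
  to∘from : ∀ v → to (from v) ≡ v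
  to∘from (x _) = refl
  to∘from y     = refl
  to∘from z     = refl
  from∘to : ∀ i → from (to i) ≡ i
  from∘to zero          = refl
  from∘to (suc zero)    = refl
  from∘to (suc (suc _)) = refl

pathArc : ∀ {m} → Fin m → Fin m → ℕ
pathArc a b = if does (suc (toℕ a) ≟ toℕ b) then 1 else 0

pathArc-loopless : ∀ {m} (a : Fin m) → pathArc a a ≡ 0
pathArc-loopless a rewrite dec-false (suc (toℕ a) ≟ toℕ a) 1+n≢n = refl

pathArc-next : ∀ {m} (a : Fin m) → 0 < pathArc (inject₁ a) (suc a)
pathArc-next a
  rewrite dec-true (suc (toℕ (inject₁ a)) ≟ suc (toℕ a)) (cong suc (Fin.toℕ-inject₁ a))
  = s≤s z≤n

module _ (k : ℕ) where

  qArc : Vertex (2 + k) → Vertex (2 + k) → ℕ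
  qArc (x a) (x b)    = pathArc a b
  qArc y     (x zero) = 1
  qArc z     (x zero) = 1
  qArc _     _        = 0

  Q : Graph
  Q = record
    { V         = Vertex (2 + k)
    ; size      = 4 + k
    ; enum      = vertices (2 + k)
    ; weight    = undirected qArc
    ; symmetric = undirected-sym qArc
    ; loopless  = undirected-loopless qArc ll
    ; connected = connected-via (undirected-sym qArc) (x zero) hub
    }
    where
    ll : ∀ v → qArc v v ≡ 0
    ll (x a) = pathArc-loopless a
    ll y     = refl
    ll z     = refl
    hub : ∀ v → ∃ (Walk (undirected qArc) v (x zero))
    hub (x a) = <-weakInduction (λ a → ∃ (Walk (undirected qArc) (x a) (x zero)))
                  (_ , []) (λ j → arc← qArc (pathArc-next j)) a
    hub y     = arc→ qArc {t = x zero} (s≤s z≤n) (_ , [])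
    hub z     = arc→ qArc {t = x zero} (s≤s z≤n) (_ , [])

  -- i is the deleted path edge, joining x (inject₁ i) and x (suc i); there
  -- are 1 + k = n - 3 of them.

  module _ (i : Fin (1 + k)) where

    apexArc : Fin (2 + k) → ℕ
    apexArc a =
      if does (a Fin.≟ inject₁ i) then 1 else
      if does (a Fin.≟ suc i)     then 2 else 0

    -- The only path arc leaving x (inject₁ i) is the deleted one.
    rArc : Vertex (2 + k) → Vertex (2 + k) → ℕ
    rArc (x a) (x b) = if does (a Fin.≟ inject₁ i) then 0 else pathArc a b
    rArc y     (x a) = apexArc a
    rArc z     (x a) = apexArc a
    rArc _     _     = 0

    R : Graph
    R = record
      { V         = Vertex (2 + k)
      ; size      = 4 + k
      ; enum      = vertices (2 + k)
      ; weight    = undirected rArc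
      ; symmetric = undirected-sym rArc
      ; loopless  = undirected-loopless rArc ll
      ; connected = connected-via (undirected-sym rArc) (x zero) hub
      }
      where
      Reach : Vertex (2 + k) → Set
      Reach v = ∃ (Walk (undirected rArc) v (x zero))

      ll : ∀ v → rArc v v ≡ 0
      ll (x a) with does (a Fin.≟ inject₁ i)
      ... | true  = refl
      ... | false = pathArc-loopless a
      ll y = refl
      ll z = refl

      apex-left : 0 < apexArc (inject₁ i)
      apex-left rewrite dec-true (inject₁ i Fin.≟ inject₁ i) refl = s≤s z≤n

      apex-right : 0 < apexArc (suc i)
      apex-right with does (suc i Fin.≟ inject₁ i)
      ... | true  = s≤s z≤n
      ... | false rewrite dec-true (i Fin.≟ i) refl = s≤s z≤n

      next : ∀ j → Reach (x (inject₁ j)) → Reach (x (suc j))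
      next j p with j Fin.≟ i
      ... | yes refl = arc← rArc {t = y} apex-right (arc→ rArc {t = x (inject₁ i)} apex-left p)
      ... | no j≢i   = arc← rArc kept p
        where
        kept : 0 < rArc (x (inject₁ j)) (x (suc j))
        kept rewrite dec-false (inject₁ j Fin.≟ inject₁ i) (j≢i ∘ Fin.inject₁-injective)
          = pathArc-next j

      hubX : ∀ a → Reach (x a)
      hubX = <-weakInduction (Reach ∘ x) (_ , []) next

      hub : ∀ v → Reach v
      hub (x a) = hubX a
      hub y     = arc→ rArc {t = x (inject₁ i)} apex-left (hubX (inject₁ i))
      hub z     = arc→ rArc {t = x (inject₁ i)} apex-left (hubX (inject₁ i))

  sArc : Vertex (2 + k) → Vertex (2 + k) → ℕ
  sArc (x a)    (x b) = pathArc a b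
  sArc (x zero) y     = 1
  sArc (x a)    z     = if does (a Fin.≟ fromℕ (1 + k)) then 2 else 0
  sArc y        z     = 2 + k
  sArc _        _     = 0

  S : Graph
  S = record
    { V         = Vertex (2 + k)
    ; size      = 4 + k
    ; enum      = vertices (2 + k)
    ; weight    = undirected sArc
    ; symmetric = undirected-sym sArc
    ; loopless  = undirected-loopless sArc ll
    ; connected = connected-via (undirected-sym sArc) (x zero) hub
    }
    where
    ll : ∀ v → sArc v v ≡ 0
    ll (x a) = pathArc-loopless a
    ll y     = refl
    ll z     = refl
    hub : ∀ v → ∃ (Walk (undirected sArc) v (x zero))
    hub (x a) = <-weakInduction (λ a → ∃ (Walk (undirected sArc) (x a) (x zero)))
                  (_ , []) (λ j → arc← sArc (pathArc-next j)) a
    hub y     = arc← sArc {t = x zero} (s≤s z≤n) (_ , [])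
    hub z     = arc← sArc {t = y} (s≤s z≤n) (hub y)

------------------------------------------------------------------------
-- Regularity and the function τ

Regular : Betweenness → Set
Regular B = ¬ (∃[ Y ] induced B {4} Y ≅ 𝓑 C₄)

-- B_Φ(n, m) is inhabited.

Inhabited : (Betweenness → Set) → ℕ → ℕ → Set₁
Inhabited Φ n m = ∃[ B ] order B ≡ n × cosize B ≡ m × Φ B

-- τ Φ n k t says that τ_Φ(n, k) exists and equals t.

record τ (Φ : Betweenness → Set) (n k t : ℕ) : Set₁ where
  field
    above    : k < t
    attained : Inhabited Φ n t
    minimal  : ∀ m → k < m → Inhabited Φ n m → t ≤ m

{-# OPTIONS --safe #-}

-- Fix a triangle abc and call a point p linked if it forms a triangle with two
-- of a, b, c.  An unlinked point lies between every two corners or opposite to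
-- one of them, and inspecting the positions of two unlinked points p ≠ q shows
-- that, in the absence of an induced C₄, at least two of pqa, pqb, pqc are
-- triangles.  Choosing triangles for the points accordingly yields n − 2
-- distinct ones, unless there is exactly one unlinked point r.  In that case
-- co-size n − 3 forces all triangles to be {y, z, u} with u ≠ r for a fixed
-- pair y, z.  Removing y or z then leaves a linear regular structure, that is,
-- a sequence, so y and z sit in gaps of the sequence of the remaining points;
-- comparing the two gaps with the way y, z, r are collinear leaves, up to
-- reversal and exchange of y and z, only Q, R and S.

module Submission where

open import Defs
open import Data.Bool using (true; false; if_then_else_)
open import Data.Empty using (⊥; ⊥-elim)
open import Data.Fin as Fin using (Fin; zero; suc; punchIn; punchOut; toℕ; fromℕ; fromℕ<; inject₁; opposite)
open import Data.Fin.Induction using (<-weakInduction-startingFrom)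
open import Data.Fin.Patterns using (0F; 1F; 2F; 3F)
open import Data.Fin.Permutation as Perm using (Permutation; _⟨$⟩ʳ_)
import Data.Fin.Properties as Fin
open import Data.List using (List; lookup; allFin; cartesianProduct)
open import Data.List.Membership.Propositional using (_∈_)
open import Data.List.Membership.Propositional.Properties
  using (∈-filter⁺; ∈-filter⁻; ∈-cartesianProduct⁺; ∈-allFin; ∈-lookup)
import Data.List.Relation.Unary.All as All
open import Data.List.Relation.Unary.AllPairs using (_∷_)
open import Data.List.Relation.Unary.Any using (index)
open import Data.List.Relation.Unary.Any.Properties using (lookup-index)
open import Data.List.Relation.Unary.Unique.Propositional using (Unique)
open import Data.List.Relation.Unary.Unique.Propositional.Properties
  using (filter⁺; cartesianProduct⁺; allFin⁺)
open import Data.Nat using (ℕ; zero; suc; _+_; _∸_; _⊔_; _≤_; _<_; z≤n; s≤s; _≟_; _<?_; _≤?_)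
import Data.Nat.Properties as ℕ
open import Data.Product using (∃; ∃-syntax; _×_; _,_; proj₁; proj₂)
open import Data.Sum using (_⊎_; inj₁; inj₂)
import Data.Vec.Functional as Vec
import Data.Vec.Functional.Properties as Vec
open import Function using (_∘_; _↔_; _⇔_; Inverse; Injection; Equivalence; mk⇔; mk↣; mk↔ₛ′)
open import Function.Construct.Composition using (_↔-∘_)
open import Function.Construct.Identity using (↔-id)
open import Function.Properties.Inverse using (↔-sym; ↔⇒↣)
open import Relation.Binary using (DecidableEquality; tri<; tri≈; tri>)
open import Relation.Binary.PropositionalEquality
open import Relation.Nullary
open import Relation.Nullary.Decidable using (dec-true; dec-false; decidable-stable; from-yes; via-injection)

-- One assumption drives everything: the co-size is less than n - 2. A nonlinear regular structure
-- of order n ≥ 4 with this property is brought into the form `Config`, which has exactly n - 3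
-- triangles. So the lower bound and the list of extremal structures come out together. The number n
-- - 2 arises by letting each point except two corners b, c own a triangle: a owns abc, a linked
-- point owns one on itself and two corners, and an unlinked point must take one with two points
-- outside abc. Two unlinked points r, q provide such triangles for each other, but r needs one that
-- is not already taken by q. This is why two of the triangles pqa, pqb, pqc are wanted and not just
-- one. `Config` speaks of betweenness alone: an ordered sequence, the gaps of y and z, and one
-- contact. These data decide every triple, so co-size, regularity and uniqueness up to isomorphism
-- follow once for all three families. For the graphs only membership in `Config` is left, and
-- potential functions on the vertices take the place of an analysis of shortest walks.

↔-injective : ∀ {A C : Set} (e : A ↔ C) {a b : A} → Inverse.to e a ≡ Inverse.to e b → a ≡ b
↔-injective e = Injection.injective (↔⇒↣ e)

β-resp : ∀ B {a b c a′ b′ c′} → a ≡ a′ → b ≡ b′ → c ≡ c′ →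
         Betweenness.β B a b c → Betweenness.β B a′ b′ c′
β-resp _ refl refl refl abc = abc

-- Triangles and a point in special position

module Geometry (B : Betweenness) where
  open Betweenness B using (X; β; β?; P1; P2; P3; P4; Collinear; Collinear?) public

  private variable
    a b c d p q r s t u v w : X

  turn : β u v w → β w v u
  turn = P2 _ _ _

  β-start : β u u w
  β-start = P1 _ _

  β-end : β u w w
  β-end = turn β-start

  β-antisym : β u v w → β v u w → u ≡ v
  β-antisym = P3 _ _ _

  β-loop : β u v u → u ≡ v
  β-loop uvu = β-antisym uvu β-end

  inner : β u v w → β u t v → β u t w
  inner uvw utv = proj₁ (P4 _ _ _ _ uvw utv)

  outer : β u v w → β u t v → β t v w
  outer uvw utv = proj₂ (P4 _ _ _ _ uvw utv)

  -- `Collinear` modulo `P2`: three cases, one for each possible middle point, instead of six.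
  data Middle (u v w : X) : Set where
    mid₁ : β v u w → Middle u v w
    mid₂ : β u v w → Middle u v w
    mid₃ : β u w v → Middle u v w

  collinear⇒middle : Collinear u v w → Middle u v w
  collinear⇒middle (inj₁ p)                               = mid₂ p
  collinear⇒middle (inj₂ (inj₁ p))                        = mid₃ p
  collinear⇒middle (inj₂ (inj₂ (inj₁ p)))                 = mid₁ p
  collinear⇒middle (inj₂ (inj₂ (inj₂ (inj₁ p))))          = mid₃ (turn p)
  collinear⇒middle (inj₂ (inj₂ (inj₂ (inj₂ (inj₁ p)))))   = mid₁ (turn p)
  collinear⇒middle (inj₂ (inj₂ (inj₂ (inj₂ (inj₂ p)))))   = mid₂ (turn p)

  middle⇒collinear : Middle u v w → Collinear u v w
  middle⇒collinear (mid₁ p) = inj₂ (inj₂ (inj₁ p))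
  middle⇒collinear (mid₂ p) = inj₁ p
  middle⇒collinear (mid₃ p) = inj₂ (inj₁ p)

  middle? : ∀ u v w → Dec (Middle u v w)
  middle? u v w = map′ collinear⇒middle middle⇒collinear (Collinear? u v w)

  swap₁₂ : Middle u v w → Middle v u w
  swap₁₂ (mid₁ p) = mid₂ p
  swap₁₂ (mid₂ p) = mid₁ p
  swap₁₂ (mid₃ p) = mid₃ (turn p)

  swap₂₃ : Middle u v w → Middle u w v
  swap₂₃ (mid₁ p) = mid₁ (turn p)
  swap₂₃ (mid₂ p) = mid₃ p
  swap₂₃ (mid₃ p) = mid₂ p

  -- Triples with a repetition are `Middle` by `P1`, so a `Tri` carries the distinctness of its
  -- points.
  Tri : X → X → X → Set
  Tri u v w = ¬ Middle u v w

  tri? : ∀ u v w → Dec (Tri u v w)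
  tri? u v w = ¬? (middle? u v w)

  tri-≢₁₂ : Tri u v w → u ≢ v
  tri-≢₁₂ t refl = t (mid₂ β-start)

  tri-≢₂₃ : Tri u v w → v ≢ w
  tri-≢₂₃ t refl = t (mid₂ β-end)

  tri-≢₁₃ : Tri u v w → u ≢ w
  tri-≢₁₃ t refl = t (mid₃ β-start)

  tri-swap₁₂ : Tri u v w → Tri v u w
  tri-swap₁₂ t = t ∘ swap₁₂

  tri-swap₂₃ : Tri u v w → Tri u w v
  tri-swap₂₃ t = t ∘ swap₂₃

  tri-rotate : Tri u v w → Tri v w u
  tri-rotate = tri-swap₂₃ ∘ tri-swap₁₂

  -- An induced C₄ given by its four betweennesses. By `P3` the two inequalities make all four
  -- points distinct, see `corner-injective`.
  Squareless : Set
  Squareless = ∀ {a b c d} → a ≢ b → b ≢ c →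
               β a b c → β b c d → β c d a → β d a b → ⊥

  -- Where a point p can lie when it is collinear with each side of the
  -- triangle abc: between any two corners, or between two corners and
  -- opposite to the third.
  data Position (a b c p : X) : Set where
    star : β a p b → β b p c → β a p c → Position a b c p
    opp₁ : β b p c → β p b a → β p c a → Position a b c p
    opp₂ : β a p c → β p a b → β p c b → Position a b c p
    opp₃ : β a p b → β p a c → β p b c → Position a b c p

  swapPos₁₂ : Position a b c p → Position b a c p
  swapPos₁₂ (star apb bpc apc) = star (turn apb) apc bpc
  swapPos₁₂ (opp₁ bpc pba pca) = opp₂ bpc pba pca
  swapPos₁₂ (opp₂ apc pab pcb) = opp₁ apc pab pcb
  swapPos₁₂ (opp₃ apb pac pbc) = opp₃ (turn apb) pbc pac

  swapPos₂₃ : Position a b c p → Position a c b p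
  swapPos₂₃ (star apb bpc apc) = star apc (turn bpc) apb
  swapPos₂₃ (opp₁ bpc pba pca) = opp₁ (turn bpc) pca pba
  swapPos₂₃ (opp₂ apc pab pcb) = opp₃ apc pab pcb
  swapPos₂₃ (opp₃ apb pac pbc) = opp₂ apb pac pbc

  -- There are 27 combinations of middle points on the three sides; by `P4` all but four of them
  -- make a, b, c collinear.
  position : Tri a b c → Middle p a b → Middle p b c → Middle p a c → Position a b c p
  position {a} {b} {c} {p} abc = go
    where
    fork : β p u v → β w p v → β v u w
    fork puv wpv = inner (turn wpv) (turn puv)
    go : Middle p a b → Middle p b c → Middle p a c → Position a b c p
    go (mid₁ apb) (mid₁ bpc) (mid₁ apc) = star apb bpc apc
    go (mid₁ apb) (mid₁ bpc) (mid₂ pac) = contradiction (mid₁ (turn (fork pac bpc))) abc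
    go (mid₁ apb) (mid₁ bpc) (mid₃ pca) = contradiction (mid₃ (fork pca (turn apb))) abc
    go (mid₁ apb) (mid₂ pbc) (mid₁ apc) = contradiction (mid₂ (turn (fork pbc apc))) abc
    go (mid₁ apb) (mid₂ pbc) (mid₂ pac) = opp₃ apb pac pbc
    go (mid₁ apb) (mid₂ pbc) (mid₃ pca) = contradiction (mid₃ (turn (outer pca pbc))) abc
    go (mid₁ apb) (mid₃ pcb) _          = contradiction (mid₃ (turn (fork pcb apb))) abc
    go (mid₂ pab) (mid₁ bpc) _          = contradiction (mid₁ (fork pab (turn bpc))) abc
    go (mid₂ pab) (mid₂ pbc) _          = contradiction (mid₂ (outer pbc pab)) abc
    go (mid₂ pab) (mid₃ pcb) (mid₁ apc) = opp₂ apc pab pcb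
    go (mid₂ pab) (mid₃ pcb) (mid₂ pac) = contradiction (mid₃ (outer pcb pac)) abc
    go (mid₂ pab) (mid₃ pcb) (mid₃ pca) = contradiction (mid₁ (turn (outer pab pca))) abc
    go (mid₃ pba) (mid₁ bpc) (mid₁ apc) = contradiction (mid₂ (fork pba (turn apc))) abc
    go (mid₃ pba) (mid₁ bpc) (mid₂ pac) = contradiction (mid₁ (outer pac pba)) abc
    go (mid₃ pba) (mid₁ bpc) (mid₃ pca) = opp₁ bpc pba pca
    go (mid₃ pba) (mid₂ pbc) (mid₁ apc) = contradiction (mid₂ (fork pba (turn apc))) abc
    go (mid₃ pba) (mid₂ pbc) (mid₂ pac) = contradiction (mid₁ (outer pac pba)) abc
    go (mid₃ pba) (mid₂ pbc) (mid₃ pca) = contradiction (mid₃ (turn (outer pca pbc))) abc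
    go (mid₃ pba) (mid₃ pcb) _          = contradiction (mid₂ (turn (outer pba pcb))) abc

  Outside : X → X → X → X → Set
  Outside a b c p = p ≢ a × p ≢ b × p ≢ c

  module Crowding (sq : Squareless) where

    -- With q between p and a, p would lie between q and b and between q and c. Together with bqc
    -- the former puts q between p and c, and `P3` gives p = q.
    star-star-beyond : p ≢ q → β a p b → β a p c → β b q c → ¬ β p q a
    star-star-beyond p≢q apb apc bqc pqa = p≢q (β-antisym
      (outer bqc (turn (outer apb (turn pqa)))) (outer apc (turn pqa)))

    opp-opp-beyond : p ≢ q → β b p c → β q b a → β q c a → ¬ β p q a
    opp-opp-beyond p≢q bpc qba qca pqa = p≢q (β-antisym
      (turn (outer (turn pqa) (turn qca)))
      (outer bpc (outer (turn pqa) (turn qba))))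

    opp-opp-apex : p ≢ q → a ≢ b →
                   β b p c → β p b a → β p c a → β b q c → β q b a → β q c a → Tri p q a
    opp-opp-apex p≢q a≢b bpc pba pca bqc qba qca (mid₁ qpa) = opp-opp-beyond (p≢q ∘ sym) bqc pba pca qpa
    opp-opp-apex p≢q a≢b bpc pba pca bqc qba qca (mid₂ pqa) = opp-opp-beyond p≢q bpc qba qca pqa
    opp-opp-apex p≢q a≢b bpc pba pca bqc qba qca (mid₃ paq) =
      a≢b (β-antisym (turn pba) (outer (turn paq) qba))

    -- As pqa is a triangle, the only middles left for pqb and pqc are b and c; then b, p, c, q is a
    -- square.
    opp-opp-base : p ≢ q → a ≢ b → p ≢ b → p ≢ c →
                   β b p c → β p b a → β p c a → β b q c → β q b a → β q c a →
                   Middle p q b → Middle p q c → ⊥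
    opp-opp-base {p} {q} {a} p≢q a≢b p≢b p≢c bpc pba pca bqc qba qca pqb pqc =
      sq (p≢b ∘ sym) p≢c bpc (side (turn bpc) pba (turn bqc) qba pqc) (turn bqc)
         (turn (side bpc pca bqc qca pqb))
      where
      apex : Tri p q a
      apex = opp-opp-apex p≢q a≢b bpc pba pca bqc qba qca
      side : ∀ {b c} → β b p c → β p c a → β b q c → β q c a → Middle p q b → β p b q
      side bpc pca bqc qca (mid₁ qpb) = contradiction (mid₂ (inner pca (outer bqc (turn qpb)))) apex
      side bpc pca bqc qca (mid₂ pqb) = contradiction (mid₁ (inner qca (outer bpc (turn pqb)))) apex
      side bpc pca bqc qca (mid₃ pbq) = pbq

    -- With p between q and a, both b and c would lie between p and q, and b, p, c, q would be a
    -- square. The other two middles identify p with b or with a.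
    star-opp-apex : p ≢ a → p ≢ b → p ≢ c →
                    β a p b → β b p c → β a p c → β b q c → β q b a → β q c a → Tri p q a
    star-opp-apex p≢a p≢b p≢c apb bpc apc bqc qba qca (mid₁ qpa) =
      sq (p≢b ∘ sym) p≢c bpc (outer (turn qca) apc) (turn bqc) (turn (outer (turn qba) apb))
    star-opp-apex p≢a p≢b p≢c apb bpc apc bqc qba qca (mid₂ pqa) =
      p≢b (β-antisym (turn (inner (turn pqa) (turn qba))) (turn apb))
    star-opp-apex p≢a p≢b p≢c apb bpc apc bqc qba qca (mid₃ paq) =
      p≢a (β-antisym (turn (outer (turn paq) qba)) apb)

    star-opp-base : p ≢ a → p ≢ b → p ≢ c →
                    β a p b → β b p c → β a p c → β b q c → β q b a → β q c a →
                    Middle p q b → Middle p q c → ⊥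
    star-opp-base {p} {a} {q = q} p≢a p≢b p≢c apb bpc apc bqc qba qca pqb pqc =
      sq (p≢b ∘ sym) p≢c bpc (side p≢c apc qca pqc) (turn bqc) (turn (side p≢b apb qba pqb))
      where
      apex : Tri p q a
      apex = star-opp-apex p≢a p≢b p≢c apb bpc apc bqc qba qca
      side : ∀ {b} → p ≢ b → β a p b → β q b a → Middle p q b → β p b q
      side p≢b apb qba (mid₁ qpb) = contradiction (β-antisym (outer qba qpb) (turn apb)) p≢b
      side p≢b apb qba (mid₂ pqb) = contradiction (mid₁ (outer (turn apb) (turn pqb))) apex
      side p≢b apb qba (mid₃ pbq) = pbq

    -- Opposite to different corners, p and q span a square with these corners.
    opp₁-opp₂ : p ≢ q → a ≢ q →
                β b p c → β p b a → β p c a → β a q c → β q a b → β q c b → ⊥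
    opp₁-opp₂ p≢q a≢q bpc pba pca aqc qab qcb =
      sq a≢q (p≢q ∘ sym) (inner (turn pca) aqc) (turn (inner (turn qcb) bpc)) pba (turn qab)

    -- The other pairs of corners follow by permuting abc, so a and b suffice. In each of the
    -- sixteen pairs of positions pqa or pqb is a triangle, or a square appears.
    crowded : Tri a b c → Position a b c p → Position a b c q →
              Outside a b c p → Outside a b c q → p ≢ q →
              Middle p q a → Middle p q b → ⊥
    crowded {a} {b} {c} {p} {q} abc = go
      where
      a≢b = tri-≢₁₂ abc
      b≢c = tri-≢₂₃ abc
      a≢c = tri-≢₁₃ abc
      go : Position a b c p → Position a b c q →
           Outside a b c p → Outside a b c q → p ≢ q →
           Middle p q a → Middle p q b → ⊥
      go (star apb bpc apc) (star aqb bqc aqc) (p≢a , p≢b , p≢c) _ p≢q pqa pqb =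
        -- Neither p nor q can be the middle, so both a and b lie between p and q: the square is a,
        -- p, b, q.
        sq (p≢a ∘ sym) p≢b apb
           (middle bpc (turn apb) apc bqc (turn aqb) aqc pqb) (turn aqb)
           (turn (middle apc apb bpc aqc aqb bqc pqa))
        where
        middle : ∀ {a b c} → β a p c → β a p b → β b p c → β a q c → β a q b → β b q c →
                 Middle p q a → β p a q
        middle apc apb bpc aqc aqb bqc (mid₁ qpa) = contradiction qpa (star-star-beyond (p≢q ∘ sym) aqb aqc bpc)
        middle apc apb bpc aqc aqb bqc (mid₂ pqa) = contradiction pqa (star-star-beyond p≢q apb apc bqc)
        middle apc apb bpc aqc aqb bqc (mid₃ paq) = paq
      go (star apb bpc apc) (opp₁ bqc qba qca) (p≢a , p≢b , p≢c) _ _ pqa _ =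
        star-opp-apex p≢a p≢b p≢c apb bpc apc bqc qba qca pqa
      go (star apb bpc apc) (opp₂ aqc qab qcb) (p≢a , p≢b , p≢c) _ _ _ pqb =
        star-opp-apex p≢b p≢a p≢c (turn apb) apc bpc aqc qab qcb pqb
      go (star apb bpc apc) (opp₃ aqb qac qbc) (p≢a , p≢b , p≢c) _ _ pqa pqb =
        star-opp-base p≢c p≢a p≢b (turn apc) apb (turn bpc) aqb qac qbc pqa pqb
      go (opp₁ bpc pba pca) (star aqb bqc aqc) _ (q≢a , q≢b , q≢c) _ pqa _ =
        star-opp-apex q≢a q≢b q≢c aqb bqc aqc bpc pba pca (swap₁₂ pqa)
      go (opp₂ apc pab pcb) (star aqb bqc aqc) _ (q≢a , q≢b , q≢c) _ _ pqb =
        star-opp-apex q≢b q≢a q≢c (turn aqb) aqc bqc apc pab pcb (swap₁₂ pqb)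
      go (opp₃ apb pac pbc) (star aqb bqc aqc) _ (q≢a , q≢b , q≢c) _ pqa pqb =
        star-opp-base q≢c q≢a q≢b (turn aqc) aqb (turn bqc) apb pac pbc (swap₁₂ pqa) (swap₁₂ pqb)
      go (opp₁ bpc pba pca) (opp₁ bqc qba qca) _ _ p≢q pqa _ =
        opp-opp-apex p≢q a≢b bpc pba pca bqc qba qca pqa
      go (opp₂ apc pab pcb) (opp₂ aqc qab qcb) _ _ p≢q _ pqb =
        opp-opp-apex p≢q (a≢b ∘ sym) apc pab pcb aqc qab qcb pqb
      go (opp₃ apb pac pbc) (opp₃ aqb qac qbc) (p≢a , p≢b , _) _ p≢q pqa pqb =
        opp-opp-base p≢q (a≢c ∘ sym) p≢a p≢b apb pac pbc aqb qac qbc pqa pqb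
      go (opp₁ bpc pba pca) (opp₂ aqc qab qcb) _ (q≢a , _) p≢q _ _ =
        opp₁-opp₂ p≢q (q≢a ∘ sym) bpc pba pca aqc qab qcb
      go (opp₁ bpc pba pca) (opp₃ aqb qac qbc) _ (q≢a , _) p≢q _ _ =
        opp₁-opp₂ p≢q (q≢a ∘ sym) (turn bpc) pca pba aqb qac qbc
      go (opp₂ apc pab pcb) (opp₁ bqc qba qca) (p≢a , _) _ p≢q _ _ =
        opp₁-opp₂ (p≢q ∘ sym) (p≢a ∘ sym) bqc qba qca apc pab pcb
      go (opp₂ apc pab pcb) (opp₃ aqb qac qbc) _ (_ , q≢b , _) p≢q _ _ =
        opp₁-opp₂ p≢q (q≢b ∘ sym) (turn apc) pcb pab (turn aqb) qbc qac
      go (opp₃ apb pac pbc) (opp₁ bqc qba qca) (p≢a , _) _ p≢q _ _ =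
        opp₁-opp₂ (p≢q ∘ sym) (p≢a ∘ sym) (turn bqc) qca qba apb pac pbc
      go (opp₃ apb pac pbc) (opp₂ aqc qab qcb) (_ , p≢b , _) _ p≢q _ _ =
        opp₁-opp₂ (p≢q ∘ sym) (p≢b ∘ sym) (turn aqc) qcb qab (turn apb) pbc pac

  Linked : X → X → X → X → Set
  Linked a b c p = Tri p a b ⊎ Tri p b c ⊎ Tri p a c

  linked? : ∀ a b c p → Dec (Linked a b c p)
  linked? a b c p = tri? p a b ⊎-dec tri? p b c ⊎-dec tri? p a c

  unlinked-position : Tri a b c → ¬ Linked a b c p → Position a b c p
  unlinked-position abc ¬linked = position abc
    (decidable-stable (middle? _ _ _) (¬linked ∘ inj₁))
    (decidable-stable (middle? _ _ _) (¬linked ∘ inj₂ ∘ inj₁))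
    (decidable-stable (middle? _ _ _) (¬linked ∘ inj₂ ∘ inj₂))

  Corner : X → X → X → X → Set
  Corner a b c s = s ≡ a ⊎ s ≡ b ⊎ s ≡ c

  corner-≢ : Corner a b c s → Outside a b c p → s ≢ p
  corner-≢ (inj₁ refl)        (p≢a , _)     refl = p≢a refl
  corner-≢ (inj₂ (inj₁ refl)) (_ , p≢b , _) refl = p≢b refl
  corner-≢ (inj₂ (inj₂ refl)) (_ , _ , p≢c) refl = p≢c refl

  TwoTriangles : X → X → X → X → X → Set
  TwoTriangles a b c p q = ∃[ s ] ∃[ t ]
    Corner a b c s × Corner a b c t × s ≢ t × Tri p q s × Tri p q t

  two-triangles : Squareless → Tri a b c → Outside a b c p → Outside a b c q → p ≢ q →
                  ¬ Linked a b c p → ¬ Linked a b c q → TwoTriangles a b c p q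
  two-triangles {a} {b} {c} {p} {q} sq abc op oq p≢q ¬lp ¬lq
    with middle? p q a | middle? p q b | middle? p q c
  ... | no pqa  | no pqb  | _       = a , b , inj₁ refl , inj₂ (inj₁ refl) , tri-≢₁₂ abc , pqa , pqb
  ... | no pqa  | yes _   | no pqc  = a , c , inj₁ refl , inj₂ (inj₂ refl) , tri-≢₁₃ abc , pqa , pqc
  ... | yes _   | no pqb  | no pqc  = b , c , inj₂ (inj₁ refl) , inj₂ (inj₂ refl) , tri-≢₂₃ abc , pqb , pqc
  ... | yes pqa | yes pqb | _       = ⊥-elim (Crowding.crowded sq abc
    (unlinked-position abc ¬lp) (unlinked-position abc ¬lq) op oq p≢q pqa pqb)
  ... | yes pqa | no _    | yes pqc = ⊥-elim (Crowding.crowded sq (tri-swap₂₃ abc)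
    (swapPos₂₃ (unlinked-position abc ¬lp)) (swapPos₂₃ (unlinked-position abc ¬lq))
    (swapOut₂₃ op) (swapOut₂₃ oq) p≢q pqa pqc)
    where
    swapOut₂₃ : Outside a b c r → Outside a c b r
    swapOut₂₃ (r≢a , r≢b , r≢c) = r≢a , r≢c , r≢b
  ... | no _    | yes pqb | yes pqc = ⊥-elim (Crowding.crowded sq (tri-rotate abc)
    (rotatePos (unlinked-position abc ¬lp)) (rotatePos (unlinked-position abc ¬lq))
    (rotateOut op) (rotateOut oq) p≢q pqb pqc)
    where
    rotatePos : Position a b c r → Position b c a r
    rotatePos = swapPos₂₃ ∘ swapPos₁₂
    rotateOut : Outside a b c r → Outside b c a r
    rotateOut (r≢a , r≢b , r≢c) = r≢b , r≢c , r≢a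

-- Counting triangles

lookup-injective : ∀ {A : Set} {xs : List A} → Unique xs →
                   ∀ {i j} → lookup xs i ≡ lookup xs j → i ≡ j
lookup-injective (_  ∷ _) {zero}  {zero}  _  = refl
lookup-injective (∉ ∷ _)  {zero}  {suc j} eq = contradiction eq (All.lookup ∉ (∈-lookup j))
lookup-injective (∉ ∷ _)  {suc i} {zero}  eq = contradiction (sym eq) (All.lookup ∉ (∈-lookup i))
lookup-injective (_ ∷ u)  {suc i} {suc j} eq = cong suc (lookup-injective u eq)

module Counting (B : Betweenness) where
  open Geometry B
  open Betweenness B using (enum; point; Triangle; Triangle?; triangles)

  Triple : Set
  Triple = X × X × X

  private variable
    a b c u v w : X
    t t′ t″ : Triple

  infix 4 _∈₃_ _≈_

  _∈₃_ : X → Triple → Set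
  u ∈₃ (a , b , c) = Corner a b c u

  Tri₃ : Triple → Set
  Tri₃ (a , b , c) = Tri a b c

  -- Equality as sets of members, which lets a triangle be named in any order of its points.
  _≈_ : Triple → Triple → Set
  t ≈ t′ = (∀ {u} → u ∈₃ t → u ∈₃ t′) × (∀ {u} → u ∈₃ t′ → u ∈₃ t)

  ≈-sym : t ≈ t′ → t′ ≈ t
  ≈-sym (f , g) = g , f

  ≈-trans : t ≈ t′ → t′ ≈ t″ → t ≈ t″
  ≈-trans (f , g) (f′ , g′) = (λ m → f′ (f m)) , (λ m → g (g′ m))

  ≈-swap₁₂ : (a , b , c) ≈ (b , a , c)
  ≈-swap₁₂ = exchange , exchange
    where
    exchange : ∀ {u a b c} → u ∈₃ (a , b , c) → u ∈₃ (b , a , c)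
    exchange (inj₁ m)        = inj₂ (inj₁ m)
    exchange (inj₂ (inj₁ m)) = inj₁ m
    exchange (inj₂ (inj₂ m)) = inj₂ (inj₂ m)

  ≈-swap₂₃ : (a , b , c) ≈ (a , c , b)
  ≈-swap₂₃ = exchange , exchange
    where
    exchange : ∀ {u a b c} → u ∈₃ (a , b , c) → u ∈₃ (a , c , b)
    exchange (inj₁ m)        = inj₁ m
    exchange (inj₂ (inj₁ m)) = inj₂ (inj₂ m)
    exchange (inj₂ (inj₂ m)) = inj₂ (inj₁ m)

  Indices : Set
  Indices = Fin (order B) × Fin (order B) × Fin (order B)

  points : Indices → Triple
  points (i , j , k) = point i , point j , point k

  point-injective : ∀ {i j} → point i ≡ point j → i ≡ j
  point-injective = ↔-injective enum

  Sorted : Triple → Set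
  Sorted t = ∃[ s ] Triangle s × points s ≈ t

  sort : Tri u v w → Sorted (u , v , w)
  sort {u} {v} {w} uvw =
    subst Sorted (cong₂ _,_ (point-from u) (cong₂ _,_ (point-from v) (point-from w)))
      (sortIndices (subst Tri₃ (sym (cong₂ _,_ (point-from u) (cong₂ _,_ (point-from v) (point-from w)))) uvw))
    where
    point-from : ∀ u → point (Inverse.from enum u) ≡ u
    point-from = Inverse.strictlyInverseˡ enum

    resort : t ≈ t′ → Sorted t → Sorted t′
    resort t≈t′ (s , △ , s≈t) = s , △ , ≈-trans s≈t t≈t′

    insertLast : ∀ {i j k} → i Fin.< j → Tri (point i) (point j) (point k) →
                 Sorted (point i , point j , point k)
    insertLast {i} {j} {k} i<j ijk with Fin.<-cmp j k
    ... | tri< j<k _ _ = (i , j , k) , (i<j , j<k , ijk ∘ collinear⇒middle) , (λ m → m) , λ m → m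
    ... | tri≈ _ j≡k _ = contradiction (cong point j≡k) (tri-≢₂₃ ijk)
    ... | tri> _ _ k<j with Fin.<-cmp i k
    ...   | tri< i<k _ _ = (i , k , j) , (i<k , k<j , tri-swap₂₃ ijk ∘ collinear⇒middle) , ≈-swap₂₃
    ...   | tri≈ _ i≡k _ = contradiction (cong point i≡k) (tri-≢₁₃ ijk)
    ...   | tri> _ _ k<i = (k , i , j) , (k<i , i<j , tri-rotate (tri-rotate ijk) ∘ collinear⇒middle)
                         , ≈-trans ≈-swap₁₂ ≈-swap₂₃

    sortIndices : ∀ {i j k} → Tri (point i) (point j) (point k) → Sorted (point i , point j , point k)
    sortIndices {i} {j} ijk with Fin.<-cmp i j
    ... | tri< i<j _ _ = insertLast i<j ijk
    ... | tri≈ _ i≡j _ = contradiction (cong point i≡j) (tri-≢₁₂ ijk)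
    ... | tri> _ _ j<i = resort ≈-swap₁₂ (insertLast j<i (tri-swap₁₂ ijk))

  locate : Tri₃ t → ∃[ n ] points (lookup triangles n) ≈ t
  locate {t} tri with sort tri
  ... | s , △ , s≈t = index s∈ , subst (λ s → points s ≈ t) (lookup-index s∈) s≈t
    where
    s∈ : s ∈ triangles
    s∈ = ∈-filter⁺ Triangle? (∈-cartesianProduct⁺ (∈-allFin _) (∈-cartesianProduct⁺ (∈-allFin _) (∈-allFin _))) △

  triangle-lookup : ∀ n → Triangle (lookup triangles n)
  triangle-lookup n = proj₂ (∈-filter⁻ Triangle?
    {xs = cartesianProduct (allFin _) (cartesianProduct (allFin _) (allFin _))} (∈-lookup n))

  -- Two increasing triples with the same members agree in the least and in the
  -- greatest member, hence also in the remaining one.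
  sorted-unique : ∀ {s s′} → Triangle s → Triangle s′ → points s ≈ points s′ → s ≡ s′
  sorted-unique {i , j , k} {i′ , j′ , k′} (i<j , j<k , _) (i′<j′ , j′<k′ , _) (f , g) =
    cong₂ _,_ i≡i′ (cong₂ _,_ (middle (f (inj₂ (inj₁ refl)))) k≡k′)
    where
    lower : ∀ {i j k n} → i Fin.< j → j Fin.< k → point n ∈₃ points (i , j , k) → i Fin.≤ n
    lower i<j j<k (inj₁ eq)        = ℕ.≤-reflexive (cong Fin.toℕ (sym (point-injective eq)))
    lower i<j j<k (inj₂ (inj₁ eq)) = subst (_ Fin.≤_) (sym (point-injective eq)) (ℕ.<⇒≤ i<j)
    lower i<j j<k (inj₂ (inj₂ eq)) = subst (_ Fin.≤_) (sym (point-injective eq)) (ℕ.<⇒≤ (ℕ.<-trans i<j j<k))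
    upper : ∀ {i j k n} → i Fin.< j → j Fin.< k → point n ∈₃ points (i , j , k) → n Fin.≤ k
    upper i<j j<k (inj₁ eq)        = subst (Fin._≤ _) (sym (point-injective eq)) (ℕ.<⇒≤ (ℕ.<-trans i<j j<k))
    upper i<j j<k (inj₂ (inj₁ eq)) = subst (Fin._≤ _) (sym (point-injective eq)) (ℕ.<⇒≤ j<k)
    upper i<j j<k (inj₂ (inj₂ eq)) = ℕ.≤-reflexive (cong Fin.toℕ (point-injective eq))
    i≡i′ : i ≡ i′
    i≡i′ = Fin.≤-antisym (lower i<j j<k (g (inj₁ refl))) (lower i′<j′ j′<k′ (f (inj₁ refl)))
    k≡k′ : k ≡ k′
    k≡k′ = Fin.≤-antisym (upper i′<j′ j′<k′ (f (inj₂ (inj₂ refl)))) (upper i<j j<k (g (inj₂ (inj₂ refl))))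
    middle : point j ∈₃ points (i′ , j′ , k′) → j ≡ j′
    middle (inj₁ eq)        = contradiction (sym (trans (point-injective eq) (sym i≡i′))) (Fin.<⇒≢ i<j)
    middle (inj₂ (inj₁ eq)) = point-injective eq
    middle (inj₂ (inj₂ eq)) = contradiction (trans (point-injective eq) (sym k≡k′)) (Fin.<⇒≢ j<k)

  -- Triples that differ as sets occupy different places in the list `triangles`.
  cosize-≥ : ∀ {m} (f : Fin m → Triple) → (∀ i → Tri₃ (f i)) →
             (∀ {i j} → f i ≈ f j → i ≡ j) → m ≤ cosize B
  cosize-≥ f tri inj = Fin.injective⇒≤ {f = λ i → proj₁ (locate (tri i))} λ {i} {j} eq →
    inj (≈-trans (≈-sym (proj₂ (locate (tri i))))
      (subst (λ n → points (lookup triangles n) ≈ f j) (sym eq) (proj₂ (locate (tri j)))))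

  -- The list has no repetitions and its entries are increasing, so two places never carry the same
  -- set.
  cosize-≤ : ∀ {m} (f : Fin m → Triple) → (∀ {u v w} → Tri u v w → ∃[ i ] (u , v , w) ≈ f i) →
             cosize B ≤ m
  cosize-≤ f cover = Fin.injective⇒≤ {f = proj₁ ∘ covered} λ {n} {n′} eq →
    lookup-injective unique (sorted-unique (triangle-lookup n) (triangle-lookup n′)
      (≈-trans (proj₂ (covered n)) (subst (λ i → f i ≈ points (lookup triangles n′)) (sym eq) (≈-sym (proj₂ (covered n′))))))
    where
    covered : ∀ n → ∃[ i ] points (lookup triangles n) ≈ f i
    covered n = cover (proj₂ (proj₂ (triangle-lookup n)) ∘ middle⇒collinear)
    unique : Unique triangles
    unique = filter⁺ Triangle? (cartesianProduct⁺ (allFin⁺ _) (cartesianProduct⁺ (allFin⁺ _) (allFin⁺ _)))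

-- Finite ground sets, and the points left after removing two

module Enumeration {X : Set} {n} (e : Fin n ↔ X) where
  open Inverse e

  infix 4 _≟ₓ_

  _≟ₓ_ : DecidableEquality X
  _≟ₓ_ = via-injection (↔⇒↣ (↔-sym e)) Fin._≟_

  search : {P : X → Set} → (∀ u → Dec (P u)) → Dec (∃ P)
  search {P} P? = map′ (λ (i , p) → to i , p)
                       (λ (u , p) → from u , subst P (sym (strictlyInverseˡ u)) p)
                       (Fin.any? (P? ∘ to))

module Removal {X : Set} {m} (e : Fin (2 + m) ↔ X) {b c : X} (b≢c : b ≢ c) where
  open Inverse e

  from-≢ : from b ≢ from c
  from-≢ = b≢c ∘ ↔-injective (↔-sym e)

  -- The index of `c` among the indices other than that of `b`.
  hole : Fin (1 + m)
  hole = punchOut from-≢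

  rest : Fin m → X
  rest i = to (punchIn (from b) (punchIn hole i))

  rest-injective : ∀ {i j} → rest i ≡ rest j → i ≡ j
  rest-injective eq = Fin.punchIn-injective hole _ _ (Fin.punchIn-injective (from b) _ _ (↔-injective e eq))

  rest-≢₁ : ∀ i → rest i ≢ b
  rest-≢₁ i eq = Fin.punchInᵢ≢i (from b) _ (trans (sym (strictlyInverseʳ _)) (cong from eq))

  rest-≢₂ : ∀ i → rest i ≢ c
  rest-≢₂ i eq = Fin.punchInᵢ≢i hole i (Fin.punchIn-injective (from b) _ _
    (trans (sym (strictlyInverseʳ _)) (trans (cong from eq) (sym (Fin.punchIn-punchOut from-≢)))))

-- With fewer than n - 2 triangles, all triangles share one pair of points

module Concentration (B : Betweenness) {m : ℕ} (e : Fin (2 + m) ↔ Betweenness.X B)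
                     (sq : Geometry.Squareless B) (few : ¬ m ≤ cosize B) where
  open Geometry B
  open Counting B
  open Enumeration e

  private variable
    a b c p q r s u v w : X
    t t′ : Triple

  -- All n points but b and c own distinct triangles, against cosize < n − 2.
  too-many : {Owns : X → Triple → Set} → b ≢ c →
             (∀ u → u ≢ b → u ≢ c → ∃[ t ] Tri₃ t × Owns u t) →
             (∀ {u v t t′} → Owns u t → Owns v t′ → t ≈ t′ → u ≡ v) → ⊥
  too-many {Owns = Owns} b≢c own disjoint = few (cosize-≥ (proj₁ ∘ owned) (proj₁ ∘ proj₂ ∘ owned)
    λ {i} {j} t≈t′ → rest-injective (disjoint (proj₂ (proj₂ (owned i))) (proj₂ (proj₂ (owned j))) t≈t′))
    where
    open Removal e b≢c
    owned : ∀ i → ∃[ t ] Tri₃ t × Owns (rest i) t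
    owned i = own (rest i) (rest-≢₁ i) (rest-≢₂ i)

  corner? : ∀ a b c s → Dec (Corner a b c s)
  corner? a b c s = s ≟ₓ a ⊎-dec s ≟ₓ b ⊎-dec s ≟ₓ c

  outside? : ∀ a b c s → Dec (Outside a b c s)
  outside? a b c s = ¬? (s ≟ₓ a) ×-dec ¬? (s ≟ₓ b) ×-dec ¬? (s ≟ₓ c)

  ¬corner⇒outside : ¬ Corner a b c s → Outside a b c s
  ¬corner⇒outside ¬s = ¬s ∘ inj₁ , ¬s ∘ inj₂ ∘ inj₁ , ¬s ∘ inj₂ ∘ inj₂

  Wide : X → X → X → Triple → Set
  Wide a b c t = ∃[ p ] ∃[ q ] Outside a b c p × Outside a b c q × p ≢ q × p ∈₃ t × q ∈₃ t

  data Owns (a b c : X) (Extra : X → Triple → Set) : X → Triple → Set where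
    base  : Owns a b c Extra a (a , b , c)
    link  : Outside a b c u → Corner a b c s → Corner a b c r → Owns a b c Extra u (u , s , r)
    extra : Extra u t → Owns a b c Extra u t

  -- Owned triangles are told apart by their number of points outside abc: none for `base`, one for
  -- `link`, at least two for `extra`. The one outside point of a `link` triangle is its owner, so
  -- only extra triangles remain to be compared with each other.
  surplus : ∀ {Extra : X → Triple → Set} → Tri a b c →
            (∀ u → Outside a b c u → Linked a b c u ⊎ (∃[ t ] Tri₃ t × Extra u t)) →
            (∀ {u t} → Extra u t → Wide a b c t) →
            (∀ {u v t t′} → Extra u t → Extra v t′ → t ≈ t′ → u ≡ v) → ⊥
  surplus {a} {b} {c} {Extra} abc supply wide disjoint = too-many (tri-≢₂₃ abc) own disjointly
    where
    own : ∀ u → u ≢ b → u ≢ c → ∃[ t ] Tri₃ t × Owns a b c Extra u t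
    own u u≢b u≢c with u ≟ₓ a
    ... | yes refl = _ , abc , base
    ... | no u≢a with supply u (u≢a , u≢b , u≢c)
    ...   | inj₁ (inj₁ uab)        = _ , uab , link (u≢a , u≢b , u≢c) (inj₁ refl) (inj₂ (inj₁ refl))
    ...   | inj₁ (inj₂ (inj₁ ubc)) = _ , ubc , link (u≢a , u≢b , u≢c) (inj₂ (inj₁ refl)) (inj₂ (inj₂ refl))
    ...   | inj₁ (inj₂ (inj₂ uac)) = _ , uac , link (u≢a , u≢b , u≢c) (inj₁ refl) (inj₂ (inj₂ refl))
    ...   | inj₂ (t , tri , ex)    = t , tri , extra ex

    base-link : Outside a b c u → ¬ (a , b , c) ≈ (u , s , r)
    base-link ou (_ , g) = corner-≢ (g (inj₁ refl)) ou refl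

    base-extra : Extra u t → ¬ (a , b , c) ≈ t
    base-extra ex (_ , g) with wide ex
    ... | _ , _ , op , _ , _ , p∈t , _ = corner-≢ (g p∈t) op refl

    only-outside : Corner a b c s → Corner a b c r → Outside a b c p → p ∈₃ (u , s , r) → p ≡ u
    only-outside _  _  _  (inj₁ p≡u)         = p≡u
    only-outside cs _  op (inj₂ (inj₁ refl)) = contradiction refl (corner-≢ cs op)
    only-outside _  cr op (inj₂ (inj₂ refl)) = contradiction refl (corner-≢ cr op)

    link-extra : Corner a b c s → Corner a b c r → Extra v t → ¬ (u , s , r) ≈ t
    link-extra cs cr ex (_ , g) with wide ex
    ... | _ , _ , op , oq , p≢q , p∈t , q∈t =
      p≢q (trans (only-outside cs cr op (g p∈t)) (sym (only-outside cs cr oq (g q∈t))))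

    disjointly : Owns a b c Extra u t → Owns a b c Extra v t′ → t ≈ t′ → u ≡ v
    disjointly base           base            _ = refl
    disjointly base           (link ou _ _)   e = contradiction e (base-link ou)
    disjointly base           (extra ex)      e = contradiction e (base-extra ex)
    disjointly (link ou _ _)  base            e = contradiction (≈-sym e) (base-link ou)
    disjointly (link ou _ _)  (link _ cs cr)  e = only-outside cs cr ou (proj₁ e (inj₁ refl))
    disjointly (link _ cs cr) (extra ex)      e = contradiction e (link-extra cs cr ex)
    disjointly (extra ex)     base            e = contradiction (≈-sym e) (base-extra ex)
    disjointly (extra ex)     (link _ cs cr)  e = contradiction (≈-sym e) (link-extra cs cr ex)
    disjointly (extra ex)     (extra ex′)     e = disjoint ex ex′ e

  unlinked-exists : Tri a b c → ∃[ r ] Outside a b c r × ¬ Linked a b c r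
  unlinked-exists {a} {b} {c} abc with search (λ u → outside? a b c u ×-dec ¬? (linked? a b c u))
  ... | yes found = found
  ... | no ¬found = ⊥-elim (surplus {Extra = λ _ _ → ⊥} abc
    (λ u ou → inj₁ (decidable-stable (linked? a b c u) λ ¬lu → ¬found (u , ou , ¬lu)))
    (λ ()) (λ ()))

  -- Every unlinked point other than r gets a triangle through r. Two triangles lie on the pair r,
  -- q: the one with `s` goes to q, which the condition `u ≡ q → v ≡ s` enforces, and the one with
  -- `s′` goes to r.
  data Fan (a b c r q s s′ : X) : X → Triple → Set where
    through : Outside a b c u → u ≢ r → Corner a b c v → (u ≡ q → v ≡ s) → Fan a b c r q s s′ u (r , u , v)
    second  : Fan a b c r q s s′ r (r , q , s′)

  unlinked-unique : Tri a b c → Outside a b c r → Outside a b c q →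
                    ¬ Linked a b c r → ¬ Linked a b c q → q ≡ r
  unlinked-unique {a} {b} {c} {r} {q} abc or oq ¬lr ¬lq = decidable-stable (q ≟ₓ r) λ q≢r →
    case-two q≢r (two-triangles sq abc or oq (q≢r ∘ sym) ¬lr ¬lq)
    where
    case-two : q ≢ r → TwoTriangles a b c r q → ⊥
    case-two q≢r (s , s′ , cs , cs′ , s≢s′ , rqs , rqs′) = surplus abc supply wide disjoint
      where
      supply : ∀ u → Outside a b c u → Linked a b c u ⊎ (∃[ t ] Tri₃ t × Fan a b c r q s s′ u t)
      supply u ou with linked? a b c u | u ≟ₓ r | u ≟ₓ q
      ... | yes lu | _        | _        = inj₁ lu
      ... | no _   | yes refl | _        = inj₂ (_ , rqs′ , second)
      ... | no _   | no u≢r   | yes refl = inj₂ (_ , rqs , through ou u≢r cs (λ _ → refl))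
      ... | no ¬lu | no u≢r   | no u≢q with two-triangles sq abc or ou (u≢r ∘ sym) ¬lr ¬lu
      ...   | _ , _ , cv , _ , _ , ruv , _ = inj₂ (_ , ruv , through ou u≢r cv (λ u≡q → contradiction u≡q u≢q))

      wide : ∀ {u t} → Fan a b c r q s s′ u t → Wide a b c t
      wide (through ou u≢r _ _) = _ , _ , or , ou , u≢r ∘ sym , inj₁ refl , inj₂ (inj₁ refl)
      wide second               = _ , _ , or , oq , q≢r ∘ sym , inj₁ refl , inj₂ (inj₁ refl)

      through-second : Outside a b c u → Corner a b c v → (u ≡ q → v ≡ s) → ¬ (r , u , v) ≈ (r , q , s′)
      through-second ou cv v≡s (_ , g) with g (inj₂ (inj₁ refl))
      ... | inj₁ q≡r         = q≢r q≡r
      ... | inj₂ (inj₂ refl) = corner-≢ cv oq refl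
      ... | inj₂ (inj₁ q≡u) with g (inj₂ (inj₂ refl))
      ...   | inj₁ s′≡r        = corner-≢ cs′ or s′≡r
      ...   | inj₂ (inj₁ s′≡u) = corner-≢ cs′ ou s′≡u
      ...   | inj₂ (inj₂ s′≡v) = s≢s′ (sym (trans s′≡v (v≡s (sym q≡u))))

      disjoint : ∀ {u v t t′} → Fan a b c r q s s′ u t → Fan a b c r q s s′ v t′ → t ≈ t′ → u ≡ v
      disjoint (through ou u≢r _ _) (through _ _ cv _) (f , _) with f (inj₂ (inj₁ refl))
      ... | inj₁ u≡r         = contradiction u≡r u≢r
      ... | inj₂ (inj₁ u≡v)  = u≡v
      ... | inj₂ (inj₂ refl) = contradiction refl (corner-≢ cv ou)
      disjoint (through ou _ cv h) second               e = contradiction e (through-second ou cv h)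
      disjoint second              (through ou _ cv h)  e = contradiction (≈-sym e) (through-second ou cv h)
      disjoint second              second               _ = refl

  -- p and q will become y and z, and r is the one further point collinear with them. The spokes
  -- already account for n - 3 triangles.
  record Pivot (p q r : X) : Set where
    field
      p≢q : p ≢ q
      r≢p : r ≢ p
      r≢q : r ≢ q
      spokes : ∀ u → u ≢ p → u ≢ q → u ≢ r → Tri p q u

  module _ (abc : Tri a b c) (or : Outside a b c r) (¬lr : ¬ Linked a b c r) where
    linked : Outside a b c u → u ≢ r → Linked a b c u
    linked {u} ou u≢r = decidable-stable (linked? a b c u) λ ¬lu →
      u≢r (unlinked-unique abc or ou ¬lr ¬lu)

    -- A wide triangle could be given to r, the only point besides b and c that owns none, and this
    -- would complete n - 2 triangles.
    not-wide : Tri₃ t → ¬ Wide a b c t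
    not-wide {t} tri wide = surplus {Extra = λ u t′ → u ≡ r × t′ ≡ t} abc supply
      (λ where (_ , refl) → wide) (λ where (refl , _) (refl , _) _ → refl)
      where
      supply : ∀ u → Outside a b c u → Linked a b c u ⊎ (∃[ t′ ] Tri₃ t′ × u ≡ r × t′ ≡ t)
      supply u ou with u ≟ₓ r
      ... | yes refl = inj₂ (t , tri , refl , refl)
      ... | no u≢r   = inj₁ (linked ou u≢r)

    -- A triangle through r either has another point outside abc and is wide, or has two corners and
    -- links r.
    apex-isolated : ¬ Tri r u v
    apex-isolated {u} {v} ruv with corner? a b c u | corner? a b c v
    ... | no ¬cu | _ = not-wide ruv (_ , _ , or , ¬corner⇒outside ¬cu , tri-≢₁₂ ruv , inj₁ refl , inj₂ (inj₁ refl))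
    ... | yes _ | no ¬cv = not-wide ruv (_ , _ , or , ¬corner⇒outside ¬cv , tri-≢₁₃ ruv , inj₁ refl , inj₂ (inj₂ refl))
    ... | yes (inj₁ refl)        | yes (inj₁ refl)        = tri-≢₂₃ ruv refl
    ... | yes (inj₁ refl)        | yes (inj₂ (inj₁ refl)) = ¬lr (inj₁ ruv)
    ... | yes (inj₁ refl)        | yes (inj₂ (inj₂ refl)) = ¬lr (inj₂ (inj₂ ruv))
    ... | yes (inj₂ (inj₁ refl)) | yes (inj₁ refl)        = ¬lr (inj₁ (tri-swap₂₃ ruv))
    ... | yes (inj₂ (inj₁ refl)) | yes (inj₂ (inj₁ refl)) = tri-≢₂₃ ruv refl
    ... | yes (inj₂ (inj₁ refl)) | yes (inj₂ (inj₂ refl)) = ¬lr (inj₂ (inj₁ ruv))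
    ... | yes (inj₂ (inj₂ refl)) | yes (inj₁ refl)        = ¬lr (inj₂ (inj₂ (tri-swap₂₃ ruv)))
    ... | yes (inj₂ (inj₂ refl)) | yes (inj₂ (inj₁ refl)) = ¬lr (inj₂ (inj₁ (tri-swap₂₃ ruv)))
    ... | yes (inj₂ (inj₂ refl)) | yes (inj₂ (inj₂ refl)) = tri-≢₂₃ ruv refl

    -- The triangles abc and pab determine the pair ab: any further point is
    -- linked to pab but, by not-wide, not through p.
    pivot-linked : Outside a b c p → p ≢ r → Tri p a b → Pivot a b r
    pivot-linked {p} op@(p≢a , p≢b , p≢c) p≢r pab = record
      { p≢q = tri-≢₁₂ abc ; r≢p = proj₁ or ; r≢q = proj₁ (proj₂ or) ; spokes = spokes }
      where
      ¬lr′ : ¬ Linked p a b r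
      ¬lr′ (inj₁ t)        = apex-isolated t
      ¬lr′ (inj₂ (inj₁ t)) = apex-isolated t
      ¬lr′ (inj₂ (inj₂ t)) = apex-isolated t

      spokes : ∀ u → u ≢ a → u ≢ b → u ≢ r → Tri a b u
      spokes u u≢a u≢b u≢r with u ≟ₓ c | u ≟ₓ p
      ... | yes refl | _        = abc
      ... | no _     | yes refl = tri-rotate pab
      ... | no u≢c   | no u≢p   with linked? p a b u
      ...   | yes (inj₁ upa)        = ⊥-elim (not-wide upa (_ , _ , (u≢a , u≢b , u≢c) , op , u≢p , inj₁ refl , inj₂ (inj₁ refl)))
      ...   | yes (inj₂ (inj₁ uab)) = tri-rotate uab
      ...   | yes (inj₂ (inj₂ upb)) = ⊥-elim (not-wide upb (_ , _ , (u≢a , u≢b , u≢c) , op , u≢p , inj₁ refl , inj₂ (inj₁ refl)))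
      -- Relative to pab both u and r are now unlinked, which produces a triangle through r, against
      -- `apex-isolated`.
      ...   | no ¬lu with two-triangles sq pab (u≢p , u≢a , u≢b)
                            (p≢r ∘ sym , proj₁ or , proj₁ (proj₂ or)) u≢r ¬lu ¬lr′
      ...     | _ , _ , _ , _ , _ , urs , _ = ⊥-elim (apex-isolated (tri-swap₁₂ urs))

  swapLinked₂₃ : Linked a c b p → Linked a b c p
  swapLinked₂₃ (inj₁ t)        = inj₂ (inj₂ t)
  swapLinked₂₃ (inj₂ (inj₁ t)) = inj₂ (inj₁ (tri-swap₂₃ t))
  swapLinked₂₃ (inj₂ (inj₂ t)) = inj₁ t

  rotateLinked : Linked b c a p → Linked a b c p
  rotateLinked (inj₁ t)        = inj₂ (inj₁ t)
  rotateLinked (inj₂ (inj₁ t)) = inj₂ (inj₂ (tri-swap₂₃ t))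
  rotateLinked (inj₂ (inj₂ t)) = inj₁ (tri-swap₂₃ t)

  pivot : Tri a b c → ∃[ p ] ∃[ q ] ∃[ r ] Pivot p q r
  pivot {a} {b} {c} abc = go (unlinked-exists abc)
    where
    go : (∃[ r ] Outside a b c r × ¬ Linked a b c r) → ∃[ p ] ∃[ q ] ∃[ r ] Pivot p q r
    go (r , or@(r≢a , r≢b , r≢c) , ¬lr) = further (search (λ u → outside? a b c u ×-dec ¬? (u ≟ₓ r)))
      where
      side : ∀ {p} → Outside a b c p → p ≢ r → Linked a b c p → ∃[ p ] ∃[ q ] ∃[ r ] Pivot p q r
      side op p≢r (inj₁ pab) = a , b , r , pivot-linked abc or ¬lr op p≢r pab
      side (p≢a , p≢b , p≢c) p≢r (inj₂ (inj₁ pbc)) = b , c , r ,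
        pivot-linked (tri-rotate abc) (r≢b , r≢c , r≢a) (¬lr ∘ rotateLinked) (p≢b , p≢c , p≢a) p≢r pbc
      side (p≢a , p≢b , p≢c) p≢r (inj₂ (inj₂ pac)) = a , c , r ,
        pivot-linked (tri-swap₂₃ abc) (r≢a , r≢c , r≢b) (¬lr ∘ swapLinked₂₃) (p≢a , p≢c , p≢b) p≢r pac

      further : Dec (∃[ u ] Outside a b c u × u ≢ r) → ∃[ p ] ∃[ q ] ∃[ r ] Pivot p q r
      further (yes (p , op , p≢r)) = side op p≢r (linked abc or ¬lr op p≢r)
      -- Here a, b, c, r are all the points; c is the only spoke and any side of abc would do.
      further (no ¬p) = a , b , r , record
        { p≢q = tri-≢₁₂ abc ; r≢p = r≢a ; r≢q = r≢b
        ; spokes = λ u u≢a u≢b u≢r →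
            subst (Tri a b) (decidable-stable (c ≟ₓ u) λ c≢u → ¬p (u , (u≢a , u≢b , c≢u ∘ sym) , u≢r)) abc }

  module _ (pv : Pivot p q r) where
    open Pivot pv

    data Spoke (E : Triple) : X → Triple → Set where
      spoke : u ≢ p → u ≢ q → u ≢ r → Spoke E u (p , q , u)
      other : Spoke E r E

    -- The pivot provides a triangle for each point other than p, q, r; one more triangle could be
    -- owned by r, making n - 2.
    spokes-only : ∀ {E} → Tri₃ E → ¬ (∀ {u} → u ≢ r → ¬ E ≈ (p , q , u))
    spokes-only {E} tri ¬spoke = too-many p≢q own disjoint
      where
      own : ∀ u → u ≢ p → u ≢ q → ∃[ t ] Tri₃ t × Spoke E u t
      own u u≢p u≢q with u ≟ₓ r
      ... | yes refl = E , tri , other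
      ... | no u≢r   = _ , spokes u u≢p u≢q u≢r , spoke u≢p u≢q u≢r
      disjoint : ∀ {u v t t′} → Spoke E u t → Spoke E v t′ → t ≈ t′ → u ≡ v
      disjoint (spoke u≢p u≢q _) (spoke _ _ _) (f , _) with f (inj₂ (inj₂ refl))
      ... | inj₁ u≡p        = contradiction u≡p u≢p
      ... | inj₂ (inj₁ u≡q) = contradiction u≡q u≢q
      ... | inj₂ (inj₂ u≡v) = u≡v
      disjoint (spoke _ _ u≢r) other           e = contradiction (≈-sym e) (¬spoke u≢r)
      disjoint other           (spoke _ _ u≢r) e = contradiction e (¬spoke u≢r)
      disjoint other           other           _ = refl

    pivot-collinear : Middle p q r
    pivot-collinear = decidable-stable (middle? p q r) λ pqr → spokes-only pqr λ u≢r e →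
      case-r (proj₁ e (inj₂ (inj₂ refl))) u≢r
      where
      case-r : ∀ {u} → r ∈₃ (p , q , u) → u ≢ r → ⊥
      case-r (inj₁ r≡p)        _   = r≢p r≡p
      case-r (inj₂ (inj₁ r≡q)) _   = r≢q r≡q
      case-r (inj₂ (inj₂ r≡u)) u≢r = u≢r (sym r≡u)

    -- Every triangle is a spoke and therefore contains both p and q.
    off-pivot : ∀ {c} → c ≡ p ⊎ c ≡ q → u ≢ c → v ≢ c → w ≢ c → Middle u v w
    off-pivot {u} {v} {w} {c} c∈ u≢c v≢c w≢c = decidable-stable (middle? u v w) λ uvw →
      spokes-only uvw λ _ e →
      missing (proj₂ e (member c∈))
      where
      member : ∀ {u} → c ≡ p ⊎ c ≡ q → c ∈₃ (p , q , u)
      member (inj₁ c≡p) = inj₁ c≡p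
      member (inj₂ c≡q) = inj₂ (inj₁ c≡q)
      missing : ¬ c ∈₃ (u , v , w)
      missing (inj₁ c≡u)        = u≢c (sym c≡u)
      missing (inj₂ (inj₁ c≡v)) = v≢c (sym c≡v)
      missing (inj₂ (inj₂ c≡w)) = w≢c (sym c≡w)

-- Linear order

-- The cut g becomes the place where `gap` inserts a point.
threshold : ∀ {m} {P : Fin m → Set} → (∀ i → Dec (P i)) →
            (∀ {i j} → i Fin.≤ j → P j → P i) →
            ∃[ g ] g ≤ m × (∀ i → toℕ i < g → P i) × (∀ i → g ≤ toℕ i → ¬ P i)
threshold {zero} P? closed = 0 , z≤n , (λ ()) , λ ()
threshold {suc m} {P} P? closed with P? zero
... | no ¬p₀ = 0 , z≤n , (λ _ ()) , λ i _ p → ¬p₀ (closed z≤n p)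
... | yes p₀ with threshold (P? ∘ suc) (closed ∘ s≤s)
...   | g , g≤m , lower , upper = suc g , s≤s g≤m , lower′ , upper′
  where
  lower′ : ∀ i → toℕ i < suc g → P i
  lower′ zero    _         = p₀
  lower′ (suc i) (s≤s i<g) = lower i i<g
  upper′ : ∀ i → suc g ≤ toℕ i → ¬ P i
  upper′ (suc i) (s≤s g≤i) = upper i g≤i

data Insertion {m} (g : Fin (suc m)) : Fin (suc m) → Set where
  here  : Insertion g g
  there : ∀ i → Insertion g (punchIn g i)

insertion : ∀ {m} (g i : Fin (suc m)) → Insertion g i
insertion g i with g Fin.≟ i
... | yes refl = here
... | no g≢i   = subst (Insertion g) (Fin.punchIn-punchOut g≢i) (there (punchOut g≢i))

punchIn-cancel-< : ∀ {m} (g : Fin (suc m)) i j → punchIn g i Fin.< punchIn g j → i Fin.< j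
punchIn-cancel-< g i j lt = ℕ.≰⇒> λ j≤i → ℕ.<⇒≱ lt (Fin.punchIn-mono-≤ g j i j≤i)

punchIn-< : ∀ {m} (g : Fin (suc m)) i → punchIn g i Fin.< g → toℕ i < toℕ g
punchIn-< (suc g) zero    lt       = s≤s z≤n
punchIn-< (suc g) (suc i) (s≤s lt) = s≤s (punchIn-< g i lt)

punchIn-> : ∀ {m} (g : Fin (suc m)) i → g Fin.< punchIn g i → toℕ g ≤ toℕ i
punchIn-> zero    i       lt       = z≤n
punchIn-> (suc g) (suc i) (s≤s lt) = s≤s (punchIn-> g i lt)

insert-at : ∀ {m} i j (π : Permutation m m) → Perm.insert i j π ⟨$⟩ʳ i ≡ j
insert-at i j π with i Fin.≟ i
... | yes _   = refl
... | no i≢i  = contradiction refl i≢i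

module Order (B : Betweenness) where
  open Geometry B

  Ordered : ∀ {m} → (Fin m → X) → Set
  Ordered s = ∀ {i j k} → i Fin.< j → j Fin.< k → β (s i) (s j) (s k)

  ordered-≤ : ∀ {m} {s : Fin m → X} → Ordered s →
              ∀ {i j k} → i Fin.≤ j → j Fin.≤ k → β (s i) (s j) (s k)
  ordered-≤ {s = s} ord {i} {j} {k} i≤j j≤k with i Fin.≟ j | j Fin.≟ k
  ... | yes refl | _        = β-start
  ... | no _     | yes refl = β-end
  ... | no i≢j   | no j≢k   = ord (Fin.≤∧≢⇒< i≤j i≢j) (Fin.≤∧≢⇒< j≤k j≢k)

  -- The point p can be inserted into the sequence s after its first g points.
  record Gap {m} (g : ℕ) (s : Fin m → X) (p : X) : Set where
    field
      below  : ∀ {i j} → i Fin.< j → toℕ j < g → β (s i) (s j) p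
      around : ∀ {i j} → toℕ i < g → g ≤ toℕ j → β (s i) p (s j)
      above  : ∀ {i j} → i Fin.< j → g ≤ toℕ i → β p (s i) (s j)

  -- Unless p precedes the whole sequence, each term lies before or behind p as seen from the first
  -- term (`side`), and those before p form an initial segment.
  gap : Squareless → ∀ {m} {s : Fin m → X} {p} → Ordered s → (∀ {i j} → s i ≡ s j → i ≡ j) →
        (∀ i j → Middle p (s i) (s j)) → ∃[ g ] g ≤ m × Gap g s p
  gap sq {zero} ord inj mid = 0 , z≤n , record { below = λ { {()} } ; around = λ { {()} } ; above = λ { {()} } }
  gap sq {suc m} {s} {p} ord inj mid with β? p (s zero) (s (fromℕ m))
  ... | yes p0l = 0 , z≤n , record { below = λ _ () ; around = λ () ; above = above }
    where
    above : ∀ {i j} → i Fin.< j → 0 ≤ toℕ i → β p (s i) (s j)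
    above {i} {j} i<j _ = turn (outer
      (inner (turn p0l) (turn (ordered-≤ ord z≤n (Fin.≤fromℕ i))))
      (turn (ordered-≤ ord (ℕ.<⇒≤ i<j) (Fin.≤fromℕ j))))
  ... | no ¬p0l = assemble (threshold (λ j → β? (s zero) (s j) p) λ i≤j 0jp → inner 0jp (ordered-≤ ord z≤n i≤j))
    where
    side : ∀ j → β (s zero) (s j) p ⊎ β (s zero) p (s j)
    side j with mid zero j
    ... | mid₁ 0pj = inj₂ 0pj
    ... | mid₃ pj0 = inj₁ (turn pj0)
    ... | mid₂ p0j with zero Fin.≟ j | j Fin.≟ fromℕ m
    ...   | yes refl | _        = inj₁ β-start
    ...   | no _     | yes refl = contradiction p0j ¬p0l
    ...   | no 0≢j   | no j≢l with mid zero (fromℕ m) | mid j (fromℕ m)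
    ...     | mid₂ p0l | _        = contradiction p0l ¬p0l
    ...     | mid₃ pl0 | _        = inj₁ (inner (turn pl0) (ordered-≤ ord z≤n (Fin.≤fromℕ j)))
    ...     | mid₁ 0pl | mid₁ jpl = inj₁ (turn (outer (turn (ordered-≤ ord z≤n (Fin.≤fromℕ j))) (turn jpl)))
    ...     | mid₁ 0pl | mid₂ pjl = contradiction (inner pjl p0j) ¬p0l
    -- The first term, `s j`, the last term and p form a square; this is the one use of `sq` in the
    -- argument.
    ...     | mid₁ 0pl | mid₃ plj = ⊥-elim (sq (0≢j ∘ inj) (j≢l ∘ inj)
      (ordered-≤ ord z≤n (Fin.≤fromℕ j)) (turn plj) (turn 0pl) p0j)

    assemble : (∃[ g ] g ≤ suc m × (∀ i → toℕ i < g → β (s zero) (s i) p) ×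
                                   (∀ i → g ≤ toℕ i → ¬ β (s zero) (s i) p)) →
               ∃[ g ] g ≤ suc m × Gap g s p
    assemble (g , g≤m , before , ¬before) = g , g≤m , record
      { below  = λ i<j j<g → outer (before _ j<g) (ordered-≤ ord z≤n (ℕ.<⇒≤ i<j))
      ; around = λ i<g g≤j → outer (after _ g≤j) (before _ i<g)
      ; above  = λ i<j g≤i → outer (ordered-≤ ord z≤n (ℕ.<⇒≤ i<j)) (after _ g≤i)
      }
      where
      after : ∀ j → g ≤ toℕ j → β (s zero) p (s j)
      after j g≤j with side j
      ... | inj₁ 0jp = contradiction 0jp (¬before j g≤j)
      ... | inj₂ 0pj = 0pj

  insert-ordered : ∀ {m} (s : Fin m → X) (s′ : Fin (suc m) → X) (g : Fin (suc m)) →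
                   (∀ i → s′ (punchIn g i) ≡ s i) → Ordered s → Gap (toℕ g) s (s′ g) → Ordered s′
  insert-ordered s s′ g eq ord gp {i} {j} {k} i<j j<k with insertion g i | insertion g j | insertion g k
  ... | here    | here    | _       = contradiction i<j (ℕ.<-irrefl refl)
  ... | here    | _       | here    = contradiction (ℕ.<-trans i<j j<k) (ℕ.<-irrefl refl)
  ... | there _ | here    | here    = contradiction j<k (ℕ.<-irrefl refl)
  ... | there i | there j | there k rewrite eq i | eq j | eq k =
    ord (punchIn-cancel-< g i j i<j) (punchIn-cancel-< g j k j<k)
  ... | here    | there j | there k rewrite eq j | eq k =
    Gap.above gp (punchIn-cancel-< g j k j<k) (punchIn-> g j i<j)
  ... | there i | here    | there k rewrite eq i | eq k =
    Gap.around gp (punchIn-< g i i<j) (punchIn-> g k j<k)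
  ... | there i | there j | here    rewrite eq i | eq j =
    Gap.below gp (punchIn-cancel-< g i j i<j) (punchIn-< g j j<k)

  Sorting : ∀ {m} → (Fin m → X) → Set
  Sorting {m} s = ∃ λ (π : Permutation m m) → Ordered (s ∘ (π ⟨$⟩ʳ_))

  -- Insertion sort: the tail is sorted first, and `gap` finds the place of `s zero`.
  sortable : Squareless → ∀ {m} (s : Fin m → X) → (∀ {i j} → s i ≡ s j → i ≡ j) →
             (∀ i j k → Middle (s i) (s j) (s k)) →
             Sorting s
  sortable sq {zero}  s inj mid = Perm.id , λ { {()} }
  sortable sq {suc m} s inj mid = extend
      (sortable sq (s ∘ suc) (Fin.suc-injective ∘ inj) (λ i j k → mid (suc i) (suc j) (suc k)))
    where
    extend : Sorting (s ∘ suc) → Sorting s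
    extend (π , ord) = place (gap sq ord (↔-injective π ∘ Fin.suc-injective ∘ inj)
                                  (λ i j → mid zero (suc (π ⟨$⟩ʳ i)) (suc (π ⟨$⟩ʳ j))))
      where
      place : ∃[ g ] g ≤ m × Gap g (s ∘ suc ∘ (π ⟨$⟩ʳ_)) (s zero) → Sorting s
      place (g , g≤m , gp) = Perm.insert g′ zero π ,
        insert-ordered (s ∘ suc ∘ (π ⟨$⟩ʳ_)) _ g′ (λ i → cong s (Perm.insert-punchIn g′ zero π i)) ord
          (subst₂ (λ g p → Gap g (s ∘ suc ∘ (π ⟨$⟩ʳ_)) p)
            (sym (Fin.toℕ-fromℕ< (s≤s g≤m))) (cong s (sym (insert-at g′ zero π))) gp)
        where
        g′ : Fin (suc m)
        g′ = fromℕ< (s≤s g≤m)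

-- Classification of the possible configurations

data Kind (k : ℕ) : Set where
  𝒬 : Kind k
  ℛ : Fin (1 + k) → Kind k
  𝒮 : Kind k

graph : ∀ {k} → Kind k → Graph
graph {k} 𝒬     = Q k
graph {k} (ℛ i) = R k i
graph {k} 𝒮     = S k

-- The number of path vertices in front of y or z. For `ℛ i` the deleted edge follows the vertex of
-- index i, hence the successor; `2 + k` puts z behind the whole path.
gapY gapZ : ∀ {k} → Kind k → ℕ
gapY 𝒬     = 0
gapY (ℛ i) = suc (toℕ i)
gapY 𝒮     = 0
gapZ 𝒬         = 0
gapZ (ℛ i)     = suc (toℕ i)
gapZ {k} 𝒮     = 2 + k

-- The one path vertex collinear with y and z, that is, the point r of the pivot.
contact : ∀ {k} → Kind k → Fin (2 + k)
contact 𝒬     = zero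
contact (ℛ i) = inject₁ i
contact 𝒮     = zero

swapYZ : ∀ {m} → Vertex m ↔ Vertex m
swapYZ = mk↔ₛ′ swap swap involutive involutive
  where
  swap : ∀ {m} → Vertex m → Vertex m
  swap (x i) = x i
  swap y     = z
  swap z     = y
  involutive : ∀ {m} (v : Vertex m) → swap (swap v) ≡ v
  involutive (x _) = refl
  involutive y     = refl
  involutive z     = refl

reversePath : ∀ {m} → Vertex m ↔ Vertex m
reversePath = mk↔ₛ′ rev rev involutive involutive
  where
  rev : ∀ {m} → Vertex m → Vertex m
  rev (x i) = x (opposite i)
  rev y     = y
  rev z     = z
  involutive : ∀ {m} (v : Vertex m) → rev (rev v) ≡ v
  involutive (x i) = cong x (Fin.opposite-involutive i)
  involutive y     = refl
  involutive z     = refl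

opposite-sum : ∀ {m} (i : Fin m) → suc (toℕ i) + toℕ (opposite i) ≡ m
opposite-sum i = trans (cong (suc (toℕ i) +_) (Fin.opposite-prop i)) (ℕ.m+[n∸m]≡n (Fin.toℕ<n i))

opposite-< : ∀ {m} {i j : Fin m} → i Fin.< j → opposite j Fin.< opposite i
opposite-< {i = i} {j} i<j = ℕ.≰⇒> λ i≤j → ℕ.<-irrefl
  (trans (opposite-sum i) (sym (opposite-sum j))) (ℕ.+-mono-<-≤ (s≤s i<j) i≤j)

module Classification (B : Betweenness) where
  open Geometry B
  open Order B

  -- In each exclusion below, a bad position of p and q makes two different terms collinear with
  -- them, against `alone`.
  module TwoGaps {m} {s : Fin m → X} {p q : X}
                 (alone : ∀ {i j} → Middle p q (s i) → Middle p q (s j) → i ≡ j) where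

    clash : ∀ {i j} → i ≢ j → Middle p q (s i) → Middle p q (s j) → ⊥
    clash i≢j pqi pqj = i≢j (alone pqi pqj)

    -- A term nearer to the gap on the same side as `s i` would lie between p and `s i`, hence
    -- between p and q.
    between-equal : ∀ {g i} → g ≤ m → Gap g s p → β p (s i) q → toℕ i ≡ g ⊎ suc (toℕ i) ≡ g
    between-equal {g} {i} g≤m gp piq with ℕ.<-cmp (toℕ i) g
    ... | tri≈ _ i≡g _ = inj₁ i≡g
    ... | tri> _ _ g<i = ⊥-elim (clash (Fin.<⇒≢ j<i ∘ sym) (mid₃ piq)
                                  (mid₃ (inner piq (Gap.above gp j<i (ℕ.≤-reflexive (sym j≡g))))))
      where
      j   = fromℕ< (ℕ.<-trans g<i (Fin.toℕ<n i))
      j≡g : toℕ j ≡ g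
      j≡g = Fin.toℕ-fromℕ< _
      j<i : j Fin.< i
      j<i = subst (_< toℕ i) (sym j≡g) g<i
    ... | tri< i<g _ _ with ℕ.m≤n⇒m<n∨m≡n i<g
    ...   | inj₂ i+1≡g = inj₂ i+1≡g
    ...   | inj₁ i+1<g = ⊥-elim (clash (Fin.<⇒≢ i<j) (mid₃ piq)
                                  (mid₃ (inner piq (turn (Gap.below gp i<j (subst (_< g) (sym j≡i+1) i+1<g))))))
      where
      j     = fromℕ< (ℕ.<-≤-trans i+1<g g≤m)
      j≡i+1 : toℕ j ≡ suc (toℕ i)
      j≡i+1 = Fin.toℕ-fromℕ< _
      i<j   : i Fin.< j
      i<j   = ℕ.≤-reflexive (sym j≡i+1)

    -- When p and q share a gap, q between p and `s i` makes every other term collinear with p and q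
    -- too.
    beyond-equal : ∀ {g i} (j : Fin m) → i ≢ j → Gap g s p → Gap g s q → ¬ β p q (s i)
    beyond-equal {g} {i} j i≢j gp gq pqi = clash i≢j (mid₂ pqi) other
      where
      other : Middle p q (s j)
      other with toℕ i <? g | toℕ j <? g | Fin.<-cmp i j
      ... | _       | _       | tri≈ _ i≡j _ = contradiction i≡j i≢j
      ... | yes i<g | yes j<g | tri< i<j _ _ = mid₂ (turn (outer (turn pqi) (Gap.below gq i<j j<g)))
      ... | yes i<g | yes j<g | tri> _ _ j<i = mid₂ (inner (turn (Gap.below gp j<i i<g)) pqi)
      ... | yes i<g | no j≮g  | _            = mid₁ (outer (Gap.around gp i<g (ℕ.≮⇒≥ j≮g)) (turn pqi))
      ... | no i≮g  | yes j<g | _            = mid₁ (outer (turn (Gap.around gp j<g (ℕ.≮⇒≥ i≮g))) (turn pqi))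
      ... | no i≮g  | no j≮g  | tri< i<j _ _ = mid₂ (inner (Gap.above gp i<j (ℕ.≮⇒≥ i≮g)) pqi)
      ... | no i≮g  | no j≮g  | tri> _ _ j<i = mid₂ (turn (outer (turn pqi) (turn (Gap.above gq j<i (ℕ.≮⇒≥ j≮g)))))

    -- The terms around the gap of p are arranged as `s i`, p, `s j`, q, so both are collinear with
    -- p and q. Together with the mirror image `no-end`, distinct gaps can only be the two ends.
    no-start : ∀ {g h} → suc g < h → h ≤ m → Gap (suc g) s p → Gap h s q → ⊥
    no-start {g} {h} 1+g<h h≤m gp gq = clash (Fin.<⇒≢ i<j) (mid₁ (turn (inner ijq ipj))) (mid₃ (outer ijq ipj))
      where
      1+g<m = ℕ.<-≤-trans 1+g<h h≤m
      j = fromℕ< 1+g<m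
      i = fromℕ< (ℕ.<-trans (ℕ.n<1+n g) 1+g<m)
      i≡g : toℕ i ≡ g
      i≡g = Fin.toℕ-fromℕ< _
      j≡1+g : toℕ j ≡ suc g
      j≡1+g = Fin.toℕ-fromℕ< _
      i<j : i Fin.< j
      i<j = ℕ.≤-reflexive (trans (cong suc i≡g) (sym j≡1+g))
      ijq : β (s i) (s j) q
      ijq = Gap.below gq i<j (subst (_< h) (sym j≡1+g) 1+g<h)
      ipj : β (s i) p (s j)
      ipj = Gap.around gp (s≤s (ℕ.≤-reflexive i≡g)) (ℕ.≤-reflexive (sym j≡1+g))

    no-end : ∀ {g h} → g < h → h < m → Gap g s p → Gap h s q → ⊥
    no-end {g} {suc h} (s≤s g≤h) 1+h<m gp gq = clash (Fin.<⇒≢ i<j) (mid₃ (turn (outer jip jqi))) (mid₂ (turn (inner jip jqi)))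
      where
      j = fromℕ< 1+h<m
      i = fromℕ< (ℕ.<-trans (ℕ.n<1+n h) 1+h<m)
      i≡h : toℕ i ≡ h
      i≡h = Fin.toℕ-fromℕ< _
      j≡1+h : toℕ j ≡ suc h
      j≡1+h = Fin.toℕ-fromℕ< _
      i<j : i Fin.< j
      i<j = ℕ.≤-reflexive (trans (cong suc i≡h) (sym j≡1+h))
      jip : β (s j) (s i) p
      jip = turn (Gap.above gp i<j (subst (g ≤_) (sym i≡h) g≤h))
      jqi : β (s j) q (s i)
      jqi = turn (Gap.around gq (s≤s (ℕ.≤-reflexive i≡h)) (ℕ.≤-reflexive (sym j≡1+h)))

    between-ends : ∀ {i} (j : Fin m) → i ≢ j → Gap 0 s p → Gap m s q → ¬ β p (s i) q
    between-ends {i} j i≢j gp gq piq with Fin.<-cmp i j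
    ... | tri< i<j _ _ = clash i≢j (mid₃ piq) (mid₃ (turn (inner (turn piq) (turn (Gap.below gq i<j (Fin.toℕ<n j))))))
    ... | tri≈ _ i≡j _ = i≢j i≡j
    ... | tri> _ _ j<i = clash i≢j (mid₃ piq) (mid₃ (inner piq (Gap.above gp j<i z≤n)))

    -- The relation `β p q (s i)` passes on to every later term, which leaves only the last one.
    beyond-end : ∀ {i j} → i Fin.< j → Gap m s q → ¬ β p q (s i)
    beyond-end i<j gq pqi = clash (Fin.<⇒≢ i<j) (mid₂ pqi)
      (mid₂ (turn (outer (turn pqi) (Gap.below gq i<j (Fin.toℕ<n _)))))

    beyond-start : ∀ {i j} → j Fin.< i → Gap 0 s p → ¬ β q p (s i)
    beyond-start j<i gp qpi = clash (Fin.<⇒≢ j<i ∘ sym) (mid₁ qpi)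
      (mid₁ (turn (outer (turn qpi) (turn (Gap.above gp j<i z≤n)))))

  record Frame {m} (g h : ℕ) (L : Vertex m ↔ X) : Set where
    open Inverse L using (to)
    field
      ordered : Ordered (to ∘ x)
      gap-y   : Gap g (to ∘ x) (to y)
      gap-z   : Gap h (to ∘ x) (to z)
      alone   : ∀ {i j} → Middle (to y) (to z) (to (x i)) → Middle (to y) (to z) (to (x j)) → i ≡ j

  Contact : ∀ {k} → Kind k → (Vertex (2 + k) → X) → Set
  Contact 𝒬     f = β (f y) (f (x zero)) (f z)
  Contact (ℛ i) f = β (f y) (f (x (inject₁ i))) (f z)
  Contact 𝒮     f = β (f (x zero)) (f y) (f z)

  -- Betweenness data without distances; through `verdict` they decide every triple of the
  -- structure.
  record Config {k} (κ : Kind k) : Set where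
    field
      label   : Vertex (2 + k) ↔ X
      frame   : Frame (gapY κ) (gapZ κ) label
      touches : Contact κ (Inverse.to label)

  gap-reverse : ∀ {m g h} {s : Fin m → X} {p} → g + h ≡ m → Gap g s p → Gap h (s ∘ opposite) p
  gap-reverse {m} {g} {h} g+h≡m gp = record
    { below  = λ i<j j<h → turn (Gap.above gp (opposite-< i<j) (reflect-< j<h))
    ; around = λ i<h h≤j → turn (Gap.around gp (reflect-≥ h≤j) (reflect-< i<h))
    ; above  = λ i<j h≤i → turn (Gap.below gp (opposite-< i<j) (reflect-≥ h≤i))
    }
    where
    reflect-< : ∀ {j : Fin m} → toℕ j < h → g ≤ toℕ (opposite j)
    reflect-< {j} j<h = ℕ.≮⇒≥ λ o<g → ℕ.<-irrefl
      (trans (trans (ℕ.+-comm (toℕ (opposite j)) _) (opposite-sum j)) (sym g+h≡m)) (ℕ.+-mono-<-≤ o<g j<h)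
    reflect-≥ : ∀ {j : Fin m} → h ≤ toℕ j → toℕ (opposite j) < g
    reflect-≥ {j} h≤j = ℕ.≰⇒> λ g≤o → ℕ.<-irrefl
      (trans g+h≡m (sym (trans (ℕ.+-comm (toℕ (opposite j)) _) (opposite-sum j)))) (ℕ.+-mono-≤-< g≤o (s≤s h≤j))

  frame-swap : ∀ {m g h} {L : Vertex m ↔ X} → Frame g h L → Frame h g (L ↔-∘ swapYZ)
  frame-swap F = record { ordered = ordered ; gap-y = gap-z ; gap-z = gap-y
                        ; alone = λ p q → alone (swap₁₂ p) (swap₁₂ q) }
    where open Frame F

  frame-reverse : ∀ {m g h g′ h′} {L : Vertex m ↔ X} → g + g′ ≡ m → h + h′ ≡ m →
                  Frame g h L → Frame g′ h′ (L ↔-∘ reversePath)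
  frame-reverse eq eq′ F = record
    { ordered = λ i<j j<k → turn (ordered (opposite-< j<k) (opposite-< i<j))
    ; gap-y   = gap-reverse eq gap-y
    ; gap-z   = gap-reverse eq′ gap-z
    ; alone   = λ p q → trans (sym (Fin.opposite-involutive _))
                          (trans (cong opposite (alone p q)) (Fin.opposite-involutive _))
    }
    where open Frame F

  module _ {k : ℕ} where
    private
      m : ℕ
      m = 2 + k

    another : (i : Fin m) → ∃[ j ] i ≢ j
    another zero    = suc zero , λ ()
    another (suc i) = zero , λ ()

    -- The contact is the term just in front of the gap. If a term follows the gap, this is `ℛ`; if
    -- the gap is at the end, reversing the path gives `𝒬`.
    classify-touching : ∀ {g i} (L : Vertex m ↔ X) → g ≤ m → suc (toℕ i) ≡ g → Frame g g L →
                        β (Inverse.to L y) (Inverse.to L (x i)) (Inverse.to L z) → ∃ (Config {k})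
    classify-touching {i = i} L g≤m refl F yiz with ℕ.m≤n⇒m<n∨m≡n g≤m
    ... | inj₁ (s≤s i<1+k) = ℛ i₀ , record { label = L
      ; frame   = subst (λ j → Frame (suc j) (suc j) L) (sym (Fin.toℕ-fromℕ< i<1+k)) F
      ; touches = subst (λ j → β _ (Inverse.to L (x j)) _) i≡i₀ yiz }
      where
      i₀ = fromℕ< i<1+k
      i≡i₀ : i ≡ inject₁ i₀
      i≡i₀ = Fin.toℕ-injective (sym (trans (Fin.toℕ-inject₁ i₀) (Fin.toℕ-fromℕ< i<1+k)))
    ... | inj₂ g≡m = 𝒬 , record { label = L ↔-∘ reversePath
      ; frame   = frame-reverse (trans (ℕ.+-identityʳ _) g≡m) (trans (ℕ.+-identityʳ _) g≡m) F
      ; touches = subst (λ j → β _ (Inverse.to L (x j)) _)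
          (Fin.toℕ-injective (trans (ℕ.suc-injective g≡m) (sym (Fin.opposite-prop {m} zero)))) yiz }

    classify-equal : ∀ {g i} (L : Vertex m ↔ X) → g ≤ m → Frame g g L →
                     Middle (Inverse.to L y) (Inverse.to L z) (Inverse.to L (x i)) → ∃ (Config {k})
    classify-equal {g} {i} L g≤m F = λ where
        (mid₁ zyi) → ⊥-elim (TwoGaps.beyond-equal (λ p q → alone (swap₁₂ p) (swap₁₂ q)) j i≢j gap-z gap-y zyi)
        (mid₂ yzi) → ⊥-elim (TwoGaps.beyond-equal alone j i≢j gap-y gap-z yzi)
        (mid₃ yiz) → touching (TwoGaps.between-equal alone g≤m gap-y yiz) yiz
      where
      open Frame F
      j = proj₁ (another i)
      i≢j = proj₂ (another i)
      touching : toℕ i ≡ g ⊎ suc (toℕ i) ≡ g → β (Inverse.to L y) (Inverse.to L (x i)) (Inverse.to L z) → ∃ (Config {k})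
      touching (inj₂ i+1≡g) yiz = classify-touching L g≤m i+1≡g F yiz
      touching (inj₁ i≡g)   yiz = after-gap i≡g yiz F
        where
        after-gap : ∀ {g i} → toℕ i ≡ g → β (Inverse.to L y) (Inverse.to L (x i)) (Inverse.to L z) →
                    Frame g g L → ∃ (Config {k})
        after-gap {i = zero} refl yiz F = 𝒬 , record { label = L ; frame = F ; touches = yiz }
        -- Reversal turns a contact just behind the gap into one just in front of it.
        after-gap {i = i@(suc _)} refl yiz F = classify-touching (L ↔-∘ reversePath) (Fin.toℕ<n (opposite i)) refl
          (frame-reverse sum sum F)
          (subst (λ j → β _ (Inverse.to L (x j)) _) (sym (Fin.opposite-involutive i)) yiz)
          where
          sum : toℕ i + suc (toℕ (opposite i)) ≡ m
          sum = trans (ℕ.+-suc (toℕ i) _) (opposite-sum i)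

    classify-less : ∀ {g h i} (L : Vertex m ↔ X) → g < h → h ≤ m → Frame g h L →
                    Middle (Inverse.to L y) (Inverse.to L z) (Inverse.to L (x i)) → ∃ (Config {k})
    classify-less {suc g} L g<h h≤m F _ = ⊥-elim (TwoGaps.no-start alone g<h h≤m gap-y gap-z)
      where open Frame F
    classify-less {zero} {h} {i} L g<h h≤m F yzi with ℕ.m≤n⇒m<n∨m≡n h≤m
    ... | inj₁ h<m  = ⊥-elim (TwoGaps.no-end alone g<h h<m gap-y gap-z)
      where open Frame F
    ... | inj₂ refl = ends yzi
      where
      open Frame F
      ends : ∀ {i} → Middle (Inverse.to L y) (Inverse.to L z) (Inverse.to L (x i)) → ∃ (Config {k})
      ends {i} (mid₃ yiz) = ⊥-elim (TwoGaps.between-ends alone (proj₁ (another i)) (proj₂ (another i)) gap-y gap-z yiz)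
      ends {zero}  (mid₁ zyi) = 𝒮 , record { label = L ; frame = F ; touches = turn zyi }
      ends {suc i} (mid₁ zyi) = ⊥-elim (TwoGaps.beyond-start alone {j = zero} (s≤s z≤n) gap-y zyi)
      ends {i} (mid₂ yzi) with ℕ.m≤n⇒m<n∨m≡n (Fin.toℕ<n i)
      ... | inj₁ i+1<m = ⊥-elim
        (TwoGaps.beyond-end alone {j = fromℕ< i+1<m} (ℕ.≤-reflexive (sym (Fin.toℕ-fromℕ< i+1<m))) gap-z yzi)
      -- z lies between y and the last vertex; exchanging y and z and reversing the path moves this
      -- contact to the first vertex.
      ... | inj₂ i+1≡m = 𝒮 , record { label = (L ↔-∘ swapYZ) ↔-∘ reversePath
        ; frame   = frame-reverse (ℕ.+-identityʳ m) refl (frame-swap F)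
        ; touches = subst (λ j → β (Inverse.to L (x j)) _ _)
            (Fin.toℕ-injective (trans (ℕ.suc-injective i+1≡m) (sym (Fin.opposite-prop {m} zero)))) (turn yzi) }

    classify : ∀ {g h i} (L : Vertex m ↔ X) → g ≤ m → h ≤ m → Frame g h L →
               Middle (Inverse.to L y) (Inverse.to L z) (Inverse.to L (x i)) → ∃ (Config {k})
    classify {g} {h} L g≤m h≤m F yzi with ℕ.<-cmp g h
    ... | tri< g<h _ _  = classify-less L g<h h≤m F yzi
    ... | tri≈ _ refl _ = classify-equal L g≤m F yzi
    ... | tri> _ _ h<g  = classify-less (L ↔-∘ swapYZ) h<g g≤m (frame-swap F) (swap₁₂ yzi)

-- From the pivot to a labelled configuration

↔-cong : ∀ {A C : Set} (e : A ↔ C) (f : A → C) → (∀ a → Inverse.to e a ≡ f a) → A ↔ C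
↔-cong e f eq = mk↔ₛ′ f from
  (λ c → trans (sym (eq (from c))) (strictlyInverseˡ c))
  (λ a → trans (cong from (sym (eq a))) (strictlyInverseʳ a))
  where open Inverse e

module Labelling {X : Set} {m} (e : Fin (2 + m) ↔ X) {p q : X} (p≢q : p ≢ q) (π : Permutation m m) where
  open Removal e p≢q

  labels : Vertex m → X
  labels y     = p
  labels z     = q
  labels (x i) = rest (π ⟨$⟩ʳ i)

  -- `↔-cong` puts `labels` in place of the composite map, so that the images of y, z and `x i`
  -- reduce to p, q and a term of `rest`.
  labelling : Vertex m ↔ X
  labelling = ↔-cong (e ↔-∘ (σ ↔-∘ ↔-sym (vertices m))) labels agrees
    where
    open Inverse e using (to; from; strictlyInverseˡ)
    ρ : Permutation (1 + m) (1 + m)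
    ρ = Perm.insert zero hole π
    σ : Permutation (2 + m) (2 + m)
    σ = Perm.insert zero (from p) ρ
    agrees : ∀ v → to (σ ⟨$⟩ʳ Inverse.from (vertices m) v) ≡ labels v
    agrees y = trans (cong to (insert-at zero (from p) ρ)) (strictlyInverseˡ p)
    agrees z = begin
      to (σ ⟨$⟩ʳ suc zero)                       ≡⟨ cong to (Perm.insert-punchIn zero (from p) ρ zero) ⟩
      to (punchIn (from p) (ρ ⟨$⟩ʳ zero))       ≡⟨ cong (to ∘ punchIn (from p)) (insert-at zero hole π) ⟩
      to (punchIn (from p) hole)                 ≡⟨ cong to (Fin.punchIn-punchOut from-≢) ⟩
      to (from q)                                ≡⟨ strictlyInverseˡ q ⟩
      q                                          ∎
      where open ≡-Reasoning
    agrees (x i) = cong to (trans (Perm.insert-punchIn zero (from p) ρ (suc i))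
      (cong (punchIn (from p)) (Perm.insert-punchIn zero hole π i)))

module _ (B : Betweenness) where
  open Geometry B
  open Order B
  open Classification B

  few-triangles⇒config : ∀ {k} (e : Fin (4 + k) ↔ X) → Squareless → ¬ (2 + k ≤ cosize B) →
                         ∀ {a b c} → Tri a b c → ∃ (Config {k})
  few-triangles⇒config {k} e sq few abc = from-pivot (pivot abc)
    where
    open Concentration B e sq few
    open Enumeration e using (_≟ₓ_)

    from-pivot : (∃[ p ] ∃[ q ] ∃[ r ] Pivot p q r) → ∃ (Config {k})
    from-pivot (p , q , r , pv) = sorted (sortable sq rest rest-injective
        (λ i j k → off-pivot pv (inj₁ refl) (rest-≢₁ i) (rest-≢₁ j) (rest-≢₁ k)))
      where
      open Pivot pv
      open Removal e p≢q

      sorted : Sorting rest → ∃ (Config {k})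
      sorted (π , ord) = assemble
          (gap sq ord labels-injective λ i j → off-pivot pv (inj₂ refl) p≢q (rest-≢₂ _) (rest-≢₂ _))
          (gap sq ord labels-injective λ i j → off-pivot pv (inj₁ refl) (p≢q ∘ sym) (rest-≢₁ _) (rest-≢₁ _))
        where
        open Labelling e p≢q π

        labels-injective : ∀ {i j} → rest (π ⟨$⟩ʳ i) ≡ rest (π ⟨$⟩ʳ j) → i ≡ j
        labels-injective = ↔-injective π ∘ rest-injective

        only-r : ∀ {i} → Middle p q (labels (x i)) → labels (x i) ≡ r
        only-r {i} pqi = decidable-stable (labels (x i) ≟ₓ r) λ i≢r →
          spokes (labels (x i)) (rest-≢₁ _) (rest-≢₂ _) i≢r pqi

        position-r : ∃[ v ] labels v ≡ r → ∃[ i ] labels (x i) ≡ r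
        position-r (x i , eq) = i , eq
        position-r (y , eq)   = contradiction (sym eq) r≢p
        position-r (z , eq)   = contradiction (sym eq) r≢q

        r-index : ∃[ i ] labels (x i) ≡ r
        r-index = position-r (Inverse.from labelling r , Inverse.strictlyInverseˡ labelling r)

        assemble : (∃[ g ] g ≤ 2 + k × Gap g (labels ∘ x) p) → (∃[ h ] h ≤ 2 + k × Gap h (labels ∘ x) q) →
                   ∃ (Config {k})
        assemble (g , g≤m , gp) (h , h≤m , gq) = classify labelling g≤m h≤m
          record { ordered = ord ; gap-y = gp ; gap-z = gq
                 ; alone = λ pqi pqj → labels-injective (trans (only-r pqi) (sym (only-r pqj))) }
          -- The term r supplies the collinear triple from which `classify` reads off the kind.
          (subst (Middle p q) (sym (proj₂ r-index)) (pivot-collinear pv))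

-- Isomorphism and regularity

module Comparison (A B : Betweenness) where
  private
    module A = Geometry A
    module B = Geometry B

  data Agree (a₁ a₂ a₃ : A.X) (b₁ b₂ b₃ : B.X) : Set where
    both₁   : A.β a₂ a₁ a₃ → B.β b₂ b₁ b₃ → Agree a₁ a₂ a₃ b₁ b₂ b₃
    both₂   : A.β a₁ a₂ a₃ → B.β b₁ b₂ b₃ → Agree a₁ a₂ a₃ b₁ b₂ b₃
    both₃   : A.β a₁ a₃ a₂ → B.β b₁ b₃ b₂ → Agree a₁ a₂ a₃ b₁ b₂ b₃
    neither : A.Tri a₁ a₂ a₃ → B.Tri b₁ b₂ b₃ → Agree a₁ a₂ a₃ b₁ b₂ b₃

  -- By `P3` distinct points have at most one middle, so agreement on it settles all orders. If a
  -- second middle holds in A, two of the points coincide and the claim is trivial.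
  transfer : ∀ {V : Set} {f : V → A.X} {g : V → B.X} → (∀ {u v} → f u ≡ f v → u ≡ v) →
             ∀ {u v w} → Agree (f u) (f v) (f w) (g u) (g v) (g w) →
             A.β (f u) (f v) (f w) → B.β (g u) (g v) (g w)
  transfer inj (both₁ vuw _) uvw with inj (A.β-antisym uvw vuw)
  ... | refl = B.β-start
  transfer inj (both₂ _ guvw) uvw = guvw
  transfer inj (both₃ uwv _) uvw with inj (A.β-antisym (A.turn uvw) (A.turn uwv))
  ... | refl = B.β-end
  transfer inj (neither tri _) uvw = contradiction (A.mid₂ uvw) tri

agree-sym : ∀ {A B a₁ a₂ a₃ b₁ b₂ b₃} → Comparison.Agree A B a₁ a₂ a₃ b₁ b₂ b₃ →
            Comparison.Agree B A b₁ b₂ b₃ a₁ a₂ a₃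
agree-sym (Comparison.both₁ p q)   = Comparison.both₁ q p
agree-sym (Comparison.both₂ p q)   = Comparison.both₂ q p
agree-sym (Comparison.both₃ p q)   = Comparison.both₃ q p
agree-sym (Comparison.neither p q) = Comparison.neither q p

module _ {A B : Betweenness} where
  private
    module A = Geometry A
    module B = Geometry B
  open Comparison

  ≅-from-agreement : ∀ {V : Set} (e : V ↔ A.X) (e′ : V ↔ B.X) →
    (∀ u v w → Agree A B (Inverse.to e u) (Inverse.to e v) (Inverse.to e w)
                         (Inverse.to e′ u) (Inverse.to e′ v) (Inverse.to e′ w)) → A ≅ B
  ≅-from-agreement e e′ agree = record
    { bijection = e′ ↔-∘ ↔-sym e
    ; preserves = λ a b c → mk⇔
        (λ abc → transfer A B {f = e.to} {g = e′.to} (↔-injective e) (agree (e.from a) (e.from b) (e.from c))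
                   (β-resp A (sym (e.strictlyInverseˡ a)) (sym (e.strictlyInverseˡ b)) (sym (e.strictlyInverseˡ c)) abc))
        (λ abc → β-resp A (e.strictlyInverseˡ a) (e.strictlyInverseˡ b) (e.strictlyInverseˡ c)
                   (transfer B A {f = e′.to} {g = e.to} (↔-injective e′)
                     (agree-sym {A} {B} (agree (e.from a) (e.from b) (e.from c))) abc))
    }
    where
    module e = Inverse e
    module e′ = Inverse e′

next : Fin 4 → Fin 4
next 0F = 1F
next 1F = 2F
next 2F = 3F
next 3F = 0F

Chain : Fin 4 → Fin 4 → Fin 4 → Set
Chain i j k = j ≡ next i × k ≡ next j

chain? : ∀ i j k → Dec (Chain i j k)
chain? i j k = j Fin.≟ next i ×-dec k Fin.≟ next j

AnyChain : Fin 4 → Fin 4 → Fin 4 → Set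
AnyChain i j k = i ≡ j ⊎ j ≡ k ⊎ i ≡ k ⊎
  Chain i j k ⊎ Chain k j i ⊎ Chain j i k ⊎ Chain k i j ⊎ Chain i k j ⊎ Chain j k i

-- Omitting one vertex of a 4-cycle leaves three consecutive ones; the check is by exhaustion.
any-chain : ∀ i j k → AnyChain i j k
any-chain = from-yes (Fin.all? λ i → Fin.all? λ j → Fin.all? λ k →
  i Fin.≟ j ⊎-dec j Fin.≟ k ⊎-dec i Fin.≟ k ⊎-dec
  chain? i j k ⊎-dec chain? k j i ⊎-dec chain? j i k ⊎-dec
  chain? k i j ⊎-dec chain? i k j ⊎-dec chain? j k i)

C₄-chain : ∀ i → Betweenness.β (𝓑 C₄) i (next i) (next (next i))
C₄-chain 0F = refl
C₄-chain 1F = refl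
C₄-chain 2F = refl
C₄-chain 3F = refl

module _ (B : Betweenness) where
  open Geometry B
  open Comparison

  record Square (a b c d : X) : Set where
    field
      abc : β a b c
      bcd : β b c d
      cda : β c d a
      dab : β d a b
      a≢b : a ≢ b
      b≢c : b ≢ c

  module _ {a b c d} (sq : Square a b c d) where
    open Square sq

    square-rotate : Square b c d a
    square-rotate = record { abc = bcd ; bcd = cda ; cda = dab ; dab = abc ; a≢b = b≢c ; b≢c = c≢d }
      where
      c≢d : c ≢ d
      c≢d refl = a≢b (β-antisym (turn (turn abc)) (turn dab))

    square-diagonal : a ≢ c
    square-diagonal refl = a≢b (β-loop abc)

  private variable a b c d : X

  corner : X → X → X → X → Fin 4 → X
  corner a b c d 0F = a
  corner a b c d 1F = b
  corner a b c d 2F = c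
  corner a b c d 3F = d

  corner-injective : Square a b c d → ∀ {i j} → corner a b c d i ≡ corner a b c d j → i ≡ j
  corner-injective sq {i} {j} = go i j
    where
    sq′ = square-rotate sq
    sq″ = square-rotate sq′
    sq‴ = square-rotate sq″
    go : ∀ i j → corner _ _ _ _ i ≡ corner _ _ _ _ j → i ≡ j
    go 0F 0F _  = refl
    go 0F 1F eq = contradiction eq (Square.a≢b sq)
    go 0F 2F eq = contradiction eq (square-diagonal sq)
    go 0F 3F eq = contradiction (sym eq) (Square.a≢b sq‴)
    go 1F 0F eq = contradiction (sym eq) (Square.a≢b sq)
    go 1F 1F _  = refl
    go 1F 2F eq = contradiction eq (Square.a≢b sq′)
    go 1F 3F eq = contradiction eq (square-diagonal sq′)
    go 2F 0F eq = contradiction (sym eq) (square-diagonal sq)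
    go 2F 1F eq = contradiction (sym eq) (Square.a≢b sq′)
    go 2F 2F _  = refl
    go 2F 3F eq = contradiction eq (Square.a≢b sq″)
    go 3F 0F eq = contradiction eq (Square.a≢b sq‴)
    go 3F 1F eq = contradiction (sym eq) (square-diagonal sq′)
    go 3F 2F eq = contradiction (sym eq) (Square.a≢b sq″)
    go 3F 3F _  = refl

  -- The four betweennesses give any three corners the middle they have in C₄, and agreement on
  -- middles yields the isomorphism.
  regular⇒squareless : Regular B → Squareless
  regular⇒squareless regular {a} {b} {c} {d} a≢b b≢c abc bcd cda dab =
    regular (mk↣ (corner-injective sq) , ≅-from-agreement (↔-id _) (↔-id _) agree)
    where
    sq : Square a b c d
    sq = record { abc = abc ; bcd = bcd ; cda = cda ; dab = dab ; a≢b = a≢b ; b≢c = b≢c }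

    f = corner a b c d

    f-chain : ∀ i → β (f i) (f (next i)) (f (next (next i)))
    f-chain 0F = abc
    f-chain 1F = bcd
    f-chain 2F = cda
    f-chain 3F = dab

    agree : ∀ i j k → Agree (induced B {4} (mk↣ (corner-injective sq))) (𝓑 C₄) i j k i j k
    agree i j k with any-chain i j k
    ... | inj₁ refl               = both₂ (P1 _ _) (Betweenness.P1 (𝓑 C₄) i k)
    ... | inj₂ (inj₁ refl)        = both₂ β-end (Geometry.β-end (𝓑 C₄) {i} {k})
    ... | inj₂ (inj₂ (inj₁ refl)) = both₃ β-start (Betweenness.P1 (𝓑 C₄) i j)
    ... | inj₂ (inj₂ (inj₂ (inj₁ (refl , refl)))) = both₂ (f-chain i) (C₄-chain i)
    ... | inj₂ (inj₂ (inj₂ (inj₂ (inj₁ (refl , refl))))) = both₂ (turn (f-chain k)) (Betweenness.P2 (𝓑 C₄) k j i (C₄-chain k))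
    ... | inj₂ (inj₂ (inj₂ (inj₂ (inj₂ (inj₁ (refl , refl)))))) = both₁ (f-chain j) (C₄-chain j)
    ... | inj₂ (inj₂ (inj₂ (inj₂ (inj₂ (inj₂ (inj₁ (refl , refl))))))) = both₁ (turn (f-chain k)) (Betweenness.P2 (𝓑 C₄) k i j (C₄-chain k))
    ... | inj₂ (inj₂ (inj₂ (inj₂ (inj₂ (inj₂ (inj₂ (inj₁ (refl , refl)))))))) = both₃ (f-chain i) (C₄-chain i)
    ... | inj₂ (inj₂ (inj₂ (inj₂ (inj₂ (inj₂ (inj₂ (inj₂ (refl , refl)))))))) = both₃ (turn (f-chain j)) (Betweenness.P2 (𝓑 C₄) j k i (C₄-chain j))

  squareless⇒regular : Squareless → Regular B
  squareless⇒regular sq (Y , iso) =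
    sq (distinct 0F 1F λ ()) (distinct 1F 2F λ ()) (chain 0F) (chain 1F) (chain 2F) (chain 3F)
    where
    open _≅_ iso
    open Inverse bijection using (strictlyInverseˡ)
    f : Fin 4 → X
    f = Injection.to Y ∘ from
    distinct : ∀ i j → i ≢ j → f i ≢ f j
    distinct i j i≢j eq = i≢j (trans (sym (strictlyInverseˡ i))
      (trans (cong to (Injection.injective Y eq)) (strictlyInverseˡ j)))
    chain : ∀ i → β (f i) (f (next i)) (f (next (next i)))
    chain i = Equivalence.from (preserves (from i) (from (next i)) (from (next (next i))))
      (β-resp (𝓑 C₄) (sym (strictlyInverseˡ i)) (sym (strictlyInverseˡ (next i)))
        (sym (strictlyInverseˡ (next (next i)))) (C₄-chain i))

-- The betweenness of a configuration, read off its labels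

data Tip : Set where
  tipY tipZ : Tip

tip : ∀ {m} → Tip → Vertex m
tip tipY = y
tip tipZ = z

tip≢x : ∀ t {m} {i : Fin m} → tip t ≢ x i
tip≢x tipY ()
tip≢x tipZ ()

gapAt : ∀ {k} → Kind k → Tip → ℕ
gapAt κ tipY = gapY κ
gapAt κ tipZ = gapZ κ

gapAt-≤ : ∀ {k} (κ : Kind k) t → gapAt κ t ≤ 2 + k
gapAt-≤ 𝒬     tipY = z≤n
gapAt-≤ 𝒬     tipZ = z≤n
gapAt-≤ (ℛ i) tipY = ℕ.<⇒≤ (s≤s (Fin.toℕ<n i))
gapAt-≤ (ℛ i) tipZ = ℕ.<⇒≤ (s≤s (Fin.toℕ<n i))
gapAt-≤ 𝒮     tipY = z≤n
gapAt-≤ 𝒮     tipZ = ℕ.≤-refl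

-- The betweennesses guaranteed by a `Config`, as syntax on labels: `verdict` is worked out once and
-- `interpret` carries it into every structure of the kind.
data Between {k} : Kind k → Vertex (2 + k) → Vertex (2 + k) → Vertex (2 + k) → Set where
  start  : ∀ {κ u v} → Between κ u u v
  turned : ∀ {κ u v w} → Between κ u v w → Between κ w v u
  path   : ∀ {κ i j l} → i Fin.≤ j → j Fin.≤ l → Between κ (x i) (x j) (x l)
  below  : ∀ {κ i j} t → i Fin.< j → toℕ j < gapAt κ t → Between κ (x i) (x j) (tip t)
  around : ∀ {κ i j} t → toℕ i < gapAt κ t → gapAt κ t ≤ toℕ j → Between κ (x i) (tip t) (x j)
  above  : ∀ {κ i j} t → i Fin.< j → gapAt κ t ≤ toℕ i → Between κ (tip t) (x i) (x j)
  touch𝒬 : Between 𝒬 y (x zero) z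
  touchℛ : ∀ {i} → Between (ℛ i) y (x (inject₁ i)) z
  touch𝒮 : Between 𝒮 (x zero) y z

data Spoke {k} (κ : Kind k) : Vertex (2 + k) → Vertex (2 + k) → Vertex (2 + k) → Set where
  spoke    : ∀ {i} → i ≢ contact κ → Spoke κ y z (x i)
  switch₁₂ : ∀ {u v w} → Spoke κ u v w → Spoke κ v u w
  switch₂₃ : ∀ {u v w} → Spoke κ u v w → Spoke κ u w v

data Verdict {k} (κ : Kind k) (u v w : Vertex (2 + k)) : Set where
  mid₁  : Between κ v u w → Verdict κ u v w
  mid₂  : Between κ u v w → Verdict κ u v w
  mid₃  : Between κ u w v → Verdict κ u v w
  apart : Spoke κ u v w → Verdict κ u v w

module _ {k} {κ : Kind k} where

  flip₁₂ : ∀ {u v w} → Verdict κ u v w → Verdict κ v u w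
  flip₁₂ (mid₁ p)  = mid₂ p
  flip₁₂ (mid₂ p)  = mid₁ p
  flip₁₂ (mid₃ p)  = mid₃ (turned p)
  flip₁₂ (apart s) = apart (switch₁₂ s)

  flip₂₃ : ∀ {u v w} → Verdict κ u v w → Verdict κ u w v
  flip₂₃ (mid₁ p)  = mid₁ (turned p)
  flip₂₃ (mid₂ p)  = mid₃ p
  flip₂₃ (mid₃ p)  = mid₂ p
  flip₂₃ (apart s) = apart (switch₂₃ s)

  verdict-path : ∀ i j l → Verdict κ (x i) (x j) (x l)
  verdict-path i j l with Fin.≤-total i j | Fin.≤-total j l | Fin.≤-total i l
  ... | inj₁ i≤j | inj₁ j≤l | _        = mid₂ (path i≤j j≤l)
  ... | inj₁ i≤j | inj₂ l≤j | inj₁ i≤l = mid₃ (path i≤l l≤j)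
  ... | inj₁ i≤j | inj₂ l≤j | inj₂ l≤i = mid₁ (turned (path l≤i i≤j))
  ... | inj₂ j≤i | inj₁ j≤l | inj₁ i≤l = mid₁ (path j≤i i≤l)
  ... | inj₂ j≤i | inj₁ j≤l | inj₂ l≤i = mid₃ (turned (path j≤l l≤i))
  ... | inj₂ j≤i | inj₂ l≤j | _        = mid₂ (turned (path l≤j j≤i))

  verdict-tip : ∀ t i j → Verdict κ (tip t) (x i) (x j)
  verdict-tip t i j with Fin.<-cmp i j
  ... | tri≈ _ refl _ = mid₂ (turned start)
  ... | tri< i<j _ _ = increasing i<j
    where
    increasing : ∀ {i j} → i Fin.< j → Verdict κ (tip t) (x i) (x j)
    increasing {i} {j} i<j with toℕ i <? gapAt κ t | toℕ j <? gapAt κ t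
    ... | _       | yes j<g = mid₃ (turned (below t i<j j<g))
    ... | yes i<g | no j≮g  = mid₁ (around t i<g (ℕ.≮⇒≥ j≮g))
    ... | no i≮g  | no _    = mid₂ (above t i<j (ℕ.≮⇒≥ i≮g))
  ... | tri> _ _ j<i = flip₂₃ (increasing j<i)
    where
    increasing : ∀ {i j} → i Fin.< j → Verdict κ (tip t) (x i) (x j)
    increasing {i} {j} i<j with toℕ i <? gapAt κ t | toℕ j <? gapAt κ t
    ... | _       | yes j<g = mid₃ (turned (below t i<j j<g))
    ... | yes i<g | no j≮g  = mid₁ (around t i<g (ℕ.≮⇒≥ j≮g))
    ... | no i≮g  | no _    = mid₂ (above t i<j (ℕ.≮⇒≥ i≮g))

verdict-contact : ∀ {k} (κ : Kind k) → Verdict κ y z (x (contact κ))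
verdict-contact 𝒬     = mid₃ touch𝒬
verdict-contact (ℛ i) = mid₃ touchℛ
verdict-contact 𝒮     = mid₁ (turned touch𝒮)

module _ {k} {κ : Kind k} where

  verdict-yz : ∀ i → Verdict κ y z (x i)
  verdict-yz i with i Fin.≟ contact κ
  ... | yes refl = verdict-contact κ
  ... | no i≢c   = apart (spoke i≢c)

  verdict : ∀ u v w → Verdict κ u v w
  verdict y     y     w     = mid₂ start
  verdict z     z     w     = mid₂ start
  verdict y     z     y     = mid₃ start
  verdict z     y     z     = mid₃ start
  verdict y     (x _) y     = mid₃ start
  verdict z     (x _) z     = mid₃ start
  verdict u     y     y     = mid₂ (turned start)
  verdict u     z     z     = mid₂ (turned start)
  verdict (x i) (x j) (x l) = verdict-path i j l
  verdict y     (x i) (x j) = verdict-tip tipY i j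
  verdict z     (x i) (x j) = verdict-tip tipZ i j
  verdict (x i) y     (x j) = flip₁₂ (verdict-tip tipY i j)
  verdict (x i) z     (x j) = flip₁₂ (verdict-tip tipZ i j)
  verdict (x i) (x j) y     = flip₂₃ (flip₁₂ (verdict-tip tipY i j))
  verdict (x i) (x j) z     = flip₂₃ (flip₁₂ (verdict-tip tipZ i j))
  verdict y     z     (x i) = verdict-yz i
  verdict z     y     (x i) = flip₁₂ (verdict-yz i)
  verdict y     (x i) z     = flip₂₃ (verdict-yz i)
  verdict z     (x i) y     = flip₂₃ (flip₁₂ (verdict-yz i))
  verdict (x i) y     z     = flip₁₂ (flip₂₃ (verdict-yz i))
  verdict (x i) z     y     = flip₁₂ (flip₂₃ (flip₁₂ (verdict-yz i)))

-- Co-size and regularity of a configuration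

module OrderedSquares (B : Betweenness) where
  open Geometry B
  open Order B

  module _ {m} {s : Fin m → X} (ord : Ordered s) (inj : ∀ {i j} → s i ≡ s j → i ≡ j) where

    -- Turning back would give the same three terms two different middles, against `P3`.
    continue-up : ∀ {i j l} → β (s i) (s j) (s l) → j ≢ l → i Fin.< j → j Fin.< l
    continue-up {i} {j} {l} ijl j≢l i<j with Fin.<-cmp j l | Fin.≤-total i l
    ... | tri< j<l _ _ | _        = j<l
    ... | tri≈ _ j≡l _ | _        = contradiction j≡l j≢l
    ... | tri> _ _ l<j | inj₁ i≤l = contradiction
      (inj (β-antisym (turn ijl) (turn (ordered-≤ ord i≤l (ℕ.<⇒≤ l<j))))) (j≢l ∘ sym)
    ... | tri> _ _ l<j | inj₂ l≤i = contradiction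
      (inj (β-antisym ijl (turn (ordered-≤ ord l≤i (ℕ.<⇒≤ i<j))))) (Fin.<⇒≢ i<j)

    continue-down : ∀ {i j l} → β (s i) (s j) (s l) → j ≢ l → j Fin.< i → l Fin.< j
    continue-down {i} {j} {l} ijl j≢l j<i with Fin.<-cmp j l | Fin.≤-total i l
    ... | tri> _ _ l<j | _        = l<j
    ... | tri≈ _ j≡l _ | _        = contradiction j≡l j≢l
    ... | tri< j<l _ _ | inj₁ i≤l = contradiction
      (sym (inj (β-antisym ijl (ordered-≤ ord (ℕ.<⇒≤ j<i) i≤l)))) (Fin.<⇒≢ j<i)
    ... | tri< j<l _ _ | inj₂ l≤i = contradiction
      (inj (β-antisym (turn ijl) (ordered-≤ ord (ℕ.<⇒≤ j<l) l≤i))) (j≢l ∘ sym)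

    -- The direction of the first side is kept by all further sides, so the fourth cannot return to
    -- the starting index.
    ordered-no-square : ∀ {i j l n} → ¬ Square B (s i) (s j) (s l) (s n)
    ordered-no-square {i} {j} {l} {n} sq with Fin.<-cmp i j
    ... | tri≈ _ refl _ = Square.a≢b sq refl
    ... | tri< i<j _ _  = ℕ.<-irrefl refl (ℕ.<-trans (ℕ.<-trans i<j j<l) (ℕ.<-trans l<n n<i))
      where
      j<l = continue-up (Square.abc sq) (λ { refl → Square.b≢c sq refl }) i<j
      l<n = continue-up (Square.bcd sq) (λ { refl → Square.b≢c (square-rotate B sq) refl }) j<l
      n<i = continue-up (Square.cda sq) (λ { refl → Square.b≢c (square-rotate B (square-rotate B sq)) refl }) l<n
    ... | tri> _ _ j<i  = ℕ.<-irrefl refl (ℕ.<-trans (ℕ.<-trans n>i l>n) (ℕ.<-trans l<j j<i))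
      where
      l<j = continue-down (Square.abc sq) (λ { refl → Square.b≢c sq refl }) j<i
      l>n = continue-down (Square.bcd sq) (λ { refl → Square.b≢c (square-rotate B sq) refl }) l<j
      n>i = continue-down (Square.cda sq) (λ { refl → Square.b≢c (square-rotate B (square-rotate B sq)) refl }) l>n

module Configured (B : Betweenness) {k} {κ : Kind k} (C : Classification.Config B κ) where
  open Geometry B
  open Counting B
  open Order B
  open Classification B
  open OrderedSquares B
  open Config C
  open Frame frame
  open Inverse label using (to; from; strictlyInverseˡ)

  to-injective : ∀ {u v} → to u ≡ to v → u ≡ v
  to-injective = ↔-injective label

  gap-tip : ∀ t → Gap (gapAt κ t) (to ∘ x) (to (tip t))
  gap-tip tipY = gap-y
  gap-tip tipZ = gap-z

  interpret : ∀ {u v w} → Between κ u v w → β (to u) (to v) (to w)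
  interpret start            = β-start
  interpret (turned p)       = turn (interpret p)
  interpret (path i≤j j≤l)   = ordered-≤ ordered i≤j j≤l
  interpret (below t p q)    = Gap.below (gap-tip t) p q
  interpret (around t p q)   = Gap.around (gap-tip t) p q
  interpret (above t p q)    = Gap.above (gap-tip t) p q
  interpret touch𝒬           = touches
  interpret touchℛ           = touches
  interpret touch𝒮           = touches

  contact-collinear : Middle (to y) (to z) (to (x (contact κ)))
  contact-collinear = at-contact κ touches
    where
    at-contact : ∀ κ → Contact κ to → Middle (to y) (to z) (to (x (contact κ)))
    at-contact 𝒬     yxz = mid₃ yxz
    at-contact (ℛ i) yxz = mid₃ yxz
    at-contact 𝒮     xyz = mid₁ (turn xyz)

  spoke-tri : ∀ {u v w} → Spoke κ u v w → Tri (to u) (to v) (to w)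
  spoke-tri (spoke i≢c) yzi = i≢c (alone yzi contact-collinear)
  spoke-tri (switch₁₂ s)      = tri-swap₁₂ (spoke-tri s)
  spoke-tri (switch₂₃ s)      = tri-swap₂₃ (spoke-tri s)

  spokes : Fin (1 + k) → Triple
  spokes j = to y , to z , to (x (punchIn (contact κ) j))

  spoke-≈ : ∀ {u v w} → Spoke κ u v w → ∃[ j ] (to u , to v , to w) ≈ spokes j
  spoke-≈ (spoke {i} i≢c) = punchOut (i≢c ∘ sym) ,
    subst (λ j → (to y , to z , to (x i)) ≈ (to y , to z , to (x j)))
          (sym (Fin.punchIn-punchOut (i≢c ∘ sym))) ((λ m → m) , λ m → m)
  spoke-≈ (switch₁₂ s) with spoke-≈ s
  ... | j , e = j , ≈-trans ≈-swap₁₂ e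
  spoke-≈ (switch₂₃ s) with spoke-≈ s
  ... | j , e = j , ≈-trans ≈-swap₂₃ e

  tri-spoke : ∀ {u v w} → Tri (to u) (to v) (to w) → Spoke κ u v w
  tri-spoke {u} {v} {w} tri with verdict {κ = κ} u v w
  ... | mid₁ p  = contradiction (mid₁ (interpret p)) tri
  ... | mid₂ p  = contradiction (mid₂ (interpret p)) tri
  ... | mid₃ p  = contradiction (mid₃ (interpret p)) tri
  ... | apart s = s

  x-injective : ∀ {m} {i j : Fin m} → x i ≡ x j → i ≡ j
  x-injective refl = refl

  -- Of the 2 + k path vertices all but the contact form a triangle with y and z, and by `verdict`
  -- no other triple is a triangle.
  config-cosize : cosize B ≡ 1 + k
  config-cosize = ℕ.≤-antisym (cosize-≤ spokes cover)
    (cosize-≥ spokes (λ j → spoke-tri (spoke (Fin.punchInᵢ≢i (contact κ) j)))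
      λ e → same (proj₁ e (inj₂ (inj₂ refl))))
    where
    cover : ∀ {a b c} → Tri a b c → ∃[ j ] (a , b , c) ≈ spokes j
    cover {a} {b} {c} abc = subst (λ t → ∃[ j ] t ≈ spokes j) back
      (spoke-≈ (tri-spoke (subst Tri₃ (sym back) abc)))
      where
      back : (to (from a) , to (from b) , to (from c)) ≡ (a , b , c)
      back = cong₂ _,_ (strictlyInverseˡ a) (cong₂ _,_ (strictlyInverseˡ b) (strictlyInverseˡ c))
    same : ∀ {i j} → to (x (punchIn (contact κ) i)) ∈₃ spokes j → i ≡ j
    same (inj₁ eq)        = contradiction (to-injective eq) λ ()
    same (inj₂ (inj₁ eq)) = contradiction (to-injective eq) λ ()
    same (inj₂ (inj₂ eq)) = Fin.punchIn-injective (contact κ) _ _ (x-injective (to-injective eq))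

  -- Without one of y and z, the structure is an ordered sequence.
  module _ (t : Tip) where
    place : Fin (3 + k)
    place = fromℕ< (s≤s (gapAt-≤ κ t))

    sequence : Fin (3 + k) → Vertex (2 + k)
    sequence = Vec.insertAt x place (tip t)

    sequence-tip : sequence place ≡ tip t
    sequence-tip = Vec.insertAt-lookup x place (tip t)

    sequence-x : ∀ i → sequence (punchIn place i) ≡ x i
    sequence-x = Vec.insertAt-punchIn x place (tip t)

    sequence-ordered : Ordered (to ∘ sequence)
    sequence-ordered = insert-ordered (to ∘ x) (to ∘ sequence) place (λ i → cong to (sequence-x i)) ordered
      (subst₂ (λ g p → Gap g (to ∘ x) p) (sym (Fin.toℕ-fromℕ< _)) (cong to (sym sequence-tip)) (gap-tip t))

    sequence-injective : ∀ {i j} → sequence i ≡ sequence j → i ≡ j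
    sequence-injective {i} {j} eq with insertion place i | insertion place j
    ... | here    | here    = refl
    ... | here    | there j = contradiction (trans (sym sequence-tip) (trans eq (sequence-x j))) (tip≢x t)
    ... | there i | here    = contradiction (trans (sym sequence-tip) (trans (sym eq) (sequence-x i))) (tip≢x t)
    ... | there i | there j = cong (punchIn place)
      (x-injective (trans (sym (sequence-x i)) (trans eq (sequence-x j))))

    InSequence : Vertex (2 + k) → Set
    InSequence v = ∃[ i ] sequence i ≡ v

    x-in : ∀ i → InSequence (x i)
    x-in i = _ , sequence-x i

    tip-in : InSequence (tip t)
    tip-in = _ , sequence-tip

    no-square-in : ∀ {u v w r} → InSequence u → InSequence v → InSequence w → InSequence r →
                   ¬ Square B (to u) (to v) (to w) (to r)
    no-square-in (_ , refl) (_ , refl) (_ , refl) (_ , refl) =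
      ordered-no-square sequence-ordered (sequence-injective ∘ to-injective)

  -- Without z the square would lie in an ordered sequence. With z, its other two corners are path
  -- vertices; any three corners of a square are collinear, so both are collinear with y and z,
  -- against `alone`.
  no-square-at-y : ∀ v w r → ¬ Square B (to y) (to v) (to w) (to r)
  no-square-at-y y w r sq = Square.a≢b sq refl
  no-square-at-y v y r sq = square-diagonal B sq refl
  no-square-at-y v w y sq = Square.b≢c (square-rotate B (square-rotate B sq)) refl
  no-square-at-y z z r sq = Square.b≢c sq refl
  no-square-at-y z w z sq = square-diagonal B (square-rotate B sq) refl
  no-square-at-y v z z sq = Square.b≢c (square-rotate B sq) refl
  no-square-at-y (x i) (x j) (x l) sq = no-square-in tipY (tip-in tipY) (x-in tipY i) (x-in tipY j) (x-in tipY l) sq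
  no-square-at-y z (x i) (x j) sq = Square.b≢c (square-rotate B sq)
    (cong (to ∘ x) (alone (mid₂ (Square.abc sq)) (mid₁ (turn (Square.dab sq)))))
  no-square-at-y (x i) z (x j) sq = square-diagonal B (square-rotate B sq)
    (cong (to ∘ x) (alone (mid₃ (Square.abc sq)) (mid₃ (turn (Square.cda sq)))))
  no-square-at-y (x i) (x j) z sq = Square.b≢c sq
    (cong (to ∘ x) (alone (mid₁ (Square.dab sq)) (mid₂ (turn (Square.cda sq)))))

  y-or-in : ∀ v → v ≡ y ⊎ InSequence tipZ v
  y-or-in y     = inj₁ refl
  y-or-in z     = inj₂ (tip-in tipZ)
  y-or-in (x i) = inj₂ (x-in tipZ i)

  no-square : ∀ u v w r → ¬ Square B (to u) (to v) (to w) (to r)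
  no-square u v w r sq with y-or-in u | y-or-in v | y-or-in w | y-or-in r
  ... | inj₁ refl | _         | _         | _         = no-square-at-y v w r sq
  ... | _         | inj₁ refl | _         | _         = no-square-at-y w r u (square-rotate B sq)
  ... | _         | _         | inj₁ refl | _         = no-square-at-y r u v (square-rotate B (square-rotate B sq))
  ... | _         | _         | _         | inj₁ refl = no-square-at-y u v w (square-rotate B (square-rotate B (square-rotate B sq)))
  ... | inj₂ iu   | inj₂ iv   | inj₂ iw   | inj₂ ir   = no-square-in tipZ iu iv iw ir sq

  config-squareless : Squareless
  config-squareless {a} {b} {c} {d} a≢b b≢c abc bcd cda dab = no-square (from a) (from b) (from c) (from d)
    (back (sym (strictlyInverseˡ a)) (sym (strictlyInverseˡ b)) (sym (strictlyInverseˡ c)) (sym (strictlyInverseˡ d))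
      (record { abc = abc ; bcd = bcd ; cda = cda ; dab = dab ; a≢b = a≢b ; b≢c = b≢c }))
    where
    back : ∀ {a b c d a′ b′ c′ d′} → a ≡ a′ → b ≡ b′ → c ≡ c′ → d ≡ d′ → Square B a b c d → Square B a′ b′ c′ d′
    back refl refl refl refl sq = sq

  config-regular : Regular B
  config-regular = squareless⇒regular B config-squareless

module _ {A B : Betweenness} {k} {κ : Kind k} where
  open Classification

  configs-isomorphic : Config A κ → Config B κ → A ≅ B
  configs-isomorphic C D = ≅-from-agreement (Config.label C) (Config.label D) λ u v w → agree (verdict u v w)
    where
    module C = Configured A C
    module D = Configured B D
    agree : ∀ {u v w} → Verdict κ u v w → Comparison.Agree A B _ _ _ _ _ _
    agree (mid₁ p)  = Comparison.both₁ (C.interpret p) (D.interpret p)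
    agree (mid₂ p)  = Comparison.both₂ (C.interpret p) (D.interpret p)
    agree (mid₃ p)  = Comparison.both₃ (C.interpret p) (D.interpret p)
    agree (apart s) = Comparison.neither (C.spoke-tri s) (D.spoke-tri s)

-- The graphs Q, R and S

module Potential (W : Graph) where
  open Graph W
  open ShortestPath W

  private variable
    u v t : V
    f : V → ℕ

  -- Such a function grows by at most the distance between two vertices, so it certifies lower
  -- bounds for `d`, while explicit edges give the upper bounds.
  Lipschitz : (V → ℕ) → Set
  Lipschitz f = ∀ u v → 0 < weight u v → f v ≤ weight u v + f u

  lipschitz-walk : Lipschitz f → ∀ {u v l} → Walk weight u v l → f v ≤ l + f u
  lipschitz-walk lip [] = ℕ.≤-refl
  lipschitz-walk {f} lip (step {u} {t} {v} {l} pos p) = begin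
    f v                       ≤⟨ lipschitz-walk lip p ⟩
    l + f t                   ≤⟨ ℕ.+-monoʳ-≤ l (lip u t pos) ⟩
    l + (weight u t + f u)    ≡⟨ sym (ℕ.+-assoc l _ _) ⟩
    (l + weight u t) + f u    ≡⟨ cong (_+ f u) (ℕ.+-comm l _) ⟩
    (weight u t + l) + f u    ∎
    where open ℕ.≤-Reasoning

  lipschitz-d : Lipschitz f → ∀ u v → f v ≤ d u v + f u
  lipschitz-d lip u v = lipschitz-walk lip (d-walk u v)

  -- Along a tight pair the potential grows at least as fast as the distance;
  -- for a Lipschitz potential, tight pairs compose to shortest paths.
  record Tight (f : V → ℕ) (u v : V) : Set where
    constructor tight
    field bound : d u v + f u ≤ f v

  tight-refl : Tight f u u
  tight-refl {f} {u} = tight (ℕ.≤-reflexive (cong (_+ f u) (d-refl u)))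

  tight-trans : Tight f u v → Tight f v t → Tight f u t
  tight-trans {f} {u} {v} {t} (tight uv) (tight vt) = tight (begin
    d u t + f u            ≤⟨ ℕ.+-monoˡ-≤ (f u) (d-triangle u v t) ⟩
    (d u v + d v t) + f u  ≡⟨ cong (_+ f u) (ℕ.+-comm (d u v) _) ⟩
    (d v t + d u v) + f u  ≡⟨ ℕ.+-assoc (d v t) _ _ ⟩
    d v t + (d u v + f u)  ≤⟨ ℕ.+-monoʳ-≤ (d v t) uv ⟩
    d v t + f v            ≤⟨ vt ⟩
    f t                    ∎)
    where open ℕ.≤-Reasoning

  tight-edge : ∀ {w} → weight u v ≡ suc w → suc w + f u ≤ f v → Tight f u v
  tight-edge {u} {v} {f} {w} eq le = tight (ℕ.≤-trans (ℕ.+-monoˡ-≤ (f u) short) le)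
    where
    short : d u v ≤ suc w
    short = subst (d u v ≤_) (trans (ℕ.+-identityʳ _) eq) (d-least (step (subst (0 <_) (sym eq) (s≤s z≤n)) []))

  tight-d : Lipschitz f → Tight f u v → d u v + f u ≡ f v
  tight-d lip (tight uv) = ℕ.≤-antisym uv (lipschitz-d lip _ _)

  tight-β : Lipschitz f → Tight f u v → Tight f v t → Betweenness.β (𝓑 W) u v t
  tight-β {f} {u} {v} {t} lip uv vt = ℕ.+-cancelʳ-≡ (f u) _ _ (begin
    d u t + f u            ≡⟨ tight-d lip (tight-trans uv vt) ⟩
    f t                    ≡⟨ tight-d lip vt ⟨
    d v t + f v            ≡⟨ cong (d v t +_) (tight-d lip uv) ⟨
    d v t + (d u v + f u)  ≡⟨ ℕ.+-assoc (d v t) _ _ ⟨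
    (d v t + d u v) + f u  ≡⟨ cong (_+ f u) (ℕ.+-comm (d v t) _) ⟩
    (d u v + d v t) + f u  ∎)
    where open ≡-Reasoning

undirected-lipschitz : ∀ {V : Set} {arc : V → V → ℕ} {f : V → ℕ} →
  (∀ u v → 0 < arc u v → f v ≤ arc u v + f u × f u ≤ arc u v + f v) →
  ∀ u v → 0 < undirected arc u v → f v ≤ undirected arc u v + f u
undirected-lipschitz {arc = arc} {f} lip u v pos with ℕ.⊔-sel (arc u v) (arc v u)
... | inj₁ eq rewrite eq = proj₁ (lip u v pos)
... | inj₂ eq rewrite eq = proj₂ (lip v u pos)

edge-weight→ : ∀ {V : Set} (arc : V → V → ℕ) u v {w} → arc u v ≡ w → arc v u ≡ 0 → undirected arc u v ≡ w
edge-weight→ arc u v refl eq rewrite eq = ℕ.⊔-identityʳ _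

edge-weight← : ∀ {V : Set} (arc : V → V → ℕ) u v {w} → arc v u ≡ w → arc u v ≡ 0 → undirected arc u v ≡ w
edge-weight← arc u v refl eq rewrite eq = refl

pathArc-consecutive : ∀ {m} (a b : Fin m) → 0 < pathArc a b → suc (toℕ a) ≡ toℕ b × pathArc a b ≡ 1
pathArc-consecutive a b pos = by-cases (suc (toℕ a) ≟ toℕ b)
  where
  by-cases : Dec (suc (toℕ a) ≡ toℕ b) → suc (toℕ a) ≡ toℕ b × pathArc a b ≡ 1
  by-cases (yes eq) = eq , cong (if_then 1 else 0) (dec-true (suc (toℕ a) ≟ toℕ b) eq)
  by-cases (no neq) = contradiction pos
    (ℕ.<-irrefl (sym (cong (if_then 1 else 0) (dec-false (suc (toℕ a) ≟ toℕ b) neq))))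

pathArc-forward : ∀ {m} (j : Fin m) → pathArc (inject₁ j) (suc j) ≡ 1
pathArc-forward j rewrite dec-true (suc (toℕ (inject₁ j)) ≟ suc (toℕ j)) (cong suc (Fin.toℕ-inject₁ j)) = refl

pathArc-backward : ∀ {m} (j : Fin m) → pathArc (suc j) (inject₁ j) ≡ 0
pathArc-backward j rewrite dec-false (suc (suc (toℕ j)) ≟ toℕ (inject₁ j))
  (λ eq → ℕ.<-irrefl (sym (trans eq (Fin.toℕ-inject₁ j))) (ℕ.m≤n⇒m≤1+n (ℕ.n<1+n _))) = refl

path-lipschitz : ∀ {m} (a b : Fin m) (f : Fin m → ℕ) → (suc (toℕ a) ≡ toℕ b → f b ≡ 1 + f a) →
                 0 < pathArc a b → f b ≤ pathArc a b + f a × f a ≤ pathArc a b + f b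
path-lipschitz a b f up pos with pathArc-consecutive a b pos
... | eq , eq′ rewrite eq′ | up eq = ℕ.≤-refl , ℕ.m≤n⇒m≤1+n (ℕ.n≤1+n _)

-- If a potential rises by the full distance at each step of `s`, then `s` runs along a shortest
-- path; only consecutive pairs need checking.
module Thread (W : Graph) {m} (s : Fin (suc m) → Graph.V W) {f : Graph.V W → ℕ} where
  open Potential W
  open Geometry (𝓑 W)
  open Order (𝓑 W)

  module _ (lip : Lipschitz f) (consecutive : ∀ j → Tight f (s (inject₁ j)) (s (suc j))) where

    chain : ∀ {i j} → i Fin.≤ j → Tight f (s i) (s j)
    chain {i} = <-weakInduction-startingFrom (λ j → Tight f (s i) (s j)) (tight-refl)
      (λ j t → tight-trans t (consecutive j))

    thread-ordered : Ordered s
    thread-ordered i<j j<k = tight-β lip (chain (ℕ.<⇒≤ i<j)) (chain (ℕ.<⇒≤ j<k))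

    thread-gap : ∀ {g p} → (∀ i → toℕ i < g → Tight f (s i) p) → (∀ i → g ≤ toℕ i → Tight f p (s i)) →
                 Gap g s p
    thread-gap before after = record
      { below  = λ i<j j<g → tight-β lip (chain (ℕ.<⇒≤ i<j)) (before _ j<g)
      ; around = λ i<g g≤j → tight-β lip (before _ i<g) (after _ g≤j)
      ; above  = λ i<j g≤i → tight-β lip (after _ g≤i) (chain (ℕ.<⇒≤ i<j))
      }

-- As u and v are equally far from t, neither can be the middle, and t halves the distance 2.
twins : ∀ W {u v t : Graph.V W} → let open ShortestPath W in
        d u v ≡ 2 → d u t ≡ d v t → Geometry.Middle (𝓑 W) u v t → d u t ≡ 1
twins W {u} {v} {t} uv≡2 ut≡vt = λ where
    (Geometry.mid₁ vut) → ⊥-elim (far (trans ut≡vt (trans vut (cong (_+ d u t) (trans (d-sym v u) uv≡2)))))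
    (Geometry.mid₂ uvt) → ⊥-elim (far (trans uvt (cong₂ _+_ uv≡2 (sym ut≡vt))))
    (Geometry.mid₃ utv) → half (trans (sym uv≡2) (trans utv (cong (d u t +_) (trans (d-sym t v) (sym ut≡vt)))))
  where
  open ShortestPath W
  far : ∀ {n} → n ≢ 2 + n
  far = ℕ.<⇒≢ (ℕ.m≤n⇒m≤1+n (ℕ.n<1+n _))
  half : ∀ {n} → 2 ≡ n + n → n ≡ 1
  half {1} _ = refl
  half {suc (suc n)} eq rewrite ℕ.+-suc n (suc n) = contradiction eq λ ()

module _ (k : ℕ) where
  open Classification (𝓑 (Q k))
  open Potential (Q k)
  open ShortestPath (Q k)

  private
    -- On the path, `depth` is the distance from y and from z alike, and so says nothing about the
    -- pair y, z; `span` certifies that their distance is 2.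
    depth span : Vertex (2 + k) → ℕ
    depth (x j) = suc (toℕ j)
    depth y     = 0
    depth z     = 0
    span y     = 0
    span (x _) = 1
    span z     = 2

    depth-lipschitz : Lipschitz depth
    depth-lipschitz = undirected-lipschitz lip
      where
      lip : ∀ u v → 0 < qArc k u v → depth v ≤ qArc k u v + depth u × depth u ≤ qArc k u v + depth v
      lip (x a) (x b)    pos = path-lipschitz a b (suc ∘ toℕ) (cong suc ∘ sym) pos
      lip y     (x zero) pos = s≤s z≤n , z≤n
      lip z     (x zero) pos = s≤s z≤n , z≤n

    span-lipschitz : Lipschitz span
    span-lipschitz = undirected-lipschitz lip
      where
      lip : ∀ u v → 0 < qArc k u v → span v ≤ qArc k u v + span u × span u ≤ qArc k u v + span v
      lip (x a) (x b)    pos = ℕ.m≤n+m _ _ , ℕ.m≤n+m _ _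
      lip y     (x zero) pos = s≤s z≤n , z≤n
      lip z     (x zero) pos = s≤s z≤n , s≤s (s≤s z≤n)

    consecutive : ∀ j → Tight depth (x (inject₁ j)) (x (suc j))
    consecutive j = tight-edge (edge-weight→ (qArc k) (x (inject₁ j)) (x (suc j)) (pathArc-forward j) (pathArc-backward j))
      (s≤s (s≤s (ℕ.≤-reflexive (Fin.toℕ-inject₁ j))))

    open Thread (Q k) x {depth}

    from-y : ∀ j → Tight depth y (x j)
    from-y j = tight-trans (tight-edge refl (s≤s z≤n)) (chain depth-lipschitz consecutive z≤n)

    from-z : ∀ j → Tight depth z (x j)
    from-z j = tight-trans (tight-edge refl (s≤s z≤n)) (chain depth-lipschitz consecutive z≤n)

    y-x₀ : Tight span y (x zero)
    y-x₀ = tight-edge refl (s≤s z≤n)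

    x₀-z : Tight span (x zero) z
    x₀-z = tight-edge refl (s≤s (s≤s z≤n))

    d-y : ∀ j → d y (x j) ≡ suc (toℕ j)
    d-y j = trans (sym (ℕ.+-identityʳ _)) (tight-d depth-lipschitz (from-y j))

    d-z : ∀ j → d z (x j) ≡ suc (toℕ j)
    d-z j = trans (sym (ℕ.+-identityʳ _)) (tight-d depth-lipschitz (from-z j))

    d-yz : d y z ≡ 2
    d-yz = trans (sym (ℕ.+-identityʳ _)) (tight-d span-lipschitz (tight-trans y-x₀ x₀-z))

  Q-config : Config (𝒬 {k})
  Q-config = record
    { label = ↔-id _
    ; frame = record
      { ordered = thread-ordered depth-lipschitz consecutive
      ; gap-y   = thread-gap depth-lipschitz consecutive (λ _ ()) (λ i _ → from-y i)
      ; gap-z   = thread-gap depth-lipschitz consecutive (λ _ ()) (λ i _ → from-z i)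
      ; alone   = λ {i} {j} yzi yzj → Fin.toℕ-injective (trans (first i yzi) (sym (first j yzj)))
      }
    ; touches = tight-β span-lipschitz y-x₀ x₀-z
    }
    where
    first : ∀ i → Geometry.Middle (𝓑 (Q k)) y z (x i) → toℕ i ≡ 0
    first i yzi = ℕ.suc-injective (trans (sym (d-y i)) (twins (Q k) d-yz (trans (d-y i) (sym (d-z i))) yzi))

module _ (k : ℕ) where
  open Classification (𝓑 (S k))
  open Potential (S k)
  open ShortestPath (S k)

  private
    last : Fin (2 + k)
    last = fromℕ (1 + k)

    -- The distances from y and from `x zero`. The graph is a weighted cycle of length 6 + 2k in
    -- which `x zero` and z are antipodal, at distance 3 + k along both arcs.
    from-y from-x : Vertex (2 + k) → ℕ
    from-y y     = 0
    from-y (x j) = suc (toℕ j)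
    from-y z     = 2 + k
    from-x y     = 1
    from-x (x j) = toℕ j
    from-x z     = 3 + k

    last-arc : ∀ a → 0 < sArc k (x a) z → a ≡ last × sArc k (x a) z ≡ 2
    last-arc a pos with a Fin.≟ last
    ... | yes eq = eq , refl

    from-y-lipschitz : Lipschitz from-y
    from-y-lipschitz = undirected-lipschitz lip
      where
      lip : ∀ u v → 0 < sArc k u v → from-y v ≤ sArc k u v + from-y u × from-y u ≤ sArc k u v + from-y v
      lip (x a)    (x b) pos = path-lipschitz a b (suc ∘ toℕ) (cong suc ∘ sym) pos
      lip (x zero) y     pos = z≤n , s≤s z≤n
      lip y        z     pos = ℕ.m≤m+n _ _ , z≤n
      lip (x a)    z     pos with last-arc a pos
      ... | refl , eq rewrite eq | Fin.toℕ-fromℕ k = ℕ.m≤n+m _ 2 , ℕ.m≤n+m _ 2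

    from-x-lipschitz : Lipschitz from-x
    from-x-lipschitz = undirected-lipschitz lip
      where
      lip : ∀ u v → 0 < sArc k u v → from-x v ≤ sArc k u v + from-x u × from-x u ≤ sArc k u v + from-x v
      lip (x a)    (x b) pos = path-lipschitz a b toℕ sym pos
      lip (x zero) y     pos = s≤s z≤n , z≤n
      lip y        z     pos = ℕ.≤-reflexive (ℕ.+-comm 1 _) , s≤s z≤n
      lip (x a)    z     pos with last-arc a pos
      ... | refl , eq rewrite eq | Fin.toℕ-fromℕ k = ℕ.≤-refl , ℕ.m≤n+m _ 4

    step-weight : ∀ j → Graph.weight (S k) (x (inject₁ j)) (x (suc j)) ≡ 1
    step-weight j = edge-weight→ (sArc k) (x (inject₁ j)) (x (suc j)) (pathArc-forward j) (pathArc-backward j)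

    consecutive-y : ∀ j → Tight from-y (x (inject₁ j)) (x (suc j))
    consecutive-y j = tight-edge (step-weight j) (s≤s (s≤s (ℕ.≤-reflexive (Fin.toℕ-inject₁ j))))

    consecutive-x : ∀ j → Tight from-x (x (inject₁ j)) (x (suc j))
    consecutive-x j = tight-edge (step-weight j) (s≤s (ℕ.≤-reflexive (Fin.toℕ-inject₁ j)))

    open Thread (S k) x

    y-x : ∀ j → Tight from-y y (x j)
    y-x j = tight-trans (tight-edge refl (s≤s z≤n)) (chain from-y-lipschitz consecutive-y z≤n)

    last-weight : Graph.weight (S k) (x last) z ≡ 2
    last-weight = edge-weight→ (sArc k) (x last) z (cong (if_then 2 else 0) (dec-true (last Fin.≟ last) refl)) refl

    x-z : ∀ j → Tight from-x (x j) z
    x-z j = tight-trans (chain from-x-lipschitz consecutive-x (Fin.≤fromℕ j))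
      (tight-edge last-weight (s≤s (s≤s (s≤s (ℕ.≤-reflexive (Fin.toℕ-fromℕ k))))))

    x₀-y : Tight from-x (x zero) y
    x₀-y = tight-edge refl (s≤s z≤n)

    y-z : Tight from-x y z
    y-z = tight-edge refl (ℕ.≤-reflexive (ℕ.+-comm (2 + k) 1))

    d-y : ∀ j → d y (x j) ≡ suc (toℕ j)
    d-y j = trans (sym (ℕ.+-identityʳ _)) (tight-d from-y-lipschitz (y-x j))

    d-z : ∀ j → d (x j) z + toℕ j ≡ 3 + k
    d-z j = tight-d from-x-lipschitz (x-z j)

    d-yz : d y z ≡ 2 + k
    d-yz = ℕ.suc-injective (trans (ℕ.+-comm 1 _) (tight-d from-x-lipschitz y-z))

  S-config : Config (𝒮 {k})
  S-config = record
    { label = ↔-id _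
    ; frame = record
      { ordered = thread-ordered from-y-lipschitz consecutive-y
      ; gap-y   = thread-gap from-y-lipschitz consecutive-y (λ _ ()) (λ i _ → y-x i)
      ; gap-z   = thread-gap from-x-lipschitz consecutive-x (λ i _ → x-z i)
                    (λ i m≤i → contradiction (Fin.toℕ<n i) (ℕ.≤⇒≯ m≤i))
      ; alone   = λ {i} {j} yzi yzj → Fin.toℕ-injective (trans (first i yzi) (sym (first j yzj)))
      }
    ; touches = tight-β from-x-lipschitz x₀-y y-z
    }
    where
    open Geometry (𝓑 (S k)) using (Middle; mid₁; mid₂; mid₃)
    first : ∀ i → Middle y z (x i) → toℕ i ≡ 0
    -- With n = `toℕ i` the distances are n + 1 from y, 3 + k - n from z, and 2 + k between y and z.
    -- As n < 2 + k, only y can be the middle, and then n = 0.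
    first i yzi = from-distances (d-y i) (trans (cong (_+ toℕ i) (d-sym z (x i))) (d-z i)) (relations yzi)
      where
      relations : Middle y z (x i) →
                  d z (x i) ≡ (2 + k) + d y (x i) ⊎ d y (x i) ≡ (2 + k) + d z (x i) ⊎
                  2 + k ≡ d y (x i) + d z (x i)
      relations (mid₁ zyi) = inj₁ (trans zyi (cong (_+ d y (x i)) (trans (d-sym z y) d-yz)))
      relations (mid₂ yzi) = inj₂ (inj₁ (trans yzi (cong (_+ d z (x i)) d-yz)))
      relations (mid₃ yiz) = inj₂ (inj₂ (trans (sym d-yz) (trans yiz (cong (d y (x i) +_) (d-sym (x i) z)))))
      from-distances : ∀ {a b} → a ≡ suc (toℕ i) → b + toℕ i ≡ 3 + k →
                       b ≡ (2 + k) + a ⊎ a ≡ (2 + k) + b ⊎ 2 + k ≡ a + b → toℕ i ≡ 0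
      from-distances refl bi (inj₁ refl) = ℕ.m+n≡0⇒m≡0 n (ℕ.suc-injective
        (ℕ.+-cancelˡ-≡ (2 + k) (suc n + n) 1 (trans (sym (ℕ.+-assoc (2 + k) (suc n) n)) (trans bi (ℕ.+-comm 1 (2 + k))))))
        where n = toℕ i
      from-distances {b = b} refl bi (inj₂ (inj₁ ai)) = contradiction
        (ℕ.<-≤-trans (Fin.toℕ<n i) (ℕ.n≤1+n (2 + k)))
        (ℕ.<-irrefl (trans (cong (_+ toℕ i) (sym b≡0)) bi))
        where
        b≡0 : b ≡ 0
        b≡0 = ℕ.n≤0⇒n≡0 (ℕ.+-cancelˡ-≤ (2 + k) b 0
          (subst₂ _≤_ ai (sym (ℕ.+-identityʳ (2 + k))) (Fin.toℕ<n i)))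
      from-distances {b = b} refl bi (inj₂ (inj₂ ab)) = contradiction
        (trans ab (cong suc (trans (ℕ.+-comm (toℕ i) b) bi))) (ℕ.<⇒≢ (ℕ.m≤n⇒m≤1+n (ℕ.n<1+n _)))

module _ (k : ℕ) (i : Fin (1 + k)) where
  open Classification (𝓑 (R k i))
  open Potential (R k i)
  open ShortestPath (R k i)

  private
    arc : Vertex (2 + k) → Vertex (2 + k) → ℕ
    arc = rArc k i

    -- The detour through y or z has length 1 + 2 in place of an edge of length 1, which shifts all
    -- later vertices by 2.
    height : Fin (2 + k) → ℕ
    height a = if does (toℕ a ≤? toℕ i) then toℕ a else 2 + toℕ a

    height-≤ : ∀ {a} → toℕ a ≤ toℕ i → height a ≡ toℕ a
    height-≤ {a} a≤i = cong (if_then toℕ a else 2 + toℕ a) (dec-true (toℕ a ≤? toℕ i) a≤i)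

    height-> : ∀ {a} → toℕ i < toℕ a → height a ≡ 2 + toℕ a
    height-> {a} i<a = cong (if_then toℕ a else 2 + toℕ a) (dec-false (toℕ a ≤? toℕ i) (ℕ.<⇒≱ i<a))

    height-step : ∀ {a b} → a ≢ inject₁ i → suc (toℕ a) ≡ toℕ b → height b ≡ 1 + height a
    height-step {a} {b} a≢i eq with ℕ.<-cmp (toℕ a) (toℕ i)
    ... | tri< a<i _ _ = trans (height-≤ (subst (_≤ toℕ i) eq a<i))
                           (trans (sym eq) (cong suc (sym (height-≤ (ℕ.<⇒≤ a<i)))))
    ... | tri≈ _ a≡i _ = contradiction (Fin.toℕ-injective (trans a≡i (sym (Fin.toℕ-inject₁ i)))) a≢i
    ... | tri> _ _ i<a = trans (height-> (subst (toℕ i <_) eq (ℕ.m≤n⇒m≤1+n i<a)))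
                           (trans (cong (2 +_) (sym eq)) (cong suc (sym (height-> i<a))))

    height-left : height (inject₁ i) ≡ toℕ i
    height-left = trans (height-≤ (ℕ.≤-reflexive (Fin.toℕ-inject₁ i))) (Fin.toℕ-inject₁ i)

    height-right : height (suc i) ≡ 3 + toℕ i
    height-right = height-> (ℕ.n<1+n _)

    level span : Vertex (2 + k) → ℕ
    level (x a) = height a
    level y     = suc (toℕ i)
    level z     = suc (toℕ i)
    span y     = 0
    span (x _) = 1
    span z     = 2

    path-arc : ∀ a b → 0 < arc (x a) (x b) → a ≢ inject₁ i × 0 < pathArc a b × arc (x a) (x b) ≡ pathArc a b
    path-arc a b pos with a Fin.≟ inject₁ i
    ... | no a≢i = a≢i , pos , refl

    apex-arc : ∀ a → 0 < apexArc k i a → a ≡ inject₁ i × apexArc k i a ≡ 1 ⊎ a ≡ suc i × apexArc k i a ≡ 2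
    apex-arc a pos with a Fin.≟ inject₁ i
    ... | yes a≡i = inj₁ (a≡i , refl)
    ... | no _ with a Fin.≟ suc i
    ...   | yes a≡1+i = inj₂ (a≡1+i , refl)

    level-lipschitz : Lipschitz level
    level-lipschitz = undirected-lipschitz lip
      where
      apex : ∀ a → 0 < apexArc k i a → height a ≤ apexArc k i a + suc (toℕ i) × suc (toℕ i) ≤ apexArc k i a + height a
      apex a pos with apex-arc a pos
      ... | inj₁ (refl , eq) rewrite eq | height-left = ℕ.m≤n+m _ 2 , ℕ.≤-refl
      ... | inj₂ (refl , eq) rewrite eq | height-right = ℕ.≤-refl , ℕ.m≤n+m _ 4
      lip : ∀ u v → 0 < arc u v → level v ≤ arc u v + level u × level u ≤ arc u v + level v
      lip (x a) (x b) pos with path-arc a b pos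
      ... | a≢i , pos′ , eq rewrite eq = path-lipschitz a b height (height-step a≢i) pos′
      lip y     (x a) pos = apex a pos
      lip z     (x a) pos = apex a pos

    span-lipschitz : Lipschitz span
    span-lipschitz = undirected-lipschitz lip
      where
      lip : ∀ u v → 0 < arc u v → span v ≤ arc u v + span u × span u ≤ arc u v + span v
      lip (x a) (x b) pos = ℕ.m≤n+m _ _ , ℕ.m≤n+m _ _
      lip y     (x a) pos = ℕ.≤-trans pos (ℕ.m≤m+n _ 0) , z≤n
      lip z     (x a) pos = ℕ.≤-trans (s≤s z≤n) (ℕ.m≤n+m 2 _) , ℕ.+-monoˡ-≤ 1 pos

    left-arc : apexArc k i (inject₁ i) ≡ 1
    left-arc = cong (if_then 1 else if does (inject₁ i Fin.≟ suc i) then 2 else 0) (dec-true (inject₁ i Fin.≟ inject₁ i) refl)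

    right-arc : apexArc k i (suc i) ≡ 2
    right-arc = trans (cong (if_then 1 else if does (suc i Fin.≟ suc i) then 2 else 0) (dec-false (suc i Fin.≟ inject₁ i)
        (λ eq → ℕ.1+n≢n (trans (cong toℕ eq) (Fin.toℕ-inject₁ i)))))
      (cong (if_then 2 else 0) (dec-true (suc i Fin.≟ suc i) refl))

    left-y : Tight level (x (inject₁ i)) y
    left-y = tight-edge (edge-weight← arc (x (inject₁ i)) y left-arc refl) (s≤s (ℕ.≤-reflexive height-left))

    left-z : Tight level (x (inject₁ i)) z
    left-z = tight-edge (edge-weight← arc (x (inject₁ i)) z left-arc refl) (s≤s (ℕ.≤-reflexive height-left))

    y-right : Tight level y (x (suc i))
    y-right = tight-edge (edge-weight→ arc y (x (suc i)) right-arc refl) (ℕ.≤-reflexive (sym height-right))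

    z-right : Tight level z (x (suc i))
    z-right = tight-edge (edge-weight→ arc z (x (suc i)) right-arc refl) (ℕ.≤-reflexive (sym height-right))

    consecutive : ∀ j → Tight level (x (inject₁ j)) (x (suc j))
    consecutive j with j Fin.≟ i
    ... | yes refl = tight-trans left-y y-right
    ... | no j≢i   = tight-edge (edge-weight→ arc (x (inject₁ j)) (x (suc j)) forward backward)
      (ℕ.≤-reflexive (sym (height-step j≢i′ (cong suc (Fin.toℕ-inject₁ j)))))
      where
      j≢i′ : inject₁ j ≢ inject₁ i
      j≢i′ = j≢i ∘ Fin.inject₁-injective
      forward : arc (x (inject₁ j)) (x (suc j)) ≡ 1
      forward = trans (cong (if_then 0 else _) (dec-false (inject₁ j Fin.≟ inject₁ i) j≢i′)) (pathArc-forward j)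
      backward : arc (x (suc j)) (x (inject₁ j)) ≡ 0
      backward with does (suc j Fin.≟ inject₁ i)
      ... | true  = refl
      ... | false = pathArc-backward j

    open Thread (R k i) x

    left-of : ∀ {j p} → Tight level (x (inject₁ i)) p → toℕ j < suc (toℕ i) → Tight level (x j) p
    left-of {j} ip (s≤s j≤i) = tight-trans
      (chain level-lipschitz consecutive (subst (toℕ j ≤_) (sym (Fin.toℕ-inject₁ i)) j≤i)) ip

    right-of : ∀ {j p} → Tight level p (x (suc i)) → suc (toℕ i) ≤ toℕ j → Tight level p (x j)
    right-of pi i<j = tight-trans pi (chain level-lipschitz consecutive i<j)

    y-contact : Tight span y (x (inject₁ i))
    y-contact = tight-edge (edge-weight→ arc y (x (inject₁ i)) left-arc refl) ℕ.≤-refl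

    contact-z : Tight span (x (inject₁ i)) z
    contact-z = tight-edge (edge-weight← arc (x (inject₁ i)) z left-arc refl) ℕ.≤-refl

    d-yz : d y z ≡ 2
    d-yz = trans (sym (ℕ.+-identityʳ _)) (tight-d span-lipschitz (tight-trans y-contact contact-z))

    d-left : ∀ j {p} → level p ≡ suc (toℕ i) → Tight level (x (inject₁ i)) p → toℕ j ≤ toℕ i →
             d p (x j) + toℕ j ≡ suc (toℕ i)
    d-left j {p} lp ip j≤i = begin
      d p (x j) + toℕ j         ≡⟨ cong₂ _+_ (d-sym p (x j)) (sym (height-≤ j≤i)) ⟩
      d (x j) p + level (x j)   ≡⟨ tight-d level-lipschitz (left-of ip (s≤s j≤i)) ⟩
      level p                   ≡⟨ lp ⟩
      suc (toℕ i)               ∎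
      where open ≡-Reasoning

    d-right : ∀ j {p} → level p ≡ suc (toℕ i) → Tight level p (x (suc i)) → toℕ i < toℕ j →
              d p (x j) + suc (toℕ i) ≡ 2 + toℕ j
    d-right j {p} lp pi i<j = trans (cong (d p (x j) +_) (sym lp))
      (trans (tight-d level-lipschitz (right-of pi i<j)) (height-> i<j))

    d-twins : ∀ j → d y (x j) ≡ d z (x j)
    d-twins j with toℕ j ≤? toℕ i
    ... | yes j≤i = ℕ.+-cancelʳ-≡ _ _ _ (trans (d-left j refl left-y j≤i) (sym (d-left j refl left-z j≤i)))
    ... | no j≰i  = ℕ.+-cancelʳ-≡ _ _ _ (trans (d-right j refl y-right (ℕ.≰⇒> j≰i)) (sym (d-right j refl z-right (ℕ.≰⇒> j≰i))))

    -- The edges from y and z to the right have weight 2, so only the left end of the deleted edge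
    -- is at distance 1. With `twins` this gives `alone`.
    neighbour : ∀ j → d y (x j) ≡ 1 → toℕ j ≡ toℕ i
    neighbour j one with toℕ j ≤? toℕ i
    ... | yes j≤i = ℕ.suc-injective (trans (cong (_+ toℕ j) (sym one)) (d-left j refl left-y j≤i))
    -- No vertex behind the gap is at distance 1, but the distance formula yields the equation
    -- directly.
    ... | no j≰i  = sym (ℕ.suc-injective (ℕ.suc-injective
      (trans (cong (_+ suc (toℕ i)) (sym one)) (d-right j refl y-right (ℕ.≰⇒> j≰i)))))

  R-config : Config (ℛ i)
  R-config = record
    { label = ↔-id _
    ; frame = record
      { ordered = thread-ordered level-lipschitz consecutive
      ; gap-y   = thread-gap level-lipschitz consecutive (λ _ → left-of left-y) (λ _ → right-of y-right)
      ; gap-z   = thread-gap level-lipschitz consecutive (λ _ → left-of left-z) (λ _ → right-of z-right)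
      ; alone   = λ {j} {l} yzj yzl → Fin.toℕ-injective
          (trans (neighbour j (twins (R k i) d-yz (d-twins j) yzj)) (sym (neighbour l (twins (R k i) d-yz (d-twins l) yzl))))
      }
    ; touches = tight-β span-lipschitz y-contact contact-z
    }

-- Transport along isomorphisms, and the case of three points

↔-≤ : ∀ {m n} → Fin m ↔ Fin n → m ≤ n
↔-≤ e = Fin.injective⇒≤ (↔-injective e)

enumeration : ∀ {n} (B : Betweenness) → order B ≡ n → Fin n ↔ Betweenness.X B
enumeration B refl = Betweenness.enum B

triangle-exists : ∀ (B : Betweenness) → 0 < cosize B → let open Geometry B in ∃[ u ] ∃[ v ] ∃[ w ] Tri u v w
triangle-exists B pos = _ , _ , _ , proj₂ (proj₂ (triangle-lookup (fromℕ< pos))) ∘ Geometry.middle⇒collinear B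
  where open Counting B

module Isomorphic {A B : Betweenness} (iso : A ≅ B) where
  private
    module A = Geometry A
    module B = Geometry B
  open _≅_ iso
  open Inverse bijection using (strictlyInverseˡ)

  pull : ∀ {u v w} → B.β u v w → A.β (from u) (from v) (from w)
  pull {u} {v} {w} uvw = Equivalence.from (preserves (from u) (from v) (from w))
    (β-resp B (sym (strictlyInverseˡ u)) (sym (strictlyInverseˡ v)) (sym (strictlyInverseˡ w)) uvw)

  push : ∀ {u v w} → A.β (from u) (from v) (from w) → B.β u v w
  push {u} {v} {w} uvw = β-resp B (strictlyInverseˡ u) (strictlyInverseˡ v) (strictlyInverseˡ w)
    (Equivalence.to (preserves (from u) (from v) (from w)) uvw)

  push-middle : ∀ {u v w} → A.Middle (from u) (from v) (from w) → B.Middle u v w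
  push-middle (A.mid₁ p) = B.mid₁ (push p)
  push-middle (A.mid₂ p) = B.mid₂ (push p)
  push-middle (A.mid₃ p) = B.mid₃ (push p)

  module _ where
    open Order

    pull-gap : ∀ {m g} {s : Fin m → B.X} {p} → Gap B g s p → Gap A g (from ∘ s) (from p)
    pull-gap gp = record { below  = λ i<j j<g → pull (Gap.below gp i<j j<g)
                         ; around = λ i<g g≤j → pull (Gap.around gp i<g g≤j)
                         ; above  = λ i<j g≤i → pull (Gap.above gp i<j g≤i) }

  module _ where
    open Classification

    pull-contact : ∀ {k} (κ : Kind k) f → Contact B κ f → Contact A κ (from ∘ f)
    pull-contact 𝒬     f = pull
    pull-contact (ℛ i) f = pull
    pull-contact 𝒮     f = pull

    -- Co-size and regularity of a structure isomorphic to one of the graphs are read off the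
    -- transported configuration.
    pull-config : ∀ {k} {κ : Kind k} → Config B κ → Config A κ
    pull-config {κ = κ} C = record
      { label   = ↔-sym bijection ↔-∘ label
      ; frame   = record { ordered = λ i<j j<k → pull (ordered i<j j<k)
                         ; gap-y   = pull-gap gap-y
                         ; gap-z   = pull-gap gap-z
                         ; alone   = λ p q → alone (push-middle p) (push-middle q) }
      ; touches = pull-contact κ _ touches
      }
      where
      open Config C
      open Frame frame

graph-config : ∀ {k} (κ : Kind k) → Classification.Config (𝓑 (graph κ)) κ
graph-config {k} 𝒬     = Q-config k
graph-config {k} (ℛ i) = R-config k i
graph-config {k} 𝒮     = S-config k

-- The two adjacent transpositions generate all orders of three indices.
permutations : ∀ {T : Fin 3 → Fin 3 → Fin 3 → Set} →
               (∀ {i j l} → T i j l → T j i l) → (∀ {i j l} → T i j l → T i l j) → T 0F 1F 2F →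
               ∀ i j l → i ≡ j ⊎ j ≡ l ⊎ i ≡ l ⊎ T i j l
permutations s₁₂ s₂₃ t 0F 0F l  = inj₁ refl
permutations s₁₂ s₂₃ t 1F 1F l  = inj₁ refl
permutations s₁₂ s₂₃ t 2F 2F l  = inj₁ refl
permutations s₁₂ s₂₃ t i  0F 0F = inj₂ (inj₁ refl)
permutations s₁₂ s₂₃ t i  1F 1F = inj₂ (inj₁ refl)
permutations s₁₂ s₂₃ t i  2F 2F = inj₂ (inj₁ refl)
permutations s₁₂ s₂₃ t 0F j  0F = inj₂ (inj₂ (inj₁ refl))
permutations s₁₂ s₂₃ t 1F j  1F = inj₂ (inj₂ (inj₁ refl))
permutations s₁₂ s₂₃ t 2F j  2F = inj₂ (inj₂ (inj₁ refl))
permutations s₁₂ s₂₃ t 0F 1F 2F = inj₂ (inj₂ (inj₂ t))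
permutations s₁₂ s₂₃ t 0F 2F 1F = inj₂ (inj₂ (inj₂ (s₂₃ t)))
permutations s₁₂ s₂₃ t 1F 0F 2F = inj₂ (inj₂ (inj₂ (s₁₂ t)))
permutations s₁₂ s₂₃ t 1F 2F 0F = inj₂ (inj₂ (inj₂ (s₂₃ (s₁₂ t))))
permutations s₁₂ s₂₃ t 2F 0F 1F = inj₂ (inj₂ (inj₂ (s₁₂ (s₂₃ t))))
permutations s₁₂ s₂₃ t 2F 1F 0F = inj₂ (inj₂ (inj₂ (s₁₂ (s₂₃ (s₁₂ t)))))

K₃-triangle : Geometry.Tri (𝓑 K₃) 0F 1F 2F
K₃-triangle (Geometry.mid₁ ())
K₃-triangle (Geometry.mid₂ ())
K₃-triangle (Geometry.mid₃ ())

module ThreePoints (B : Betweenness) (e : Fin 3 ↔ Betweenness.X B) where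
  open Geometry B
  open Counting B
  open Inverse e using (to; from; strictlyInverseˡ)

  three-regular : Regular B
  three-regular (Y , _) = ℕ.<⇒≱ (ℕ.n<1+n 3)
    (Fin.injective⇒≤ (Injection.injective Y ∘ ↔-injective (↔-sym e)))

  same-triple : ∀ {u v w} → Tri u v w → (u , v , w) ≈ (to 0F , to 1F , to 2F)
  same-triple {u} {v} {w} uvw = subst (_≈ (to 0F , to 1F , to 2F)) back
    (distinct (permutations {λ i j l → (to i , to j , to l) ≈ (to 0F , to 1F , to 2F)}
      (≈-trans ≈-swap₁₂) (≈-trans ≈-swap₂₃) ((λ m → m) , λ m → m) (from u) (from v) (from w))
      (subst Tri₃ (sym back) uvw))
    where
    back : (to (from u) , to (from v) , to (from w)) ≡ (u , v , w)
    back = cong₂ _,_ (strictlyInverseˡ u) (cong₂ _,_ (strictlyInverseˡ v) (strictlyInverseˡ w))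
    distinct : ∀ {i j l} {A : Set} → i ≡ j ⊎ j ≡ l ⊎ i ≡ l ⊎ A → Tri (to i) (to j) (to l) → A
    distinct (inj₁ refl)               t = contradiction refl (tri-≢₁₂ t)
    distinct (inj₂ (inj₁ refl))        t = contradiction refl (tri-≢₂₃ t)
    distinct (inj₂ (inj₂ (inj₁ refl))) t = contradiction refl (tri-≢₁₃ t)
    distinct (inj₂ (inj₂ (inj₂ a)))    _ = a

  three-cosize : ∀ {u v w} → Tri u v w → cosize B ≡ 1
  three-cosize uvw = ℕ.≤-antisym
    (cosize-≤ {1} (λ _ → to 0F , to 1F , to 2F) (λ t → 0F , same-triple t))
    (cosize-≥ {1} (λ _ → _) (λ _ → uvw) (λ { {0F} {0F} _ → refl }))

  three-≅ : ∀ {u v w} → Tri u v w → B ≅ 𝓑 K₃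
  three-≅ uvw = ≅-from-agreement e (↔-id _) λ i j l → agree (permutations {λ i j l → Tri (to i) (to j) (to l) × K.Tri i j l}
      (λ (s , t) → tri-swap₁₂ s , K.tri-swap₁₂ t) (λ (s , t) → tri-swap₂₃ s , K.tri-swap₂₃ t)
      (base , K₃-triangle) i j l)
    where
    module K = Geometry (𝓑 K₃)
    base : Tri (to 0F) (to 1F) (to 2F)
    base m = uvw (back (permutations {λ i j l → Middle (to i) (to j) (to l)} swap₁₂ swap₂₃ m _ _ _))
      where
      back : ∀ {u v w} → from u ≡ from v ⊎ from v ≡ from w ⊎ from u ≡ from w ⊎
                         Middle (to (from u)) (to (from v)) (to (from w)) → Middle u v w
      back (inj₁ eq) with ↔-injective (↔-sym e) eq
      ... | refl = mid₂ β-start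
      back (inj₂ (inj₁ eq)) with ↔-injective (↔-sym e) eq
      ... | refl = mid₂ β-end
      back (inj₂ (inj₂ (inj₁ eq))) with ↔-injective (↔-sym e) eq
      ... | refl = mid₃ β-start
      back {u} {v} {w} (inj₂ (inj₂ (inj₂ m))) rewrite strictlyInverseˡ u | strictlyInverseˡ v | strictlyInverseˡ w = m
    agree : ∀ {i j l} → i ≡ j ⊎ j ≡ l ⊎ i ≡ l ⊎ (Tri (to i) (to j) (to l) × K.Tri i j l) →
            Comparison.Agree B (𝓑 K₃) (to i) (to j) (to l) i j l
    agree {i} {l = l} (inj₁ refl)         = Comparison.both₂ β-start (K.β-start {i} {l})
    agree {i} {j} (inj₂ (inj₁ refl))      = Comparison.both₂ β-end (K.β-end {i} {j})
    agree {i} {j} (inj₂ (inj₂ (inj₁ refl))) = Comparison.both₃ β-start (K.β-start {i} {j})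
    agree (inj₂ (inj₂ (inj₂ (t , t′))))   = Comparison.neither t t′

-- The minimum co-size and the structures attaining it

module _ {k} (B : Betweenness) (ord : order B ≡ 4 + k) (reg : Regular B) (pos : 0 < cosize B) where

  near-minimal⇒config : ¬ (2 + k ≤ cosize B) → ∃ (Classification.Config B {k})
  near-minimal⇒config few = few-triangles⇒config B (enumeration B ord) (regular⇒squareless B reg) few
    (proj₂ (proj₂ (proj₂ (triangle-exists B pos))))

  -- A co-size below 2 + k makes the structure a configuration, and then it equals 1 + k.
  cosize-lower-bound : 1 + k ≤ cosize B
  cosize-lower-bound with 2 + k ≤? cosize B
  ... | yes many = ℕ.≤-trans (ℕ.n≤1+n _) many
  ... | no few   = ℕ.≤-reflexive (sym (Configured.config-cosize B (proj₂ (near-minimal⇒config few))))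

τ-three : τ Regular 3 0 1
τ-three = record
  { above    = s≤s z≤n
  ; attained = 𝓑 K₃ , refl , ThreePoints.three-cosize (𝓑 K₃) (↔-id _) {0F} {1F} {2F} K₃-triangle
             , ThreePoints.three-regular (𝓑 K₃) (↔-id _)
  ; minimal  = λ _ 0<m _ → 0<m
  }

Q-inhabits : ∀ k → Inhabited Regular (4 + k) (1 + k)
Q-inhabits k = 𝓑 (Q k) , refl , C.config-cosize , C.config-regular
  where module C = Configured (𝓑 (Q k)) (Q-config k)

τ-four+ : ∀ k → τ Regular (4 + k) 0 (1 + k)
τ-four+ k = record
  { above    = s≤s z≤n
  ; attained = Q-inhabits k
  ; minimal  = λ { _ 0<m (B , ord , refl , reg) → cosize-lower-bound B ord reg 0<m }
  }

Extremal : ℕ → Betweenness → Set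
Extremal n B = (∃[ k ] n ≡ 4 + k × B ≅ 𝓑 (Q k))
  ⊎ (∃[ k ] ∃[ i ] n ≡ 4 + k × B ≅ 𝓑 (R k i))
  ⊎ (∃[ k ] n ≡ 4 + k × B ≅ 𝓑 (S k))
  ⊎ B ≅ 𝓑 K₃

minimum-three : ∀ B → order B ≡ 3 → (Regular B × τ Regular 3 0 (cosize B)) ⇔ Extremal 3 B
minimum-three B ord = mk⇔
  (λ (_ , t) → inj₂ (inj₂ (inj₂ (three-≅ (proj₂ (proj₂ (proj₂ (triangle-exists B (τ.above t)))))))))
  λ where
    (inj₁ (_ , () , _))
    (inj₂ (inj₁ (_ , _ , () , _)))
    (inj₂ (inj₂ (inj₁ (_ , () , _))))
    (inj₂ (inj₂ (inj₂ iso))) → three-regular ,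
      subst (τ Regular 3 0) (sym (three-cosize (K₃-triangle ∘ Isomorphic.push-middle iso))) τ-three
  where open ThreePoints B (enumeration B ord)

minimum-four+ : ∀ k B → order B ≡ 4 + k → (Regular B × τ Regular (4 + k) 0 (cosize B)) ⇔ Extremal (4 + k) B
minimum-four+ k B ord = mk⇔
  (λ (reg , t) → extremal (near-minimal⇒config B ord reg (τ.above t)
    -- Minimality compared with `Q k` bounds the co-size by 1 + k, below the threshold 2 + k.
    (ℕ.<⇒≱ (s≤s (τ.minimal t (1 + k) (s≤s z≤n) (Q-inhabits k))))))
  λ where
    (inj₁ (_ , refl , iso))               → minimum 𝒬 iso
    (inj₂ (inj₁ (_ , i , refl , iso)))    → minimum (ℛ i) iso
    (inj₂ (inj₂ (inj₁ (_ , refl , iso)))) → minimum 𝒮 iso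
    (inj₂ (inj₂ (inj₂ iso)))              → contradiction
      (↔-≤ (_≅_.bijection iso ↔-∘ enumeration B ord)) (ℕ.<⇒≱ (s≤s (s≤s (s≤s (s≤s z≤n)))))
  where
  extremal : ∃ (Classification.Config B {k}) → Extremal (4 + k) B
  extremal (𝒬   , C) = inj₁ (k , refl , configs-isomorphic C (Q-config k))
  extremal (ℛ i , C) = inj₂ (inj₁ (k , i , refl , configs-isomorphic C (R-config k i)))
  extremal (𝒮   , C) = inj₂ (inj₂ (inj₁ (k , refl , configs-isomorphic C (S-config k))))

  minimum : (κ : Kind k) → B ≅ 𝓑 (graph κ) → Regular B × τ Regular (4 + k) 0 (cosize B)
  minimum κ iso = Configured.config-regular B C ,
    subst (τ Regular (4 + k) 0) (sym (Configured.config-cosize B C)) (τ-four+ k)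
    where C = Isomorphic.pull-config iso (graph-config κ)

theorem2 : ∀ (n : ℕ) → 3 ≤ n →
    τ Regular n 0 (1 ⊔ (n ∸ 3)) ×
    (∀ (B : Betweenness) → order B ≡ n →
    (Regular B × τ Regular n 0 (cosize B)) ⇔
    ( (∃[ k ] n ≡ 4 + k × B ≅ 𝓑 (Q k))
    ⊎ (∃[ k ] ∃[ i ] n ≡ 4 + k × B ≅ 𝓑 (R k i))
    ⊎ (∃[ k ] n ≡ 4 + k × B ≅ 𝓑 (S k))
    ⊎ B ≅ 𝓑 K₃ ))
-- `1 ⊔ (n ∸ 3)` reduces to 1 here and to 1 + k in the next clause.
theorem2 3 _ = τ-three , minimum-three
theorem2 (suc (suc (suc (suc k)))) _ = τ-four+ k , minimum-four+ k
theorem2 1 (s≤s ())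
theorem2 2 (s≤s (s≤s ()))
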